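{- Let $p > 3$ be a prime such that $p\equiv 1 \bmod 8$ or $p\equiv 3\bmod 8$. Then there is a Latin square $\mathscr{L}_p$ of order $p$ with $\nu(\mathscr{L}_p)=4$.
   Context: A Latin square of order $n$ is an $n\times n$ matrix on a set of $n$ symbols such that each symbol occurs exactly once in each row and each column. Rows, columns and symbols are all indexed by the same $n$-element set $S$, and $L$ is identified with its set of triples $(i,j,L_{i,j})\in S^3$. For each of the six permutations of the three coordinates, applying that permutation uniformly to all triples of $L$ gives the set of triples of another Latin square, called a conjugate of $L$; thus $L$ has six conjugates, labelled by permutations (and counted with this labelling, even if some of them coincide as squares). For two distinct rows $i,j$ of a Latin square $L$ with symbol set $S$, the row permutation $r_{i,j}:S\to S$ is defined by $r_{i,j}(L_{i,k})=L_{j,k}$ for every column $k$. $L$ is row-Hamiltonian if every row permutation (over all pairs of distinct rows) consists of a single cycle of length $n$. $\nu(L)$ denotes the number of the six conjugates of $L$ that are row-Hamiltonian. -}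

module Defs where

open import Data.Fin using (Fin; toℕ)
open import Data.Fin.Properties using (_≟_; all?; any?)
open import Data.Nat using (ℕ)
open import Data.Nat.GeneralisedArithmetic using (iterate)
open import Data.Product using (∃!; _×_; _,_; proj₁; proj₂)
open import Data.Vec using (Vec; []; _∷_; count)
open import Function.Bundles using (_⇔_; mk⇔)
open import Function.Construct.Composition using (_⇔-∘_)
open import Function.Construct.Identity using (⇔-id)
open import Relation.Binary.PropositionalEquality using (_≡_; _≢_; refl; sym; trans; cong)
open import Relation.Nullary using (Dec)
open import Relation.Nullary.Decidable using (_×-dec_; _→-dec_; ¬?; map′)
open import Relation.Unary using (Decidable)

-- Rows, columns and symbols are all indexed by S = Fin n.
record LatinSquare (n : ℕ) : Set where
  field
    entry        : Fin n → Fin n → Fin n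
    onceInRow    : ∀ i s → ∃! _≡_ λ j → entry i j ≡ s
    onceInColumn : ∀ j s → ∃! _≡_ λ i → entry i j ≡ s

  columnOf : Fin n → Fin n → Fin n
  columnOf i s = proj₁ (onceInRow i s)

  rowOf : Fin n → Fin n → Fin n
  rowOf j s = proj₁ (onceInColumn j s)

  entry-columnOf : ∀ i s → entry i (columnOf i s) ≡ s
  entry-columnOf i s = proj₁ (proj₂ (onceInRow i s))

  columnOf-entry : ∀ i j → columnOf i (entry i j) ≡ j
  columnOf-entry i j = proj₂ (proj₂ (onceInRow i (entry i j))) refl

  entry-rowOf : ∀ j s → entry (rowOf j s) j ≡ s
  entry-rowOf j s = proj₁ (proj₂ (onceInColumn j s))

  rowOf-entry : ∀ i j → rowOf j (entry i j) ≡ i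
  rowOf-entry i j = proj₂ (proj₂ (onceInColumn j (entry i j))) refl

open LatinSquare public

private
  variable
    n : ℕ

Triple : ℕ → Set
Triple n = Fin n × Fin n × Fin n

infix 4 _∈_

_∈_ : Triple n → LatinSquare n → Set
(i , j , k) ∈ L = entry L i j ≡ k

------------------------------------------------------------------------
-- Conjugates

-- The digits say which original coordinate ends up in each position.
data CoordinatePermutation : Set where
  [123] [132] [213] [231] [312] [321] : CoordinatePermutation

coordinatePermutations : Vec CoordinatePermutation 6
coordinatePermutations = [123] ∷ [132] ∷ [213] ∷ [231] ∷ [312] ∷ [321] ∷ []

permute : CoordinatePermutation → Triple n → Triple n
permute [123] (i , j , k) = i , j , k
permute [132] (i , j , k) = i , k , j
permute [213] (i , j , k) = j , i , k
permute [231] (i , j , k) = j , k , i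
permute [312] (i , j , k) = k , i , j
permute [321] (i , j , k) = k , j , i

swapRowsColumns : LatinSquare n → LatinSquare n
swapRowsColumns L = record
  { entry        = λ i j → entry L j i
  ; onceInRow    = onceInColumn L
  ; onceInColumn = onceInRow L
  }

swapColumnsSymbols : LatinSquare n → LatinSquare n
swapColumnsSymbols L = record
  { entry        = columnOf L
  ; onceInRow    = λ i j →
      entry L i j , columnOf-entry L i j ,
      λ {s} eq → trans (cong (entry L i) (sym eq)) (entry-columnOf L i s)
  ; onceInColumn = λ s j →
      rowOf L j s ,
      trans (cong (columnOf L (rowOf L j s)) (sym (entry-rowOf L j s)))
            (columnOf-entry L (rowOf L j s) j) ,
      λ {i} eq → proj₂ (proj₂ (onceInColumn L j s))
        (trans (cong (entry L i) (sym eq)) (entry-columnOf L i s))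
  }

conjugate : CoordinatePermutation → LatinSquare n → LatinSquare n
conjugate [123] L = L
conjugate [132] L = swapColumnsSymbols L
conjugate [213] L = swapRowsColumns L
conjugate [231] L = swapColumnsSymbols (swapRowsColumns L)
conjugate [312] L = swapRowsColumns (swapColumnsSymbols L)
conjugate [321] L = swapColumnsSymbols (swapRowsColumns (swapColumnsSymbols L))

private
  swapColumnsSymbols-∈ : ∀ (L : LatinSquare n) {i j k} →
    (i , j , k) ∈ L ⇔ (i , k , j) ∈ swapColumnsSymbols L
  swapColumnsSymbols-∈ L {i} {j} {k} = mk⇔
    (λ eq → trans (cong (columnOf L i) (sym eq)) (columnOf-entry L i j))
    (λ eq → trans (cong (entry L i) (sym eq)) (entry-columnOf L i k))

-- `conjugate σ L` is the Latin square whose set of triples is obtained by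
-- applying σ to every triple of L.
conjugate-∈ : ∀ σ (L : LatinSquare n) (t : Triple n) →
  t ∈ L ⇔ permute σ t ∈ conjugate σ L
conjugate-∈ [123] L t = ⇔-id _
conjugate-∈ [132] L t = swapColumnsSymbols-∈ L
conjugate-∈ [213] L t = ⇔-id _
conjugate-∈ [231] L t = swapColumnsSymbols-∈ (swapRowsColumns L)
conjugate-∈ [312] L t = swapColumnsSymbols-∈ L
conjugate-∈ [321] L t =
  swapColumnsSymbols-∈ (swapRowsColumns (swapColumnsSymbols L)) ⇔-∘
  swapColumnsSymbols-∈ L

------------------------------------------------------------------------
-- Row permutations

rowPermutation : LatinSquare n → Fin n → Fin n → Fin n → Fin n
rowPermutation L i j s = entry L j (columnOf L i s)

rowPermutation-entry : ∀ (L : LatinSquare n) i j k →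
  rowPermutation L i j (entry L i k) ≡ entry L j k
rowPermutation-entry L i j k = cong (entry L j) (columnOf-entry L i k)

-- From any starting point x, the points x, f x, …, fⁿ⁻¹ x run through every
-- element of Fin n exactly once, and fⁿ x is x again.
IsSingleCycle : (Fin n → Fin n) → Set
IsSingleCycle {n} f = ∀ x →
  (∀ y → ∃! _≡_ λ (k : Fin n) → iterate f x (toℕ k) ≡ y) ×
  iterate f x n ≡ x

RowHamiltonian : LatinSquare n → Set
RowHamiltonian L = ∀ i j → i ≢ j → IsSingleCycle (rowPermutation L i j)

∃!? : ∀ {P : Fin n → Set} → Decidable P → Dec (∃! _≡_ P)
∃!? P? = map′
  (λ (x , px , u) → x , px , λ {y} → u y)
  (λ (x , px , u) → x , px , λ y → u {y})
  (any? λ x → P? x ×-dec all? λ y → P? y →-dec (x ≟ y))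

isSingleCycle? : (f : Fin n → Fin n) → Dec (IsSingleCycle f)
isSingleCycle? {n} f = all? λ x →
  (all? λ y → ∃!? λ k → iterate f x (toℕ k) ≟ y) ×-dec
  (iterate f x n ≟ x)

rowHamiltonian? : (L : LatinSquare n) → Dec (RowHamiltonian L)
rowHamiltonian? L = all? λ i → all? λ j →
  ¬? (i ≟ j) →-dec isSingleCycle? (rowPermutation L i j)

ν : LatinSquare n → ℕ
ν L = count (λ σ → rowHamiltonian? (conjugate σ L)) coordinatePermutations

-- Colour the residues modulo p = 2m + 1 by S and N so that x and -2x always have the same colour, and put entry i
-- j = 2i - j if j - i is coloured S, and 2j - i otherwise. With θ k = k or -2k according to the colour of k, row i
-- has the entries i - θ (j - i), so that (after scaling the colouring by the difference of the two rows) a row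
-- permutation is θ k ↦ θ (k - 1) - 1. To see that it is a single cycle, regard the residues as cut into maximal
-- runs of S and N. Within runs the permutation moves by steps of 1 and 2, and at the ends of the runs it jumps by
-- a factor -2 or -1/2; the runs of the elements -j/2 are the runs of step 2 among the j. A run and the run of step
-- 2 obtained from it are joined, and sweeping once around the circle joins all runs of step 2 except those at the
-- odd places of runs of odd length, which are joined to the rest through longer runs. The transposed square is of
-- the same form.
--
-- A progression of five residues coloured S N N N S gives a 3-cycle in a permutation between two symbols. Let the
-- colouring be the quadratic character, for which -2 is a square if p ≡ 1, 3 mod 8. If neither S N N N S nor N S S
-- S N occurs, the character is rigid: for p ≡ 1 mod 8 the least nonresidue q and the least nonresidue prime to q
-- are the ends of a progression N S S S N; for p ≡ 3 mod 8 a finite search shows that the character agrees up to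
-- 42 with that modulo 3 or 19, then by induction it does so up to p - 1, which contradicts χ (p - j) = -χ j. Only
-- p = 19 is left, where the pattern does not occur and another cyclotomic square does the job.
module Submission where

open import Defs
open import Algebra.Bundles using (CommutativeSemiring)
open import Data.Bool using (Bool; true; false; not; _xor_)
import Data.Bool.Properties as Bool
open import Data.Empty using (⊥)
open import Data.Fin using (Fin; toℕ; fromℕ; fromℕ<; inject₁; #_) renaming (zero to fzero; suc to fsuc)
open import Data.Fin.Properties using
    (_≟_; all?; any?; pigeonhole; injective⇒≤; toℕ<n; toℕ-fromℕ; toℕ-fromℕ<; toℕ-inject₁; toℕ-injective)
open import Data.Integer using (ℤ; +_; -[1+_]; -_; _+_; _*_; _-_; _^_; ∣_∣; -1ℤ)
open import Data.Integer.DivMod using (_%ℕ_; _/ℕ_; a≡a%ℕn+[a/ℕn]*n; n%ℕd<d)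
open import Data.Integer.Divisibility.Signed as ℤ using (divides; ∣ᵤ⇒∣; ∣⇒∣ᵤ)
import Data.Integer.Properties as ℤ
open import Data.Integer.Tactic.RingSolver using (solve-∀)
open import Data.List using (List; []; _∷_)
open import Data.List.Membership.Propositional using () renaming (_∈_ to _∈ₗ_)
open import Data.List.Relation.Unary.All as All using (All; []; _∷_)
open import Data.List.Relation.Unary.Any using (here; there)
open import Data.Maybe using (Maybe; just; nothing; from-just; _>>=_)
open import Data.Nat as ℕ using (ℕ; zero; suc; z≤n; s≤s; s≤s⁻¹; NonZero; _>_)
open import Data.Nat.Combinatorics using (_C_; nCk+nC[k+1]≡[n+1]C[k+1]; nCn≡1)
open import Data.Nat.DivMod using (_%_; _/_; _mod_; m≡m%n+[m/n]*n; m%n<n; m<n⇒m%n≡m)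
open import Data.Nat.Divisibility as ℕ using (_∣?_)
open import Data.Nat.GeneralisedArithmetic using (iterate)
open import Data.Nat.Primality using (Prime; euclidsLemma; prime?; prime⇒irreducible; prime⇒nonTrivial)
import Data.Nat.Properties as ℕ
open import Data.Nat.Tactic.RingSolver using () renaming (solve-∀ to solveℕ-∀)
open import Data.Product using (∃; ∃₂; _×_; _,_; proj₁; proj₂)
open import Data.Sum using (_⊎_; inj₁; inj₂; [_,_]′)
open import Data.Vec using (Vec; []; _∷_; lookup; replicate)
open import Relation.Binary.Definitions using (Tri; tri<; tri≈; tri>)
open import Relation.Binary.PropositionalEquality using
    (_≡_; _≢_; refl; sym; trans; cong; cong₂; subst; subst₂; module ≡-Reasoning)
open import Relation.Nullary using (¬_; Dec; yes; no; does; contradiction)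
open import Relation.Nullary.Decidable using
    (map′; from-yes; from-no; dec-true; dec-false; decidable-stable; ¬?; _×-dec_; _⊎-dec_)
open import Relation.Unary using (Decidable)

-- Exchanging columns and symbols inverts the row permutations up to conjugation, so the six
-- conjugates fall into three pairs; two pairs have to be row-Hamiltonian and the third not. The
-- cycles are hard to follow directly, because the jumps by -2 and -1/2 scatter neighbouring points.
-- But the orbits of a permutation of a finite set are equivalence classes, so the direction of the
-- steps may be forgotten: connectivity is shown for an arbitrary relation of this kind that
-- contains all steps, and for every colouring invariant under -2 in which both colours occur.
-- Squares matter only as such a colouring in which a pattern can be forced. No pattern is located
-- in general: its absence is refuted, and it is found because only finitely many progressions have
-- to be examined. The characters modulo 3 and 19 are the ones that the finite search cannot
-- exclude, since they too have the value -1 at both -1 and 2; this is why the case of 3 modulo 8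
-- needs a second argument that compares the character with them.

least : ∀ {P : ℕ → Set} → Decidable P → ∀ n → P n →
  ∃ λ k → k ℕ.≤ n × P k × (∀ i → i ℕ.< k → ¬ P i)
least P? zero    pn = 0 , z≤n , pn , λ _ ()
least P? (suc n) pn with P? 0
... | yes p0 = 0 , z≤n , p0 , λ _ ()
... | no ¬p0 with k , k≤n , pk , below ← least (λ i → P? (suc i)) n pn =
  suc k , s≤s k≤n , pk , λ where
    zero    _         → ¬p0
    (suc i) (s≤s i<k) → below i i<k

parity : ∀ n → ∃ λ q → n ≡ q ℕ.+ q ⊎ n ≡ suc (q ℕ.+ q)
parity zero = 0 , inj₁ refl
parity (suc n) with parity n
... | q , inj₁ refl = q , inj₂ refl
... | q , inj₂ refl = suc q , inj₁ (cong suc (sym (ℕ.+-suc q q)))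

difference : ∀ {i r} → i ℕ.≤ r → {A : ℕ → Set} → (∀ d → A (i ℕ.+ d)) → A r
difference i≤r {A} f = subst A (proj₂ (ℕ.m≤n⇒∃[o]m+o≡n i≤r)) (f _)

below-or-above : ∀ i r {A : ℕ → Set} → (i ℕ.< r → A i) → (∀ d → A (r ℕ.+ d)) → A i
below-or-above i r {A} below above with ℕ.<-≤-connex i r
... | inj₁ i<r = below i<r
... | inj₂ r≤i = difference r≤i {A} above

-- Residues modulo an odd number

module Modulo (m : ℕ) where

  P μ : ℤ
  P = + 2 * + m + + 1
  μ = + m

  pℕ : ℕ
  pℕ = suc (m ℕ.+ m)

  +p≡P : + pℕ ≡ P
  +p≡P = lem μ
    where
    lem : ∀ x → + 1 + (x + x) ≡ + 2 * x + + 1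
    lem = solve-∀

  infix 4 _≈_
  record _≈_ (x y : ℤ) : Set where
    constructor _,_
    field
      quotient : ℤ
      equation : y ≡ x + quotient * P

  Invertible : Set
  Invertible = ∀ x → ¬ x ≈ + 0 → ∃ λ y → x * y ≈ + 1

  ≈-sym : ∀ {x y} → x ≈ y → y ≈ x
  ≈-sym {x} (k , refl) = - k , lem x k P
    where
    lem : ∀ x k p → x ≡ x + k * p + - k * p
    lem = solve-∀

  abstract
    residue : ∀ x a → ∃ λ n → n ℕ.< pℕ × x ≈ a + + n
    residue x a = (x - a) %ℕ pℕ , n%ℕd<d (x - a) pℕ , - ((x - a) /ℕ pℕ) ,
      trans (lem x a (+ ((x - a) %ℕ pℕ)) ((x - a) /ℕ pℕ) (+ pℕ) (a≡a%ℕn+[a/ℕn]*n (x - a) pℕ))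
          (cong (λ z → x + - ((x - a) /ℕ pℕ) * z) +p≡P)
      where
      lem : ∀ x a r k p → x - a ≡ r + k * p → a + r ≡ x + - k * p
      lem x a r k p eq = trans (lem₁ a r k p) (trans (cong (λ z → a + z + - k * p) (sym eq)) (lem₂ x a k p))
        where
        lem₁ : ∀ a r k p → a + r ≡ a + (r + k * p) + - k * p
        lem₁ = solve-∀
        lem₂ : ∀ x a k p → a + (x - a) + - k * p ≡ x + - k * p
        lem₂ = solve-∀

  +-≈ : ∀ {x y} z → x ≈ y → x + z ≈ y + z
  +-≈ {x} z (k , refl) = k , lem x z k P
    where
    lem : ∀ x z k p → x + k * p + z ≡ x + z + k * p
    lem = solve-∀

  -- Halving modulo P and negating: -2 η(j) ≈ j.
  η : ℤ → ℤ
  η j = μ * j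

  -2η : ∀ j → - (+ 2) * η j ≈ j
  -2η j = j , lem μ j
    where
    lem : ∀ μ j → j ≡ - (+ 2) * (μ * j) + j * (+ 2 * μ + + 1)
    lem = solve-∀

  η-2 : ∀ j i → η (j - + 2 * i) ≈ η j + i
  η-2 j i = i , lem μ j i
    where
    lem : ∀ μ j i → μ * j + i ≡ μ * (j - + 2 * i) + i * (+ 2 * μ + + 1)
    lem = solve-∀

-- Connectivity of the row permutations

module Connectivity
  (m : ℕ) (col : ℤ → Bool)
  (col-periodic : ∀ x k → col (x + k * (+ 2 * + m + + 1)) ≡ col x)
  (col-[-2] : ∀ x → col (- (+ 2) * x) ≡ col x)
  where

  open Modulo m

  -- S and N stand for square and nonsquare.
  S N : ℤ → Set
  S x = col x ≡ false
  N x = col x ≡ true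

  S⊎N : ∀ x → S x ⊎ N x
  S⊎N x with col x
  ... | false = inj₁ refl
  ... | true  = inj₂ refl

  ¬S×N : ∀ {x} → S x → ¬ N x
  ¬S×N s n with () ← trans (sym s) n

  col-≈ : ∀ {x y b} → x ≈ y → col x ≡ b → col y ≡ b
  col-≈ {x} (k , refl) = trans (col-periodic x k)

  col-η : ∀ {j b} → col j ≡ b → col (η j) ≡ b
  col-η {j} e = trans (sym (col-[-2] (η j))) (col-≈ (≈-sym (-2η j)) e)

  θ : ℤ → ℤ
  θ k with col k
  ... | false = k
  ... | true  = - (+ 2) * k

  θ-S : ∀ {k} → S k → θ k ≡ k
  θ-S {k} s with col k
  θ-S refl | false = refl

  θ-N : ∀ {k} → N k → θ k ≡ - (+ 2) * k
  θ-N {k} s with col k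
  θ-N refl | true = refl

  -- Reflexivity is contained in `~-periodic` with k = 0. As θ is a bijection of the residues,
  -- `step` describes the whole permutation.
  module Joined
    (_~_ : ℤ → ℤ → Set)
    (~-sym : ∀ {x y} → x ~ y → y ~ x)
    (~-trans : ∀ {x y z} → x ~ y → y ~ z → x ~ z)
    (~-periodic : ∀ x k → x ~ (x + k * P))
    (step : ∀ k → θ k ~ (θ (k - + 1) - + 1))
    (∃S : ∃ S) (∃N : ∃ N)
    where

    infixr 5 _∙_
    _∙_ : ∀ {x y z} → x ~ y → y ~ z → x ~ z
    _∙_ = ~-trans

    ≈⇒~ : ∀ {x y} → x ≈ y → x ~ y
    ≈⇒~ {x} (k , refl) = ~-periodic x k

    ≡⇒~ : ∀ {x y} → x ≡ y → x ~ y
    ≡⇒~ {x} {y} refl = ≈⇒~ (+ 0 , lem x P)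
      where
      lem : ∀ x p → x ≡ x + + 0 * p
      lem = solve-∀

    SS : ∀ {k} → S k → S (k - + 1) → k ~ (k - + 2)
    SS {k} s t = ≡⇒~ (sym (θ-S s)) ∙ step k ∙ ≡⇒~ (trans (cong (_- + 1) (θ-S t)) (lem k))
      where
      lem : ∀ k → k - + 1 - + 1 ≡ k - + 2
      lem = solve-∀

    SN : ∀ {k} → S k → N (k - + 1) → k ~ (- (+ 2) * k + + 1)
    SN {k} s t = ≡⇒~ (sym (θ-S s)) ∙ step k ∙ ≡⇒~ (trans (cong (_- + 1) (θ-N t)) (lem k))
      where
      lem : ∀ k → - (+ 2) * (k - + 1) - + 1 ≡ - (+ 2) * k + + 1
      lem = solve-∀


    η-pred : ∀ {j b} → col (j + + 2) ≡ b → col (η j - + 1) ≡ b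
    η-pred {j} e = col-≈ (lem j) (col-η e)
      where
      lem : ∀ j → η (j + + 2) ≈ η j - + 1
      lem j = - (+ 1) , lem′ μ j
        where
          lem′ : ∀ μ j → μ * j - + 1 ≡ μ * (j + + 2) + - (+ 1) * (+ 2 * μ + + 1)
          lem′ = solve-∀

    -- Multiplication by -1/2 makes j and j + 2 neighbours: the step is taken at k = -j/2, where k -
    -- 1 = -(j + 2)/2.
    NN : ∀ {j} → N j → N (j + + 2) → j ~ (j + + 1)
    NN {j} s t = ≈⇒~ (≈-sym (-2η j)) ∙ ≡⇒~ (sym (θ-N (col-η s))) ∙ step (η j) ∙
      ≡⇒~ (cong (_- + 1) (θ-N (η-pred t))) ∙ ≈⇒~ (j , lem μ j)
      where
      lem : ∀ μ j → j + + 1 ≡ - (+ 2) * (μ * j - + 1) - + 1 + j * (+ 2 * μ + + 1)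
      lem = solve-∀

    NS : ∀ {j} → N j → S (j + + 2) → j ~ (η j - + 2)
    NS {j} s t = ≈⇒~ (≈-sym (-2η j)) ∙ ≡⇒~ (sym (θ-N (col-η s))) ∙ step (η j) ∙
      ≡⇒~ (cong (_- + 1) (θ-S (η-pred t))) ∙ ≡⇒~ (lem (η j))
      where
      lem : ∀ k → k - + 1 - + 1 ≡ k - + 2
      lem = solve-∀

    -- Maximal runs of S

    Run : ℤ → ℕ → Set
    Run a l = ∀ i → i ℕ.< l → S (a + + i)

    -- `SS` asks nothing of its lower end k - 2, so the colour of a is free; the chain may start at
    -- the N just before a run.
    S-chain : ∀ a q → Run (a + + 1) (q ℕ.+ q) → a ~ (a + + (q ℕ.+ q))
    S-chain a zero    _   = ≡⇒~ (lem a)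
      where
      lem : ∀ a → a ≡ a + + 0
      lem = solve-∀
    S-chain a (suc q) run = S-chain a q (λ i i<q → run i (ℕ.<-≤-trans i<q (ℕ.+-mono-≤ (ℕ.n≤1+n q) (ℕ.n≤1+n q)))) ∙
      ≡⇒~ (lem₁ a (+ q)) ∙ ~-sym (SS (subst S (lem₂ a (+ q)) (run (suc (q ℕ.+ q))
          (s≤s (ℕ.≤-reflexive (sym (ℕ.+-suc q q))))))
                    (subst S (lem₃ a (+ q)) (run (q ℕ.+ q) (s≤s (ℕ.+-monoʳ-≤ q (ℕ.n≤1+n q))))))
      where
      lem₁ : ∀ a q → a + (q + q) ≡ a + (+ 1 + q + (+ 1 + q)) - + 2
      lem₁ = solve-∀
      lem₂ : ∀ a q → a + + 1 + (+ 1 + (q + q)) ≡ a + (+ 1 + q + (+ 1 + q))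
      lem₂ = solve-∀
      lem₃ : ∀ a q → a + + 1 + (q + q) ≡ a + (+ 1 + q + (+ 1 + q)) - + 1
      lem₃ = solve-∀

    -- The points -j/2 for j = a + l - 2, a + l - 4, …, a + 1 of a run of odd length l form a run of
    -- length (l - 1)/2 whose two ends are joined to those of the given run.
    run-ends : ∀ n l a → l ℕ.≤ n → N (a - + 1) → Run a l → N (a + + l) → 1 ℕ.≤ l →
               a ~ (a + + l - + 2)
    run-ends zero    .0 a z≤n _ _ _ ()
    run-ends (suc n) l a l≤n start run end 1≤l with parity l
    ... | zero  , inj₁ refl with () ← 1≤l
    ... | suc q , inj₁ refl = S-chain a q (λ i i<q → subst S (lem a (+ i))
        (run (suc i) (s≤s (ℕ.≤-trans i<q (ℕ.+-monoʳ-≤ q (ℕ.n≤1+n q)))))) ∙ ≡⇒~ (lem₂ a (+ q))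
      where
      lem : ∀ a i → a + (+ 1 + i) ≡ a + + 1 + i
      lem = solve-∀
      lem₂ : ∀ a q → a + (q + q) ≡ a + (+ 1 + q + (+ 1 + q)) - + 2
      lem₂ = solve-∀
    ... | zero  , inj₂ refl = ~-sym (NN start (subst N (lem a) end) ∙ ≡⇒~ (lem₂ a)) ∙ ≡⇒~ (lem₃ a)
      where
      lem : ∀ a → a + + 1 ≡ a - + 1 + + 2
      lem = solve-∀
      lem₂ : ∀ a → a - + 1 + + 1 ≡ a
      lem₂ = solve-∀
      lem₃ : ∀ a → a - + 1 ≡ a + + 1 - + 2
      lem₃ = solve-∀
    -- Steps of 2 lead to the last element a + 2q, which is -2b + 1; `SN` leads back to b, the
    -- halved run to its own end, `NS` back to a - 1, and steps of 2 up to a + l - 2.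
    ... | q@(suc r)  , inj₂ refl =
      S-chain a q (λ i i<2q → subst S (lem₁ a (+ i)) (run (suc i) (s≤s i<2q))) ∙
      ≈⇒~ (ee , lem₂ a Q μ) ∙
      ~-sym (SN Sb Nb) ∙
      run-ends n q b q≤n Nb runb endb (s≤s z≤n) ∙
      ≈⇒~ (- (+ 1) * Q , lem₃ a Q μ) ∙
      ~-sym (NS start (subst S (lem₄ a) (run 1 (s≤s (s≤s z≤n))))) ∙
      S-chain (a - + 1) q (λ i i<2q → subst S (lem₅ a (+ i)) (run i (ℕ.m≤n⇒m≤1+n i<2q))) ∙
      ≡⇒~ (lem₆ a Q)
      where
      Q ee b : ℤ
      Q = + q
      ee = - (a + (Q + Q) - + 1)
      b = η (a + (Q + Q) - + 1)
      q≤n : q ℕ.≤ n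
      q≤n = ℕ.≤-trans (ℕ.m≤m+n q q) (s≤s⁻¹ l≤n)
      lem₁ : ∀ a i → a + (+ 1 + i) ≡ a + + 1 + i
      lem₁ = solve-∀
      lem₂ : ∀ a Q μ → - (+ 2) * (μ * (a + (Q + Q) - + 1)) + + 1 ≡ a + (Q + Q) + - (a + (Q + Q) - + 1) * (+ 2 * μ + + 1)
      lem₂ = solve-∀
      lem₃ : ∀ a Q μ → μ * (a - + 1) - + 2 ≡ μ * (a + (Q + Q) - + 1) + Q - + 2 + - (+ 1) * Q * (+ 2 * μ + + 1)
      lem₃ = solve-∀
      lem₄ : ∀ a → a + + 1 ≡ a - + 1 + + 2
      lem₄ = solve-∀
      lem₅ : ∀ a i → a + i ≡ a - + 1 + + 1 + i
      lem₅ = solve-∀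
      lem₆ : ∀ a Q → a - + 1 + (Q + Q) ≡ a + (+ 1 + (Q + Q)) - + 2
      lem₆ = solve-∀
      runb : Run b q
      runb i i<q with d , refl ← ℕ.m≤n⇒∃[o]m+o≡n i<q =
        col-≈ (η-2 (a + (Q + Q) - + 1) (+ i)) (col-η (subst S (lem a (+ i) (+ d))
            (run (suc (d ℕ.+ d)) (s≤s (s≤s (ℕ.+-mono-≤ d≤ (ℕ.m≤n⇒m≤1+n d≤)))))))
        where
        d≤ : d ℕ.≤ i ℕ.+ d
        d≤ = ℕ.m≤n+m d i
        lem : ∀ a i d → a + (+ 1 + (d + d)) ≡ a + (+ 1 + i + d + (+ 1 + i + d)) - + 1 - + 2 * i
        lem = solve-∀
      Sb : S b
      Sb = subst S (lem b) (runb 0 (s≤s z≤n))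
        where
        lem : ∀ b → b + + 0 ≡ b
        lem = solve-∀
      Nb : N (b - + 1)
      Nb = η-pred (subst N (lem a Q) end)
        where
        lem : ∀ a Q → a + (+ 1 + (Q + Q)) ≡ a + (Q + Q) - + 1 + + 2
        lem = solve-∀
      endb : N (b + + q)
      endb = col-≈ (η-2 (a + (Q + Q) - + 1) Q) (col-η (subst N (lem a Q) start))
        where
        lem : ∀ a Q → a - + 1 ≡ a + (Q + Q) - + 1 - + 2 * Q
        lem = solve-∀

    -- If t and s are the last and the first element of the run of step 2 through j, then KR j v says that v is joined
    -- to t + 1, and KL j v that v is joined to s - 2.
    record KR (j v : ℤ) : Set where
      constructor kr
      field
        q   : ℕ
        run : ∀ i → i ℕ.≤ q → S (j + + 2 * + i)
        end : N (j + + 2 * + q + + 2)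
        v~  : v ~ (j + + 2 * + q + + 1)

    record KL (j v : ℤ) : Set where
      constructor kl
      field
        q   : ℕ
        run : ∀ i → i ℕ.≤ q → S (j - + 2 * + i)
        end : N (j - + 2 * + q - + 2)
        v~  : v ~ (j - + 2 * + q - + 2)

    -- A maximal run of step 2 is, after multiplication by -1/2, a run of step 1.
    KR~KL : ∀ {j v w} → KR j v → KL j w → v ~ w
    KR~KL {j} {v} {w} (kr q right endR v~) (kl q′ left endL w~) =
      v~ ∙ ≈⇒~ (≈-sym (t , lem₁ j Q μ)) ∙
      ~-sym (SN Sb Nb) ∙
      run-ends l l b ℕ.≤-refl Nb runb endb (s≤s z≤n) ∙
      ≈⇒~ (- (Q + Q′ + + 1) , lem₂ j Q Q′ μ) ∙
      ~-sym (NS endL (subst S (lem₃ j Q′) (left q′ ℕ.≤-refl))) ∙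
      ~-sym w~
      where
      Q Q′ t b : ℤ
      Q = + q
      Q′ = + q′
      t = j + + 2 * Q
      b = η t
      l : ℕ
      l = suc (q ℕ.+ q′)
      lem₁ : ∀ j Q μ → j + + 2 * Q + + 1 ≡ - (+ 2) * (μ * (j + + 2 * Q)) + + 1 + (j + + 2 * Q) * (+ 2 * μ + + 1)
      lem₁ = solve-∀
      lem₂ : ∀ j Q Q′ μ → μ * (j - + 2 * Q′ - + 2) - + 2 ≡ μ * (j + + 2 * Q) + (+ 1 + (Q + Q′)) - + 2 + -
          (Q + Q′ + + 1) * (+ 2 * μ + + 1)
      lem₂ = solve-∀
      lem₃ : ∀ j q → j - + 2 * q ≡ j - + 2 * q - + 2 + + 2
      lem₃ = solve-∀
      fromRight : ∀ j i d → j + + 2 * d ≡ j + + 2 * (i + d) - + 2 * i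
      fromRight = solve-∀
      fromLeft : ∀ j q d → j - + 2 * d ≡ j + + 2 * q - + 2 * (q + d)
      fromLeft = solve-∀
      both : ∀ i → i ℕ.< l → S (t - + 2 * + i)
      both i i<l = below-or-above i q {λ i → i ℕ.< l → S (t - + 2 * + i)}
        (λ i<q _ → difference (ℕ.<⇒≤ i<q) {λ n → n ℕ.≤ q → S (j + + 2 * + n - + 2 * + i)}
          (λ d i+d≤q → subst S (fromRight j (+ i) (+ d)) (right d (ℕ.≤-trans (ℕ.m≤n+m d i) i+d≤q))) ℕ.≤-refl)
        (λ d q+d<l → subst S (fromLeft j (+ q) (+ d)) (left d (ℕ.+-cancelˡ-≤ q d q′ (s≤s⁻¹ q+d<l))))
        i<l
      runb : Run b l
      runb i i<l = col-≈ (η-2 t (+ i)) (col-η (both i i<l))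
      Sb : S b
      Sb = subst S (lem b) (runb 0 (s≤s z≤n))
        where
        lem : ∀ b → b + + 0 ≡ b
        lem = solve-∀
      Nb : N (b - + 1)
      Nb = η-pred endR
      endb : N (b + + l)
      endb = col-≈ (η-2 t (+ l)) (col-η (subst N (lem j Q Q′) endL))
        where
        lem : ∀ j Q Q′ → j - + 2 * Q′ - + 2 ≡ j + + 2 * Q - + 2 * (+ 1 + (Q + Q′))
        lem = solve-∀

    -- Blocks on the circle of residues

    First : Bool → ℤ → Set
    First b a = ∃ λ n → n ℕ.< pℕ × col (a + + n) ≡ b × (∀ i → i ℕ.< n → col (a + + i) ≢ b)

    first : ∀ b → (∃ λ x → col x ≡ b) → ∀ a → First b a
    first b (x , cx) a = bounded (residue x a)
      where
      bounded : (∃ λ n → n ℕ.< pℕ × x ≈ a + + n) → First b a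
      bounded (n , n<p , x≈) = least-below (least (λ i → col (a + + i) Bool.≟ b) n (col-≈ x≈ cx))
        where
        least-below : (∃ λ k → k ℕ.≤ n × col (a + + k) ≡ b × (∀ i → i ℕ.< k → col (a + + i) ≢ b)) → First b a
        least-below (k , k≤n , ck , below) = k , ℕ.≤-<-trans k≤n n<p , ck , below

    -- The bound `l<p` makes the induction along growing runs in `before-joined` terminate.
    record Block (a : ℤ) (l : ℕ) : Set where
      constructor block
      field
        before  : N (a - + 1)
        run     : Run a l
        after   : N (a + + l)
        l>0     : 1 ℕ.≤ l
        l<p     : l ℕ.< pℕ

    ¬N⇒S : ∀ {x} → ¬ N x → S x
    ¬N⇒S {x} ¬n with S⊎N x
    ... | inj₁ s = s
    ... | inj₂ n = contradiction n ¬n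

    ¬S⇒N : ∀ {x} → ¬ S x → N x
    ¬S⇒N {x} ¬s with S⊎N x
    ... | inj₁ s = contradiction s ¬s
    ... | inj₂ n = n

    +0 : ∀ a → a + + 0 ≡ a
    +0 = solve-∀

    block-from : ∀ {a} → N (a - + 1) → S a → ∃ (Block a)
    block-from {a} n s = go (first true ∃N a)
      where
      go : First true a → ∃ (Block a)
      go (zero  , _   , nl , _)     = contradiction (subst N (+0 a) nl) (¬S×N s)
      go (suc l , l<p , nl , below) = suc l , block n (λ i i<l → ¬N⇒S (below i i<l)) nl (s≤s z≤n) l<p

    private
      back : ∀ {y n} → y ≈ proj₁ ∃N + + n → N (y - + n)
      back {y} {n} (k , e) = col-≈ (≈-sym {y - + n} {x} (k , trans (lem₂ x (+ n))
          (trans (cong (_- + n) e) (lem₁ y (+ n) k P)))) (proj₂ ∃N)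
        where
        x = proj₁ ∃N
        lem₁ : ∀ y n k p → y + k * p - n ≡ y - n + k * p
        lem₁ = solve-∀
        lem₂ : ∀ x n → x ≡ x + n - n
        lem₂ = solve-∀

      Backwards : ℤ → Set
      Backwards y = ∃ λ n → N (y - + n) × (∀ i → i ℕ.< n → S (y - + i))

      backwards : ∀ y → Backwards y
      backwards y = bounded (residue y (proj₁ ∃N))
        where
        bounded : (∃ λ n → n ℕ.< pℕ × y ≈ proj₁ ∃N + + n) → Backwards y
        bounded (n , _ , y≈) = least-below (least (λ i → col (y - + i) Bool.≟ true) n (back {y} y≈))
          where
          least-below : (∃ λ k → k ℕ.≤ n × N (y - + k) × (∀ i → i ℕ.< k → ¬ N (y - + i))) → Backwards y
          least-below (k , _ , ck , below) = k , ck , λ i i<k → ¬N⇒S (below i i<k)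

    inside : ∀ {a l i} → Block a l → (∀ j → j ℕ.≤ i → S (a + + j)) → i ℕ.< l
    inside {a} {l} {i} blk up = ℕ.≰⇒> λ l≤i → ¬S×N (up l l≤i) (Block.after blk)

    Around : ℤ → Set
    Around y = ∃₂ λ a l → ∃ λ i → Block a l × i ℕ.< l × y ≡ a + + i

    around : ∀ {y} → S y → Around y
    around {y} s = go (backwards y)
      where
      lem : ∀ y → y - + 0 ≡ y
      lem = solve-∀
      lem₁ : ∀ y i → y - (+ 1 + i) ≡ y - i - + 1
      lem₁ = solve-∀
      lem₂ : ∀ y i → y ≡ y - i + i
      lem₂ = solve-∀
      lem₃ : ∀ y j d → y - d ≡ y - (j + d) + j
      lem₃ = solve-∀
      go : Backwards y → Around y
      go (zero  , n , _)    = contradiction (subst N (lem y) n) (¬S×N s)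
      go (suc i , n , back) = enclose (block-from (subst N (lem₁ y (+ i)) n) (back i ℕ.≤-refl))
        where
        up : ∀ j → j ℕ.≤ i → S (y - + i + + j)
        up j j≤i = ascend (ℕ.m≤n⇒∃[o]m+o≡n j≤i)
          where
          ascend : (∃ λ d → j ℕ.+ d ≡ i) → S (y - + i + + j)
          ascend (d , refl) = subst S (lem₃ y (+ j) (+ d)) (back d (s≤s (ℕ.m≤n+m d j)))
        enclose : ∃ (Block (y - + i)) → Around y
        enclose (l , blk) = y - + i , l , i , blk , inside blk up , lem₂ y (+ i)

    block-start : ∀ {a l} → Block a l → S a
    block-start {a} (block _ run _ l>0 _) = subst S (+0 a) (run 0 l>0)

    -- Going left from j in steps of 2 is going right from -j/2 in steps of 1, so the first N after
    -- `η j` marks the end.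
    leftmost : ∀ {j} → S j → ∃ (KL j)
    leftmost {j} s = go (first true ∃N (η j))
      where
      lem : ∀ j q → j - + 2 * (+ 1 + q) ≡ j - + 2 * q - + 2
      lem = solve-∀
      go : First true (η j) → ∃ (KL j)
      go (zero , _ , n , _) = contradiction (subst N (+0 (η j)) n) (¬S×N (col-η s))
      go (suc q , _ , n , below) = j - + 2 * + q - + 2 , kl q
        (λ i i≤q → ¬N⇒S λ n′ → below i (s≤s i≤q) (col-≈ (η-2 j (+ i)) (col-η n′)))
        (¬S⇒N (λ s′ → ¬S×N (col-≈ (η-2 j (+ suc q)) (col-η (subst S (sym (lem j (+ q))) s′))) n))
        (≡⇒~ refl)

    Start : ℤ → Set
    Start a = N (a - + 1) × S a

    -- The sweep around the circle

    module Swept (a₀ w₀ : ℤ) (start₀ : Start a₀) (leftmost₀ : KL a₀ w₀) where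

      -- The invariant of the sweep: the right end of the run of step 2 through j is joined to w₀.
      -- Quantifying over `KR` leaves that end to be supplied where it is known.
      record Good (j : ℤ) : Set where
        constructor mkGood
        field
          KR⇒~ : ∀ {v} → KR j v → v ~ w₀
      open Good

      good-KL : ∀ {j w} → KL j w → w ~ w₀ → Good j
      good-KL l w~ = mkGood λ r → KR~KL r l ∙ w~

      good-start : Good a₀
      good-start = good-KL leftmost₀ (≡⇒~ refl)

      good-≈ : ∀ {j j′} → j ≈ j′ → Good j → Good j′
      good-≈ {j} {j′} j≈j′ good = mkGood λ (kr q right end v~) → KR⇒~ good
        (kr q (λ i i≤q → col-≈ (+-≈ (+ 2 * + i) (≈-sym j≈j′)) (right i i≤q))
         (subst N (ass″ j (+ q)) (col-≈ (+-≈ (+ 2 * + q + + 2) (≈-sym j≈j′)) (subst N (sym (ass″ j′ (+ q))) end)))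
         (v~ ∙ ≡⇒~ (ass′ j′ (+ q)) ∙ ≈⇒~ (+-≈ (+ 2 * + q + + 1) (≈-sym j≈j′)) ∙ ≡⇒~ (sym (ass′ j (+ q)))))
        where
        ass′ : ∀ j q → j + + 2 * q + + 1 ≡ j + (+ 2 * q + + 1)
        ass′ = solve-∀
        ass″ : ∀ j q → j + (+ 2 * q + + 2) ≡ j + + 2 * q + + 2
        ass″ = solve-∀

      -- Both points lie in one run of step 2 and share its right end.
      good-extend : ∀ {j} r → (∀ i → i ℕ.< r → S (j + + 2 * + i)) → Good j → Good (j + + 2 * + r)
      good-extend {j} r left good = mkGood λ (kr q right end v~) → KR⇒~ good
        (kr (r ℕ.+ q) (all q right) (subst N (lem j (+ r) (+ q) (+ 2)) end) (v~ ∙ ≡⇒~ (lem j (+ r) (+ q) (+ 1))))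
        where
        lem : ∀ j r q c → j + + 2 * r + + 2 * q + c ≡ j + + 2 * (r + q) + c
        lem = solve-∀
        lem₂ : ∀ j r q → j + + 2 * r + + 2 * q ≡ j + + 2 * (r + q)
        lem₂ = solve-∀
        all : ∀ q → (∀ i → i ℕ.≤ q → S (j + + 2 * + r + + 2 * + i)) → ∀ i → i ℕ.≤ r ℕ.+ q → S (j + + 2 * + i)
        all q right i i≤ = below-or-above i r {λ i → i ℕ.≤ r ℕ.+ q → S (j + + 2 * + i)} (λ i<r _ → left i i<r)
          (λ d r+d≤ → subst S (lem₂ j (+ r) (+ d)) (right d (ℕ.+-cancelˡ-≤ r d q r+d≤))) i≤

      private
        2*< : ∀ {i r} → i ℕ.≤ r → i ℕ.+ i ℕ.≤ r ℕ.+ r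
        2*< i≤r = ℕ.+-mono-≤ i≤r i≤r

        dbl : ∀ a i → a + (i + i) ≡ a + + 2 * i
        dbl = solve-∀

        run-from-before : ∀ {a l} → Block a l → ∀ q → q ℕ.+ q ℕ.≤ l → (a - + 1) ~ (a - + 1 + + (q ℕ.+ q))
        run-from-before {a} blk q 2q≤l = S-chain (a - + 1) q λ i i<2q → subst S (lem a (+ i))
            (Block.run blk i (ℕ.<-≤-trans i<2q 2q≤l))
          where
          lem : ∀ a i → a + i ≡ a - + 1 + + 1 + i
          lem = solve-∀

      -- From an odd place of a block, steps of 2 to the left end at a + 1, because a - 1 is N.
      odd-KL : ∀ {a l} r → Block a l → r ℕ.+ r ℕ.+ 1 ℕ.< l → KL (a + + (r ℕ.+ r ℕ.+ 1)) (a - + 1)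
      odd-KL {a} {l} r (block before run _ _ _) r< = kl r all (subst N (lem a (+ r)) before) (≡⇒~ (lem a (+ r)))
        where
        lem : ∀ a r → a - + 1 ≡ a + (r + r + + 1) - + 2 * r - + 2
        lem = solve-∀
        lem₂ : ∀ a i d → a + (d + d + + 1) ≡ a + (i + d + (i + d) + + 1) - + 2 * i
        lem₂ = solve-∀
        all : ∀ i → i ℕ.≤ r → S (a + + (r ℕ.+ r ℕ.+ 1) - + 2 * + i)
        all i i≤r = difference i≤r {λ r → r ℕ.+ r ℕ.+ 1 ℕ.< l → S (a + + (r ℕ.+ r ℕ.+ 1) - + 2 * + i)} (λ d r< →
          subst S (lem₂ a (+ i) (+ d)) (run (d ℕ.+ d ℕ.+ 1) (ℕ.≤-<-trans (ℕ.+-monoˡ-≤ 1 (2*< (ℕ.m≤n+m d i))) r<))) r<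

      good-even : ∀ {a l} r → Block a l → r ℕ.+ r ℕ.< l → Good a → Good (a + + (r ℕ.+ r))
      good-even {a} r blk 2r<l good = subst Good (sym (dbl a (+ r))) (good-extend r
        (λ i i<r → subst S (dbl a (+ i)) (Block.run blk (i ℕ.+ i) (ℕ.≤-<-trans (2*< (ℕ.<⇒≤ i<r)) 2r<l))) good)

      -- The even places end at a + 2r, so a + 2r + 1 is the right end belonging to a; steps of 2
      -- through the odd places join it to a - 1.
      even-before : ∀ {a} r → Block a (suc r ℕ.+ suc r) → Good a → (a - + 1) ~ w₀
      even-before {a} r blk good = run-from-before blk (suc r) ℕ.≤-refl ∙ ≡⇒~ (lem₁ a (+ r)) ∙
        KR⇒~ good (kr r (λ i i≤r → subst S (dbl a (+ i)) (Block.run blk (i ℕ.+ i)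
            (s≤s (ℕ.≤-trans (2*< i≤r) (ℕ.+-monoʳ-≤ r (ℕ.n≤1+n r))))))
              (subst N (lem₂ a (+ r)) (Block.after blk)) (≡⇒~ refl))
        where
        lem₁ : ∀ a r → a - + 1 + (+ 1 + r + (+ 1 + r)) ≡ a + + 2 * r + + 1
        lem₁ = solve-∀
        lem₂ : ∀ a r → a + (+ 1 + r + (+ 1 + r)) ≡ a + + 2 * r + + 2
        lem₂ = solve-∀

      good-last : ∀ {a l} → Block a l → Good a → Good (a + + l - + 1)
      good-last {a} {l} blk good = byParity (parity l) blk
        where
        lem : ∀ a r → a + (r + r) ≡ a + (+ 1 + (r + r)) - + 1
        lem = solve-∀
        lem₂ : ∀ a r → a + (r + r + + 1) ≡ a + (+ 1 + r + (+ 1 + r)) - + 1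
        lem₂ = solve-∀
        byParity : (∃ λ r → l ≡ r ℕ.+ r ⊎ l ≡ suc (r ℕ.+ r)) → Block a l → Good (a + + l - + 1)
        byParity (r     , inj₂ refl) blk = subst Good (lem a (+ r)) (good-even r blk ℕ.≤-refl good)
        byParity (zero  , inj₁ refl) blk = contradiction (Block.l>0 blk) λ ()
        byParity (suc r , inj₁ refl) blk = subst Good (lem₂ a (+ r)) (good-KL (odd-KL r blk
          (s≤s (ℕ.≤-reflexive (trans (ℕ.+-assoc r r 1) (cong (r ℕ.+_) (ℕ.+-comm r 1))))))
          (even-before r blk good))

      N-chain : ∀ {b} h → (∀ i → i ℕ.< suc (suc h) → N (b + + i)) → b ~ (b + + h)
      N-chain {b} zero    _  = ≡⇒~ (sym (+0 b))
      N-chain {b} (suc h) ns = N-chain h (λ i i< → ns i (ℕ.m≤n⇒m≤1+n i<)) ∙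
        NN (ns h (s≤s (ℕ.≤-trans (ℕ.n≤1+n h) (ℕ.n≤1+n _)))) (subst N (lem b (+ h) (+ 2)) (ns (suc (suc h)) ℕ.≤-refl)) ∙
        ≡⇒~ (sym (lem b (+ h) (+ 1)))
        where
        lem : ∀ b h c → b + (c + h) ≡ b + h + c
        lem = solve-∀

      -- A gap of a single N does not interrupt the run of step 2. In a longer gap the first point
      -- is the right end for the block before it and the last point but one the left end for the
      -- block after it, and steps of 1 join the two.
      good-gap : ∀ {b} g → S (b - + 1) → (∀ i → i ℕ.< suc g → N (b + + i)) → S (b + + suc g) →
                 Good (b - + 1) → Good (b + + suc g)
      good-gap {b} zero s ns s′ good = subst Good (lem b) (good-extend 1
          (λ { zero _ → subst S (lem₂ b) s ; (suc _) (s≤s ()) }) good)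
        where
        lem : ∀ b → b - + 1 + + 2 * + 1 ≡ b + + 1
        lem = solve-∀
        lem₂ : ∀ b → b - + 1 ≡ b - + 1 + + 2 * + 0
        lem₂ = solve-∀
      good-gap {b} (suc h) s ns s′ good = good-KL
        (kl 0 (λ { zero _ → subst S (lem₁ (b + + (suc (suc h)))) s′ }) (subst N (lem₂ b (+ h))
            (ns h (s≤s (ℕ.n≤1+n h)))) (≡⇒~ (lem₂ b (+ h))))
        (~-sym (N-chain h ns) ∙ KR⇒~ good (kr 0 (λ { zero _ → subst S (lem₃ (b - + 1)) s })
            (subst N (lem₄ b) (ns 1 (s≤s (s≤s z≤n)))) (≡⇒~ (lem₅ b))))
        where
        lem₁ : ∀ x → x ≡ x - + 2 * + 0
        lem₁ = solve-∀
        lem₂ : ∀ b h → b + h ≡ b + (+ 2 + h) - + 2 * + 0 - + 2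
        lem₂ = solve-∀
        lem₃ : ∀ x → x ≡ x + + 2 * + 0
        lem₃ = solve-∀
        lem₄ : ∀ b → b + + 1 ≡ b - + 1 + + 2 * + 0 + + 2
        lem₄ = solve-∀
        lem₅ : ∀ b → b ≡ b - + 1 + + 2 * + 0 + + 1
        lem₅ = solve-∀

      private
        +-split : ∀ a l i → a + + (l ℕ.+ i) ≡ a + + l + + i
        +-split a l i = lem a (+ l) (+ i)
          where
          lem : ∀ a l i → a + (l + i) ≡ a + l + i
          lem = solve-∀

        pred-suc : ∀ a i → a + + suc i - + 1 ≡ a + + i
        pred-suc a i = lem a (+ i)
          where
          lem : ∀ a i → a + (+ 1 + i) - + 1 ≡ a + i
          lem = solve-∀

      Start-next : ℤ → Set
      Start-next a = ∃ λ n → Good (a + + suc n) × Start (a + + suc n) × (∀ i → i ℕ.< n → ¬ Start (a + + suc i))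

      start-next : ∀ {a} → Start a → Good a → Start-next a
      start-next {a} (n , s) good = after-block (block-from n s)
        where
        after-block : ∃ (Block a) → Start-next a
        after-block (suc l , blk@(block _ run end _ _)) = after-gap (first false ∃S (a + + suc l))
          where
          b = a + + suc l
          after-gap : First false b → Start-next a
          after-gap (zero  , _ , s′ , _)     = contradiction end (¬S×N (subst S (+0 b) s′))
          after-gap (suc g , _ , s′ , below) = l ℕ.+ suc g ,
            subst Good (sym (+-split a (suc l) (suc g))) (good-gap {b} g
                (subst S (sym (pred-suc a l)) (run l ℕ.≤-refl)) gap s′ (good-last blk good)) ,
            (subst N (sym (trans (cong (_- + 1) (+-split a (suc l) (suc g))) (pred-suc b g))) (gap g ℕ.≤-refl) ,
             subst S (sym (+-split a (suc l) (suc g))) s′) ,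
            none
            where
            gap : ∀ i → i ℕ.< suc g → N (b + + i)
            gap i i<g = ¬S⇒N (below i i<g)
            none : ∀ i → i ℕ.< l ℕ.+ suc g → ¬ Start (a + + suc i)
            none i i<n (n′ , s″) = below-or-above i l {λ i → i ℕ.< l ℕ.+ suc g → ¬ Start (a + + suc i)}
              (λ i<l _ (n′ , _) → ¬S×N (run _ (ℕ.m≤n⇒m≤1+n i<l)) (subst N (pred-suc a _) n′))
              (λ d l+d< (_ , s″) → ¬S×N s″ (subst N (sym (+-split a (suc l) d))
                  (gap d (ℕ.+-cancelˡ-< l d (suc g) l+d<))))
              i<n (n′ , s″)

      good-starts : ∀ f {a} n → n ℕ.< f → Start a → Good a → Start (a + + n) → Good (a + + n)
      good-starts zero    n ()
      good-starts (suc f) {a} zero    n<f st good _ = subst Good (sym (+0 a)) good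
      good-starts (suc f) {a} (suc n) n<f st good st′ = go (start-next st good)
        where
        go : Start-next a → Good (a + + suc n)
        go (k , good′ , st″ , none) = compare (ℕ.≤-<-connex k n)
          where
          continue : (∃ λ d → k ℕ.+ d ≡ n) → Good (a + + suc n)
          continue (d , refl) = subst Good (sym (+-split a (suc k) d))
            (good-starts f d (ℕ.≤-<-trans (ℕ.m≤n+m d k) (s≤s⁻¹ n<f)) st″ good′ (subst Start (+-split a (suc k) d) st′))
          compare : k ℕ.≤ n ⊎ n ℕ.< k → Good (a + + suc n)
          compare (inj₁ k≤n) = continue (ℕ.m≤n⇒∃[o]m+o≡n k≤n)
          compare (inj₂ n<k) = contradiction st′ (none n n<k)

      start-good : ∀ {b} → Start b → Good b
      start-good {b} st = go (residue b a₀)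
        where
        go : (∃ λ n → n ℕ.< pℕ × b ≈ a₀ + + n) → Good b
        go (n , _ , b≈) = good-≈ (≈-sym b≈) (good-starts (suc n) n ℕ.≤-refl start₀ good-start
          (col-≈ (+-≈ (- (+ 1)) b≈) (proj₁ st) , col-≈ b≈ (proj₂ st)))

      block-good : ∀ {a l} → Block a l → Good a
      block-good blk = start-good (Block.before blk , block-start blk)

      private
        -- The run of step 2 through -2a stops there, since -2a + 2 = -2(a - 1) is N.
        KR-double : ∀ {a l} → Block a l → KR (- (+ 2) * a) (- (+ 2) * a + + 1)
        KR-double {a} blk = kr 0 (λ { zero _ → subst S (lem (- (+ 2) * a)) (trans (col-[-2] a) (block-start blk)) })
          (subst N (lem₂ a) (trans (col-[-2] (a - + 1)) (Block.before blk))) (≡⇒~ (lem₃ (- (+ 2) * a)))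
          where
          lem : ∀ x → x ≡ x + + 2 * + 0
          lem = solve-∀
          lem₂ : ∀ a → - (+ 2) * (a - + 1) ≡ - (+ 2) * a + + 2 * + 0 + + 2
          lem₂ = solve-∀
          lem₃ : ∀ x → x + + 1 ≡ x + + 2 * + 0 + + 1
          lem₃ = solve-∀

        double : ∀ {a l} → Block a l → a ~ (- (+ 2) * a + + 1)
        double blk = SN (block-start blk) (Block.before blk)

      -- For odd length the climb from a - 1 in steps of 2 ends at a + l - 2, which `run-ends` joins
      -- to a.
      odd-before : ∀ {a} r → Block a (suc (r ℕ.+ r)) → (a - + 1) ~ a
      odd-before {a} r blk@(block before run after l>0 _) = run-from-before blk r (ℕ.n≤1+n _) ∙ ≡⇒~ (lem a (+ r)) ∙
        ~-sym (run-ends _ _ a ℕ.≤-refl before run after l>0)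
        where
        lem : ∀ a r → a - + 1 + (r + r) ≡ a + (+ 1 + (r + r)) - + 2
        lem = solve-∀

      -- In a run of odd length the elements at odd places are tied to the run itself; multiplying by -2
      -- either escapes from such places or leads to a longer run.
      before-joined : ∀ f {a} l → pℕ ℕ.≤ l ℕ.+ f → Block a l → (a - + 1) ~ w₀
      before-joined zero    l p≤l blk = contradiction (Block.l<p blk) (ℕ.≤⇒≯ (subst (pℕ ℕ.≤_) (ℕ.+-identityʳ l) p≤l))
      before-joined (suc f) {a} l p≤l blk = byParity (parity l) blk
        where
        byParity : (∃ λ r → l ≡ r ℕ.+ r ⊎ l ≡ suc (r ℕ.+ r)) → Block a l → (a - + 1) ~ w₀
        byParity (zero  , inj₁ refl) blk = contradiction (Block.l>0 blk) λ ()
        byParity (suc r , inj₁ refl) blk = even-before r blk (block-good blk)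
        byParity (r     , inj₂ refl) blk = odd-before r blk ∙ double blk ∙ go
            (around (trans (col-[-2] a) (block-start blk)))
          where
          go : Around (- (+ 2) * a) → (- (+ 2) * a + + 1) ~ w₀
          go (a′ , l′ , i , blk′ , i<l′ , eq) = inner (parity i)
            where
            inner : (∃ λ k → i ≡ k ℕ.+ k ⊎ i ≡ suc (k ℕ.+ k)) → (- (+ 2) * a + + 1) ~ w₀
            inner (k , inj₁ refl) = KR⇒~ (subst Good (sym eq) (good-even k blk′ i<l′ (block-good blk′))) (KR-double blk)
            inner (k , inj₂ refl) = KR~KL (KR-double blk)
              (subst (λ x → KL x (a′ - + 1)) (sym (trans eq (cong (λ n → a′ + + n) (ℕ.+-comm 1 (k ℕ.+ k)))))
                (odd-KL k blk′ (subst (ℕ._< l′) (ℕ.+-comm 1 (k ℕ.+ k)) i<l′))) ∙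
              before-joined f l′ (ℕ.≤-trans p≤l (ℕ.≤-trans (ℕ.≤-reflexive (ℕ.+-suc l f)) (ℕ.+-monoˡ-≤ f l<l′))) blk′
              where
              lem : ∀ a a′ k → - (+ 2) * a ≡ a′ + (+ 1 + (k + k)) → a′ - + 1 ≡ - (+ 2) * (a + (+ 1 + k))
              lem a a′ k e = trans (lem₁ a a′ k) (trans (cong (_- (+ 2 + (k + k))) (sym e)) (lem₂ a k))
                where
                lem₁ : ∀ a a′ k → a′ - + 1 ≡ a′ + (+ 1 + (k + k)) - (+ 2 + (k + k))
                lem₁ = solve-∀
                lem₂ : ∀ a k → - (+ 2) * a - (+ 2 + (k + k)) ≡ - (+ 2) * (a + (+ 1 + k))
                lem₂ = solve-∀
              -- Here a′ - 1 = -2(a + k + 1) is N, hence a + k + 1 is N and lies beyond the run of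
              -- length l. So l ≤ k + 1, while l′ exceeds 2k + 1.
              l≤1+k : l ℕ.≤ suc k
              l≤1+k = ℕ.≮⇒≥ λ k<l → ¬S×N (Block.run blk (suc k) k<l)
                (trans (sym (col-[-2] (a + + suc k))) (subst N (lem a a′ (+ k) eq) (Block.before blk′)))
              l<l′ : suc l ℕ.≤ l′
              l<l′ = ℕ.≤-trans (s≤s l≤1+k) (ℕ.≤-trans (s≤s (s≤s (ℕ.m≤m+n k k))) i<l′)

      block-before : ∀ {a l} → Block a l → (a - + 1) ~ w₀
      block-before {a} {l} = before-joined pℕ l (ℕ.m≤n+m pℕ l)

      double-joined : ∀ {a l} → Block a l → (- (+ 2) * a + + 1) ~ w₀
      double-joined {a} blk = go (around (trans (col-[-2] a) (block-start blk)))
        where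
        go : Around (- (+ 2) * a) → (- (+ 2) * a + + 1) ~ w₀
        go (a′ , l′ , i , blk′ , i<l′ , eq) = inner (parity i)
          where
          inner : (∃ λ k → i ≡ k ℕ.+ k ⊎ i ≡ suc (k ℕ.+ k)) → (- (+ 2) * a + + 1) ~ w₀
          inner (k , inj₁ refl) = KR⇒~ (subst Good (sym eq) (good-even k blk′ i<l′ (block-good blk′))) (KR-double blk)
          inner (k , inj₂ refl) = KR~KL (KR-double blk)
            (subst (λ x → KL x (a′ - + 1)) (sym (trans eq (cong (λ n → a′ + + n) (ℕ.+-comm 1 (k ℕ.+ k)))))
              (odd-KL k blk′ (subst (ℕ._< l′) (ℕ.+-comm 1 (k ℕ.+ k)) i<l′))) ∙ block-before blk′

      start-joined : ∀ {a l} → Block a l → a ~ w₀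
      start-joined blk = double blk ∙ double-joined blk

      -- Steps of 2 join the even places of a block to its start a and the odd places to a - 1.
      S-joined : ∀ {u} → S u → u ~ w₀
      S-joined {u} s = go (around s)
        where
        go : Around u → u ~ w₀
        go (a , l , i , blk , i<l , refl) = inner (parity i)
          where
          lem : ∀ a i → a + (+ 1 + i) ≡ a + + 1 + i
          lem = solve-∀
          lem₂ : ∀ a i → a - + 1 + (+ 1 + i + (+ 1 + i)) ≡ a + (+ 1 + (i + i))
          lem₂ = solve-∀
          inner : (∃ λ k → i ≡ k ℕ.+ k ⊎ i ≡ suc (k ℕ.+ k)) → (a + + i) ~ w₀
          inner (k , inj₁ refl) = ~-sym (S-chain a k λ j j<2k → subst S (lem a (+ j))
              (Block.run blk (suc j) (ℕ.≤-<-trans j<2k i<l))) ∙ start-joined blk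
          inner (k , inj₂ refl) = ≡⇒~ (sym (lem₂ a (+ k))) ∙
            ~-sym (run-from-before blk (suc k) (ℕ.≤-trans (ℕ.≤-reflexive
                (cong suc (ℕ.+-suc k k))) i<l)) ∙ block-before blk

      -- -u/2 - 2 is the last but one element of the run ending in -u/2 - 1.
      NS-joined : ∀ {u} → N u → S (u + + 2) → u ~ w₀
      NS-joined {u} n s = NS n s ∙ go (around (η-pred s))
        where
        lem : ∀ x → x ≡ x - + 1 + + 1
        lem = solve-∀
        go : Around (η u - + 1) → (η u - + 2) ~ w₀
        go (a , l , i , blk@(block before run after l>0 _) , i<l , eq) = ≡⇒~ (lem₂ (η u) a (+ i) eq) ∙ ≡⇒~
            (cong (λ n → a + + n - + 2) (sym last)) ∙
          ~-sym (run-ends l l a ℕ.≤-refl before run after l>0) ∙ start-joined blk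
          where
          lem₂ : ∀ x a i → x - + 1 ≡ a + i → x - + 2 ≡ a + (+ 1 + i) - + 2
          lem₂ x a i e = trans (lem₃ x) (trans (cong (_- + 1) e) (lem₄ a i))
            where
            lem₃ : ∀ x → x - + 2 ≡ x - + 1 - + 1
            lem₃ = solve-∀
            lem₄ : ∀ a i → a + i - + 1 ≡ a + (+ 1 + i) - + 2
            lem₄ = solve-∀
          lem₅ : ∀ x a i → x - + 1 ≡ a + i → x ≡ a + (+ 1 + i)
          lem₅ x a i e = trans (lem x) (trans (cong (_+ + 1) e) (lem₆ a i))
            where
            lem₆ : ∀ a i → a + i + + 1 ≡ a + (+ 1 + i)
            lem₆ = solve-∀
          last : l ≡ suc i
          last = ℕ.≤-antisym (ℕ.≮⇒≥ λ 1+i<l → ¬S×N (run (suc i) 1+i<l) (subst N (lem₅ (η u) a (+ i) eq) (col-η n))) i<l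

      private
        -- As long as u + 2 is N, `NN` moves one place towards the next S; once it is S, `NS-joined`
        -- applies.
        N-joined-within : ∀ n u → S (u + + n) → (∀ i → i ℕ.< n → N (u + + i)) → u ~ w₀
        N-joined-within zero u s ns = S-joined (subst S (+0 u) s)
        N-joined-within (suc zero) u s ns = compare (S⊎N (u + + 2))
          where
          n₀ : N u
          n₀ = subst N (+0 u) (ns 0 (s≤s z≤n))
          compare : S (u + + 2) ⊎ N (u + + 2) → u ~ w₀
          compare (inj₁ s₂) = NS-joined n₀ s₂
          compare (inj₂ n₂) = NN n₀ n₂ ∙ S-joined s
        N-joined-within (suc (suc zero)) u s ns = NS-joined (subst N (+0 u) (ns 0 (s≤s z≤n))) s
        N-joined-within (suc n@(suc (suc _))) u s ns = NN (subst N (+0 u) (ns 0 (s≤s z≤n)))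
            (ns 2 (s≤s (s≤s (s≤s z≤n)))) ∙
          N-joined-within n (u + + 1) (subst S (+-split u 1 n) s) (λ i i<n → subst N (+-split u 1 i)
              (ns (suc i) (s≤s i<n)))

      joined : ∀ u → u ~ w₀
      joined u = go (first false ∃S u)
        where
        go : First false u → u ~ w₀
        go (n , _ , s , below) = N-joined-within n u s (λ i i<n → ¬S⇒N (below i i<n))

    connected : ∀ u v → u ~ v
    connected u v = from (around (proj₂ ∃S))
      where
      from : Around (proj₁ ∃S) → u ~ v
      from (a , _ , _ , blk , _) = via (leftmost (block-start blk))
        where
        via : ∃ (KL a) → u ~ v
        via (w , kl₀) = joined u ∙ ~-sym (joined v)
          where open Swept a w (Block.before blk , block-start blk) kl₀

-- Single cycles

module _ {n : ℕ} (f : Fin n → Fin n) where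

  Reach : Fin n → Fin n → Set
  Reach x y = ∃ λ k → iterate f x k ≡ y

  iterate-+ : ∀ x a b → iterate f x (a ℕ.+ b) ≡ iterate f (iterate f x a) b
  iterate-+ x zero    b = refl
  iterate-+ x (suc a) b = iterate-+ (f x) a b

  reach-trans : ∀ {x y z} → Reach x y → Reach y z → Reach x z
  reach-trans {x} (a , refl) (b , refl) = a ℕ.+ b , iterate-+ x a b

  iterate-* : ∀ {x} m → iterate f x m ≡ x → ∀ q → iterate f x (q ℕ.* m) ≡ x
  iterate-* m e zero    = refl
  iterate-* {x} m e (suc q) = trans (iterate-+ x m (q ℕ.* m)) (trans (cong (λ y → iterate f y (q ℕ.* m)) e)
      (iterate-* m e q))

  iterate-% : ∀ {x} m .{{_ : NonZero m}} → iterate f x m ≡ x → ∀ k → iterate f x (k % m) ≡ iterate f x k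
  iterate-% {x} m e k = sym (begin
    iterate f x k                                   ≡⟨ cong (iterate f x)
        (trans (m≡m%n+[m/n]*n k m) (ℕ.+-comm (k % m) _)) ⟩
    iterate f x (k / m ℕ.* m ℕ.+ k % m)             ≡⟨ iterate-+ x (k / m ℕ.* m) (k % m) ⟩
    iterate f (iterate f x (k / m ℕ.* m)) (k % m)   ≡⟨ cong (λ y → iterate f y (k % m)) (iterate-* m e (k / m)) ⟩
    iterate f x (k % m)                             ∎)
    where open ≡-Reasoning

  module _ (f-injective : ∀ {x y} → f x ≡ f y → x ≡ y) where

    iterate-injective : ∀ {x y} k → iterate f x k ≡ iterate f y k → x ≡ y
    iterate-injective zero    e = e
    iterate-injective (suc k) e = f-injective (iterate-injective k e)

    iterate-cancel : ∀ {x} i d → iterate f x i ≡ iterate f x (i ℕ.+ d) → iterate f x d ≡ x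
    iterate-cancel {x} i d e = sym (iterate-injective i
      (trans e (trans (cong (iterate f x) (ℕ.+-comm i d)) (iterate-+ x d i))))

    period : ∀ x → ∃ λ m → m ℕ.< n × iterate f x (suc m) ≡ x
    period x with i , j , i<j , e ← pigeonhole ℕ.≤-refl (λ (k : Fin (suc n)) → iterate f x (toℕ k))
      with d , 1+i+d≡j ← ℕ.m≤n⇒∃[o]m+o≡n i<j =
      d , ℕ.<-≤-trans (subst (d ℕ.<_) (trans (ℕ.+-suc (toℕ i) d) 1+i+d≡j) (ℕ.m≤n+m (suc d) (toℕ i))) (s≤s⁻¹ (toℕ<n j)) ,
      iterate-cancel (toℕ i) (suc d) (trans e (cong (iterate f x) (trans (sym 1+i+d≡j) (sym (ℕ.+-suc (toℕ i) d)))))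

    -- After k steps, k (m + 1) - k further ones complete k rounds of the period m + 1 and lead back
    -- to x.
    reach-sym : ∀ {x y} → Reach x y → Reach y x
    reach-sym {x} (k , refl) with m , _ , e ← period x
      with d , eq ← ℕ.m≤n⇒∃[o]m+o≡n (ℕ.m≤m*n k (suc m)) =
      d , trans (sym (iterate-+ x k d)) (trans (cong (iterate f x) eq) (iterate-* (suc m) e k))

    module _ (reach : ∀ x y → Reach x y) where

      -- Reducing the number of steps modulo m + 1 places every element among the m + 1 iterates of
      -- x, so that the n elements inject into `Fin (suc m)`.
      n≤period : ∀ x m → iterate f x (suc m) ≡ x → n ℕ.≤ suc m
      n≤period x m e = injective⇒≤ {f = index} λ {y} {z} eq → trans (sym (at y))
          (trans (cong (λ k → iterate f x (toℕ k)) eq) (at z))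
        where
        index : Fin n → Fin (suc m)
        index y = fromℕ< (m%n<n (proj₁ (reach x y)) (suc m))
        at : ∀ y → iterate f x (toℕ (index y)) ≡ y
        at y = trans (cong (iterate f x) (toℕ-fromℕ< (m%n<n (proj₁ (reach x y)) (suc m))))
            (trans (iterate-% (suc m) e (proj₁ (reach x y))) (proj₂ (reach x y)))

      no-return : ∀ x i d → i ℕ.+ suc d ℕ.< n → iterate f x i ≢ iterate f x (i ℕ.+ suc d)
      no-return x i d i+d<n e = ℕ.<⇒≱ (ℕ.≤-<-trans (ℕ.m≤n+m (suc d) i) i+d<n)
          (n≤period x d (iterate-cancel i (suc d) e))

      unique : ∀ x (i j : Fin n) → iterate f x (toℕ i) ≡ iterate f x (toℕ j) → i ≡ j
      unique x i j e = toℕ-injective (go (toℕ<n i) (toℕ<n j) e (ℕ.<-cmp (toℕ i) (toℕ j)))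
        where
        clash : ∀ {a b} → b ℕ.< n → a ℕ.< b → iterate f x a ≢ iterate f x b
        clash {a} b<n a<b e with d , refl ← ℕ.m≤n⇒∃[o]m+o≡n a<b =
          no-return x a d (subst (ℕ._< n) (sym (ℕ.+-suc a d)) b<n) (trans e (cong (iterate f x) (sym (ℕ.+-suc a d))))
        go : ∀ {a b} → a ℕ.< n → b ℕ.< n → iterate f x a ≡ iterate f x b → Tri (a ℕ.< b) (a ≡ b) (b ℕ.< a) → a ≡ b
        go a<n b<n e (tri< a<b _ _) = contradiction e (clash b<n a<b)
        go a<n b<n e (tri≈ _ a≡b _) = a≡b
        go a<n b<n e (tri> _ _ b<a) = contradiction (sym e) (clash a<n b<a)

      singleCycle : IsSingleCycle f
      singleCycle x with m , m<n , e ← period x with refl ← ℕ.≤-antisym m<n (n≤period x m e) =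
        (λ y → index y , at y , λ {k} e′ → unique x (index y) k (trans (at y) (sym e′))) , e
        where
        index : Fin n → Fin n
        index y = fromℕ< (m%n<n (proj₁ (reach x y)) n)
        at : ∀ y → iterate f x (toℕ (index y)) ≡ y
        at y = trans (cong (iterate f x) (toℕ-fromℕ< (m%n<n (proj₁ (reach x y)) n)))
            (trans (iterate-% (suc m) e (proj₁ (reach x y))) (proj₂ (reach x y)))

    reach-from : ∀ x₀ → (∀ y → Reach x₀ y) → ∀ x y → Reach x y
    reach-from x₀ reach₀ x y = reach-trans (reach-sym (reach₀ x)) (reach₀ y)

singleCycle⇒reach : ∀ {n} {f : Fin n → Fin n} → IsSingleCycle f → ∀ x y → Reach f x y
singleCycle⇒reach cyc x y with k , e , _ ← proj₁ (cyc x) y = toℕ k , e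

-- Row permutations of a Latin square and its conjugates

module _ {n : ℕ} (L : LatinSquare n) where

  entry-injective : ∀ i {x y} → entry L i x ≡ entry L i y → x ≡ y
  entry-injective i {x} {y} e = trans (sym (columnOf-entry L i x)) (trans (cong (columnOf L i) e)
      (columnOf-entry L i y))

  columnOf-injective : ∀ i {x y} → columnOf L i x ≡ columnOf L i y → x ≡ y
  columnOf-injective i {x} {y} e = trans (sym (entry-columnOf L i x)) (trans (cong (entry L i) e)
      (entry-columnOf L i y))

  rowPermutation-injective : ∀ i j {x y} → rowPermutation L i j x ≡ rowPermutation L i j y → x ≡ y
  rowPermutation-injective i j e = columnOf-injective i (entry-injective j e)

  reach⇒rowHamiltonian : (∀ i j → i ≢ j → ∀ x y → Reach (rowPermutation L i j) x y) → RowHamiltonian L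
  reach⇒rowHamiltonian reach i j i≢j = singleCycle (rowPermutation L i j) (rowPermutation-injective i j) (reach i j i≢j)

-- The row permutation r′ of the conjugate satisfies entry j ∘ r′ i j = r j i ∘ entry j.
rowHamiltonian-swapColumnsSymbols : ∀ {n} (L : LatinSquare n) → RowHamiltonian L → RowHamiltonian (swapColumnsSymbols L)
rowHamiltonian-swapColumnsSymbols L ham = reach⇒rowHamiltonian (swapColumnsSymbols L) λ i j i≢j x y →
  pull i j (singleCycle⇒reach (ham j i (λ e → i≢j (sym e))) (entry L j x) (entry L j y))
  where
  conj : ∀ i j x k → entry L j (iterate (rowPermutation (swapColumnsSymbols L) i j) x k) ≡ iterate
      (rowPermutation L j i) (entry L j x) k
  conj i j x zero    = refl
  conj i j x (suc k) = trans (conj i j (columnOf L j (entry L i x)) k) (cong (λ z → iterate (rowPermutation L j i) z k)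
    (trans (entry-columnOf L j (entry L i x)) (cong (entry L i) (sym (columnOf-entry L j x)))))
  pull : ∀ i j {x y} → Reach (rowPermutation L j i) (entry L j x) (entry L j y) → Reach
      (rowPermutation (swapColumnsSymbols L) i j) x y
  pull i j {x} (k , e) = k , entry-injective L j (trans (conj i j x k) e)

¬rowHamiltonian : ∀ {n} (M : LatinSquare n) {s t} → s ≢ t → ∀ x k → suc k ℕ.< n →
                  iterate (rowPermutation M s t) x (suc k) ≡ x → ¬ RowHamiltonian M
¬rowHamiltonian M {s} {t} s≢t x k k<n e ham = no-return (rowPermutation M s t) (rowPermutation-injective M s t)
  (singleCycle⇒reach (ham s t s≢t)) x 0 k k<n (sym e)

ν≡4 : ∀ {n} (L : LatinSquare n) → RowHamiltonian L → RowHamiltonian (swapRowsColumns L) →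
      ¬ RowHamiltonian (swapRowsColumns (swapColumnsSymbols L)) → ν L ≡ 4
ν≡4 L rows columns ¬symbols
  rewrite dec-true (rowHamiltonian? L) rows
        | dec-true (rowHamiltonian? (swapColumnsSymbols L)) (rowHamiltonian-swapColumnsSymbols L rows)
        | dec-true (rowHamiltonian? (swapRowsColumns L)) columns
        | dec-true (rowHamiltonian? (swapColumnsSymbols (swapRowsColumns L)))
            (rowHamiltonian-swapColumnsSymbols (swapRowsColumns L) columns)
        | dec-false (rowHamiltonian? (swapRowsColumns (swapColumnsSymbols L))) ¬symbols
        | dec-false (rowHamiltonian? (swapColumnsSymbols (swapRowsColumns (swapColumnsSymbols L))))
            -- Exchanging columns and symbols twice gives back the same row permutations by
            -- computation, so the implication also runs backwards.
            (λ ham → ¬symbols (rowHamiltonian-swapColumnsSymbols (swapColumnsSymbols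
                (swapRowsColumns (swapColumnsSymbols L))) ham))
  = refl

∃ν≡4 : ∀ {n} (L : LatinSquare n) → RowHamiltonian L → RowHamiltonian (swapRowsColumns L) →
       ¬ RowHamiltonian (swapRowsColumns (swapColumnsSymbols L)) → ∃ λ (L : LatinSquare n) → ν L ≡ 4
∃ν≡4 L rows columns ¬symbols = L , ν≡4 L rows columns ¬symbols

-- Residues as elements of `Fin pℕ`

module Residues (m : ℕ) where

  open Modulo m public

  ≡⇒≈ : ∀ {x y} → x ≡ y → x ≈ y
  ≡⇒≈ {x} refl = + 0 , lem x P
    where
    lem : ∀ x p → x ≡ x + + 0 * p
    lem = solve-∀

  ≈-trans : ∀ {x y z} → x ≈ y → y ≈ z → x ≈ z
  ≈-trans {x} (k , refl) (l , refl) = k + l , lem x k l P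
    where
    lem : ∀ x k l p → x + k * p + l * p ≡ x + (k + l) * p
    lem = solve-∀

  *-≈ : ∀ {x y} z → x ≈ y → z * x ≈ z * y
  *-≈ {x} z (k , refl) = z * k , lem x z k P
    where
    lem : ∀ x z k p → z * (x + k * p) ≡ z * x + z * k * p
    lem = solve-∀

  neg-≈ : ∀ {x y} → x ≈ y → - x ≈ - y
  neg-≈ {x} (k , refl) = - k , lem x k P
    where
    lem : ∀ x k p → - (x + k * p) ≡ - x + - k * p
    lem = solve-∀

  sub-≈ : ∀ {x y} a → x ≈ y → a - x ≈ a - y
  sub-≈ {x} {y} a x≈y = ≈-trans (≡⇒≈ (lem a x)) (≈-trans (+-≈ a (neg-≈ x≈y)) (≡⇒≈ (sym (lem a y))))
    where
    lem : ∀ a x → a - x ≡ - x + a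
    lem = solve-∀

  p∣small⇒0 : ∀ k d → + d ≡ k * P → d ℕ.< pℕ → d ≡ 0
  p∣small⇒0 k d eq d<p = go ∣ k ∣ (trans (cong ∣_∣ eq) (trans (ℤ.abs-* k P) (cong (λ z → ∣ k ∣ ℕ.* ∣ z ∣) (sym +p≡P))))
    where
    go : ∀ a → d ≡ a ℕ.* pℕ → d ≡ 0
    go zero    e = e
    go (suc a) e = contradiction d<p (ℕ.≤⇒≯ (subst (pℕ ℕ.≤_) (sym e) (ℕ.m≤m+n pℕ (a ℕ.* pℕ))))

  residue-unique : ∀ {r s} → + r ≈ + s → r ℕ.< pℕ → s ℕ.< pℕ → r ≡ s
  residue-unique {r} {s} r≈s r<p s<p = below-or-above r s {λ r → + r ≈ + s → r ℕ.< pℕ → r ≡ s}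
    (λ r<s r≈s _ → difference (ℕ.<⇒≤ r<s) {λ s → + r ≈ + s → s ℕ.< pℕ → r ≡ s} (λ d → up r d) r≈s s<p)
    (λ d r≈s r<p → sym (up s d (≈-sym r≈s) r<p)) r≈s r<p
    where
    up : ∀ r d → + r ≈ + (r ℕ.+ d) → r ℕ.+ d ℕ.< pℕ → r ≡ r ℕ.+ d
    up r d (k , e) r+d<p = trans (sym (ℕ.+-identityʳ r)) (cong (r ℕ.+_)
        (sym (p∣small⇒0 k d (lem (+ r) (+ d) (k * P) e) (ℕ.≤-<-trans (ℕ.m≤n+m d r) r+d<p))))
      where
      lem : ∀ r d k → r + d ≡ r + k → d ≡ k
      lem r d k e = trans (lem₁ r d) (trans (cong (_- r) e) (sym (lem₁ r k)))
        where
        lem₁ : ∀ r d → d ≡ r + d - r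
        lem₁ = solve-∀

  abstract
    ι : ℤ → Fin pℕ
    ι z = fromℕ< (n%ℕd<d z pℕ)

    τι : ∀ z → z ≈ + toℕ (ι z)
    τι z = - (z /ℕ pℕ) , trans (cong +_ (toℕ-fromℕ< (n%ℕd<d z pℕ)))
      (trans (lem (+ (z %ℕ pℕ)) (z /ℕ pℕ) (+ pℕ)) (cong₂ (λ a b → a + - (z /ℕ pℕ) * b)
          (sym (a≡a%ℕn+[a/ℕn]*n z pℕ)) +p≡P))
      where
      lem : ∀ r k p → r ≡ r + k * p + - k * p
      lem = solve-∀

  τ : Fin pℕ → ℤ
  τ i = + toℕ i

  ι-cong : ∀ {x y} → x ≈ y → ι x ≡ ι y
  ι-cong {x} {y} x≈y = toℕ-injective (residue-unique
    (≈-trans (≈-sym (τι x)) (≈-trans x≈y (τι y))) (toℕ<n (ι x)) (toℕ<n (ι y)))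

  ι-injective : ∀ {x y} → ι x ≡ ι y → x ≈ y
  ι-injective {x} {y} e = ≈-trans (τι x) (≈-trans (≡⇒≈ (cong τ e)) (≈-sym (τι y)))

  ιτ : ∀ i → ι (τ i) ≡ i
  ιτ i = toℕ-injective (residue-unique (≈-sym (τι (τ i))) (toℕ<n (ι (τ i))) (toℕ<n i))

  ι⇒≈ : ∀ {x s} → ι x ≡ s → x ≈ τ s
  ι⇒≈ {x} refl = τι x

  ≈⇒ι : ∀ {x s} → x ≈ τ s → ι x ≡ s
  ≈⇒ι {x} {s} e = trans (ι-cong e) (ιτ s)

-- The Latin square of a colouring of the residues

module Quadratic
  (m : ℕ) (col : ℤ → Bool)
  (col-periodic : ∀ x k → col (x + k * (+ 2 * + m + + 1)) ≡ col x)
  (col-[-2] : ∀ x → col (- (+ 2) * x) ≡ col x)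
  where

  open Residues m
  open Connectivity m col col-periodic col-[-2]

  byColour : ∀ {A : Set} x → (S x → A) → (N x → A) → A
  byColour x f g with S⊎N x
  ... | inj₁ s = f s
  ... | inj₂ n = g n

  θ-cong : ∀ {x y} → x ≈ y → θ x ≈ θ y
  θ-cong {x} {y} x≈y = byColour x
    (λ s → subst₂ _≈_ (sym (θ-S s)) (sym (θ-S (col-≈ x≈y s))) x≈y)
    (λ n → subst₂ _≈_ (sym (θ-N n)) (sym (θ-N (col-≈ x≈y n))) (*-≈ (- (+ 2)) x≈y))

  η[-2] : ∀ x → η (- (+ 2) * x) ≈ x
  η[-2] x = x , lem μ x
    where
    lem : ∀ μ x → x ≡ μ * (- (+ 2) * x) + x * (+ 2 * μ + + 1)
    lem = solve-∀

  η-cong : ∀ {x y} → x ≈ y → η x ≈ η y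
  η-cong = *-≈ μ

  -- θ⁻ inverts θ, which governs the rows, and ω⁻ inverts x ↦ x + θ x, which governs the columns.
  θ⁻ ω⁻ : ℤ → ℤ
  θ⁻ t with col t
  ... | false = t
  ... | true  = η t
  ω⁻ t with col (- t)
  ... | false = η (- t)
  ... | true  = - t

  θ⁻-S : ∀ {t} → S t → θ⁻ t ≡ t
  θ⁻-S {t} s with col t
  θ⁻-S refl | false = refl

  θ⁻-N : ∀ {t} → N t → θ⁻ t ≡ η t
  θ⁻-N {t} s with col t
  θ⁻-N refl | true = refl

  ω⁻-S : ∀ {t} → S (- t) → ω⁻ t ≡ η (- t)
  ω⁻-S {t} s with col (- t)
  ω⁻-S refl | false = refl

  ω⁻-N : ∀ {t} → N (- t) → ω⁻ t ≡ - t
  ω⁻-N {t} s with col (- t)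
  ω⁻-N refl | true = refl

  -- θ preserves colours because -2 does; therefore the colour of t tells which branch of θ to
  -- invert.
  θθ⁻ : ∀ t → θ (θ⁻ t) ≈ t
  θθ⁻ t = byColour t
    (λ s → ≡⇒≈ (trans (cong θ (θ⁻-S s)) (θ-S s)))
    (λ n → ≈-trans (≡⇒≈ (trans (cong θ (θ⁻-N n)) (θ-N (col-η n)))) (-2η t))

  θ-solve : ∀ {x t} → θ x ≈ t → θ⁻ t ≈ x
  θ-solve {x} {t} e = byColour x
    (λ s → let x≈t = ≈-trans (≡⇒≈ (sym (θ-S s))) e in
      ≈-trans (≡⇒≈ (θ⁻-S (col-≈ x≈t s))) (≈-sym x≈t))
    (λ n → let -2x≈t = ≈-trans (≡⇒≈ (sym (θ-N n))) e in
      ≈-trans (≡⇒≈ (θ⁻-N (col-≈ -2x≈t (trans (col-[-2] x) n)))) (≈-trans (η-cong (≈-sym -2x≈t)) (η[-2] x)))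

  ω-S : ∀ {x} → S x → x + θ x ≡ - (- (+ 2) * x)
  ω-S {x} s = trans (cong (λ z → x + z) (θ-S s)) (lem x)
    where
    lem : ∀ x → x + x ≡ - (- (+ 2) * x)
    lem = solve-∀

  ω-N : ∀ {x} → N x → x + θ x ≡ - x
  ω-N {x} n = trans (cong (λ z → x + z) (θ-N n)) (lem x)
    where
    lem : ∀ x → x + - (+ 2) * x ≡ - x
    lem = solve-∀

  neg-neg : ∀ x → - (- x) ≡ x
  neg-neg = solve-∀

  ωω⁻ : ∀ t → ω⁻ t + θ (ω⁻ t) ≈ t
  ωω⁻ t = byColour (- t)
    (λ s → ≈-trans (≡⇒≈ (trans (cong (λ x → x + θ x) (ω⁻-S s)) (ω-S (col-η s))))
        (≈-trans (neg-≈ (-2η (- t))) (≡⇒≈ (neg-neg t))))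
    (λ n → ≡⇒≈ (trans (cong (λ x → x + θ x) (ω⁻-N n)) (trans (ω-N n) (neg-neg t))))

  ω-solve : ∀ {x t} → x + θ x ≈ t → ω⁻ t ≈ x
  ω-solve {x} {t} e = byColour x
    (λ s → let -2x≈-t = ≈-trans (≡⇒≈ (sym (neg-neg (- (+ 2) * x)))) (neg-≈ (≈-trans (≡⇒≈ (sym (ω-S s))) e)) in
      ≈-trans (≡⇒≈ (ω⁻-S (col-≈ -2x≈-t (trans (col-[-2] x) s)))) (≈-trans (η-cong (≈-sym -2x≈-t)) (η[-2] x)))
    (λ n → let x≈-t = ≈-trans (≡⇒≈ (sym (neg-neg x))) (neg-≈ (≈-trans (≡⇒≈ (sym (ω-N n))) e)) in
      ≈-trans (≡⇒≈ (ω⁻-N (col-≈ x≈-t n))) (≈-sym x≈-t))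

  cell : ℤ → ℤ → ℤ
  cell x y = x - θ (y - x)

  latinSquare : LatinSquare pℕ
  latinSquare = record
    { entry        = λ i j → ι (cell (τ i) (τ j))
    ; onceInRow    = λ i s → ι (τ i + θ⁻ (τ i - τ s)) ,
        ≈⇒ι (≈-trans (sub-≈ (τ i) (≈-trans (θ-cong (≈-trans (+-≈ (- τ i) (≈-sym (τι _))) (≡⇒≈ (lem₁ (τ i) _))))
            (θθ⁻ (τ i - τ s)))) (≡⇒≈ (lem₂ (τ i) (τ s)))) ,
        λ {j} e → ≈⇒ι (≈-trans (+-comm≈ (τ i) (θ-solve (≈-trans (≡⇒≈ (sym (lem₂ (τ i) _))) (sub-≈ (τ i) (ι⇒≈ e)))))
            (≡⇒≈ (lem₃ (τ i) (τ j))))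
    ; onceInColumn = λ j s → ι (τ j - ω⁻ (τ j - τ s)) ,
        ≈⇒ι (columnSolves (τ j) (τ s)) ,
        λ {i} e → ≈⇒ι (≈-trans (sub-≈ (τ j) (ω-solve {τ j - τ i} (≈-trans (≡⇒≈ (lem₅ (τ i) (τ j) _))
            (sub-≈ (τ j) (ι⇒≈ e))))) (≡⇒≈ (lem₂ (τ j) (τ i))))
    }
    where
    lem₁ : ∀ a x → a + x - a ≡ x
    lem₁ = solve-∀
    lem₂ : ∀ a s → a - (a - s) ≡ s
    lem₂ = solve-∀
    lem₃ : ∀ a x → a + (x - a) ≡ x
    lem₃ = solve-∀
    lem₄ : ∀ j x y → j - x - y ≡ j - (x + y)
    lem₄ = solve-∀
    lem₅ : ∀ i j t → j - i + t ≡ j - (i - t)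
    lem₅ = solve-∀
    +-comm≈ : ∀ {x y} a → x ≈ y → a + x ≈ a + y
    +-comm≈ {x} {y} a e = ≈-trans (≡⇒≈ (ℤ.+-comm a x)) (≈-trans (+-≈ a e) (≡⇒≈ (ℤ.+-comm y a)))
    cell-cong : ∀ {x x′ y} → x ≈ x′ → cell x y ≈ cell x′ y
    cell-cong {x} {x′} {y} e = ≈-trans (+-≈ (- θ (y - x)) e) (sub-≈ x′ (θ-cong (sub-≈ y e)))
    columnSolves : ∀ y s → cell (+ toℕ (ι (y - ω⁻ (y - s)))) y ≈ s
    columnSolves y s = ≈-trans (cell-cong {y = y} (≈-sym (τι (y - w)))) (≈-trans
      (≡⇒≈ (trans (cong (λ z → y - w - θ z) (lem₂ y w)) (lem₄ y w (θ w))))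
      (≈-trans (sub-≈ y (ωω⁻ (y - s))) (≡⇒≈ (lem₂ y s))))
      where
      w = ω⁻ (y - s)

-- Row permutations of the square of a colouring

module Hamiltonicity
  (m : ℕ) (col : ℤ → Bool)
  (col-periodic : ∀ x k → col (x + k * (+ 2 * + m + + 1)) ≡ col x)
  (col-[-2] : ∀ x → col (- (+ 2) * x) ≡ col x)
  (inverse : Modulo.Invertible m)
  where

  open Residues m
  open Connectivity m col col-periodic col-[-2]
  open Quadratic m col col-periodic col-[-2]

  module Row (L : LatinSquare pℕ) (isCell : ∀ i j → entry L i j ≡ ι (cell (τ i) (τ j))) (∃S : ∃ S) (∃N : ∃ N) where

    module Pair (i j : Fin pℕ) (D E : ℤ) (D≡ : τ j - τ i ≡ D) (DE≈1 : D * E ≈ + 1) where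

      scaled : ℤ → Bool
      scaled k = col (D * k)

      scaled-periodic : ∀ x k → scaled (x + k * (+ 2 * + m + + 1)) ≡ scaled x
      scaled-periodic x k = trans (cong col (lem D x k P)) (col-periodic (D * x) (D * k))
        where
        lem : ∀ d x k p → d * (x + k * p) ≡ d * x + d * k * p
        lem = solve-∀

      scaled-[-2] : ∀ x → scaled (- (+ 2) * x) ≡ scaled x
      scaled-[-2] x = trans (cong col (lem D x)) (col-[-2] (D * x))
        where
        lem : ∀ d x → d * (- (+ 2) * x) ≡ - (+ 2) * (d * x)
        lem = solve-∀

      module Scaled = Connectivity m scaled scaled-periodic scaled-[-2]

      θ-scaled : ∀ k → D * Scaled.θ k ≡ θ (D * k)
      θ-scaled k = byColour (D * k)
        (λ s → trans (cong (D *_) (Scaled.θ-S {k} s)) (sym (θ-S s)))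
        (λ n → trans (cong (D *_) (Scaled.θ-N {k} n)) (trans (lem D k) (sym (θ-N n))))
        where
        lem : ∀ d k → d * (- (+ 2) * k) ≡ - (+ 2) * (d * k)
        lem = solve-∀

      r : Fin pℕ → Fin pℕ
      r = rowPermutation L i j

      -- The symbol with coordinate x. In column τ i + D k, row i has the coordinate θ k and row j,
      -- now the next row, has θ (k - 1) - 1, both for the scaled colouring.
      at : ℤ → Fin pℕ
      at x = ι (τ i - D * x)

      _~_ : ℤ → ℤ → Set
      x ~ y = Reach r (at x) (at y)

      at-cong : ∀ {x y} → x ≈ y → at x ≡ at y
      at-cong x≈y = ι-cong (sub-≈ (τ i) (*-≈ D x≈y))

      cell-at : ∀ x k → x - θ (x + D * k - x) ≡ x - D * Scaled.θ k
      cell-at x k = cong (λ z → x - z) (trans (cong θ (lem x (D * k))) (sym (θ-scaled k)))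
        where
        lem : ∀ x y → x + y - x ≡ y
        lem = solve-∀

      entry-at : ∀ a z → entry L a (ι z) ≡ ι (τ a - θ (z - τ a))
      entry-at a z = trans (isCell a (ι z)) (ι-cong (sub-≈ (τ a) (θ-cong (+-≈ (- τ a) (≈-sym (τι z))))))

      step : ∀ k → Scaled.θ k ~ (Scaled.θ (k - + 1) - + 1)
      step k = 1 , (begin
        r (at (Scaled.θ k))             ≡⟨ cong r (sym (trans (entry-at i z) (cong ι (cell-at (τ i) k)))) ⟩
        r (entry L i (ι z))             ≡⟨ rowPermutation-entry L i j (ι z) ⟩
        entry L j (ι z)                 ≡⟨ entry-at j z ⟩
        ι (τ j - θ (z - τ j))           ≡⟨ cong (λ y → ι (y - θ (z - y))) j≡ ⟩
        ι (τ i + D - θ (z - (τ i + D))) ≡⟨ cong (λ y → ι (τ i + D - y))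
            (trans (cong θ (lem (τ i) D k)) (sym (θ-scaled (k - + 1)))) ⟩
        ι (τ i + D - D * Scaled.θ (k - + 1)) ≡⟨ cong ι (lem₂ (τ i) D (Scaled.θ (k - + 1))) ⟩
        at (Scaled.θ (k - + 1) - + 1)   ∎)
        where
        open ≡-Reasoning
        z = τ i + D * k
        j≡ : τ j ≡ τ i + D
        j≡ = trans (lem₃ (τ i) (τ j)) (cong (λ y → τ i + y) D≡)
          where
          lem₃ : ∀ i j → j ≡ i + (j - i)
          lem₃ = solve-∀
        lem : ∀ i d k → i + d * k - (i + d) ≡ d * (k - + 1)
        lem = solve-∀
        lem₂ : ∀ i d t → i + d - d * t ≡ i - d * (t - + 1)
        lem₂ = solve-∀

      scale : ∀ {b} x → col x ≡ b → scaled (E * x) ≡ b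
      scale x e = col-≈ (≈-sym (≈-trans (≡⇒≈ (lem D E x)) (≈-trans (*-≈ x DE≈1) (≡⇒≈ (lem₂ x))))) e
        where
        lem : ∀ d e x → d * (e * x) ≡ x * (d * e)
        lem = solve-∀
        lem₂ : ∀ x → x * + 1 ≡ x
        lem₂ = solve-∀

      r-injective : ∀ {x y} → r x ≡ r y → x ≡ y
      r-injective = rowPermutation-injective L i j

      connected : ∀ x y → x ~ y
      connected = Scaled.Joined.connected _~_ (reach-sym r r-injective) (reach-trans r)
        (λ x k → 0 , at-cong (k , refl)) step (E * proj₁ ∃S , scale (proj₁ ∃S) (proj₂ ∃S))
            (E * proj₁ ∃N , scale (proj₁ ∃N) (proj₂ ∃N))

      coordinate : Fin pℕ → ℤ
      coordinate a = E * (τ i - τ a)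

      at-coordinate : ∀ a → at (coordinate a) ≡ a
      at-coordinate a = ≈⇒ι (≈-trans (sub-≈ (τ i) (≈-trans (≡⇒≈ (lem D E (τ i - τ a))) (*-≈ (τ i - τ a) DE≈1)))
          (≡⇒≈ (lem₂ (τ i) (τ a))))
        where
        lem : ∀ d e x → d * (e * x) ≡ x * (d * e)
        lem = solve-∀
        lem₂ : ∀ i a → i - (i - a) * + 1 ≡ a
        lem₂ = solve-∀

      reach : ∀ x y → Reach r x y
      reach x y = subst₂ (Reach r) (at-coordinate x) (at-coordinate y) (connected (coordinate x) (coordinate y))

    distinct : ∀ {i j} → i ≢ j → ¬ τ j - τ i ≈ + 0
    distinct {i} {j} i≢j e = i≢j (trans (sym (ιτ i)) (≈⇒ι (≈-sym (≈-trans (≡⇒≈ (lem (τ i) (τ j)))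
        (≈-trans (+-≈ (τ i) e) (≡⇒≈ (ℤ.+-identityˡ (τ i))))))))
      where
      lem : ∀ i j → j ≡ j - i + i
      lem = solve-∀

    rowHamiltonian : RowHamiltonian L
    rowHamiltonian = reach⇒rowHamiltonian L λ i j i≢j →
      let E , DE≈1 = inverse (τ j - τ i) (distinct i≢j) in Pair.reach i j (τ j - τ i) E refl DE≈1

  -- Three cells with symbol 0 and three cells with symbol 4d form a hexagon, that is, a cycle of length 3.
  hexagon : ∀ y d → S (y - + 2 * d) → N (y - d) → N y → N (y + d) → S (y + + 2 * d) → 3 ℕ.< pℕ →
            ¬ RowHamiltonian (swapRowsColumns (swapColumnsSymbols latinSquare))
  hexagon y d s₋₂ n₋₁ n₀ n₁ s₂ 3<p = ¬rowHamiltonian M s≢t x₁ 2 3<p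
    (trans (cong (λ x → r (r x)) (next i₁
        (N-cell (+ 4 * y) (+ 2 * y) (+ 0) y (c₁ y) (c₂ y) n₀)
        (N-cell (+ 4 * y) (+ 2 * y + + 2 * d) (+ 4 * d) (y - d) (c₃ y d) (c₄ y d) n₋₁)))
      (trans (cong r (next i₂
        (N-cell (+ 4 * y + + 4 * d) (+ 2 * y + + 2 * d) (+ 0) (y + d) (c₅ y d) (c₆ y d) n₁)
        (N-cell (+ 4 * y + + 4 * d) (+ 2 * y + + 4 * d) (+ 4 * d) y (c₇ y d) (c₈ y d) n₀)))
      (next i₃
        (S-cell (y + + 2 * d) (+ 2 * y + + 4 * d) (+ 0) (y + + 2 * d) (c₉ y d) (c₁₀ y d) s₂)
        (S-cell (y + + 2 * d) (+ 2 * y) (+ 4 * d) (y - + 2 * d) (c₁₁ y d) (c₁₂ y d) s₋₂))))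
    where
    M = swapRowsColumns (swapColumnsSymbols latinSquare)
    s = ι (+ 0)
    t = ι (+ 4 * d)
    r = rowPermutation M s t
    x₁ = ι (+ 2 * y)
    x₂ = ι (+ 2 * y + + 2 * d)
    x₃ = ι (+ 2 * y + + 4 * d)
    i₁ = ι (+ 4 * y)
    i₂ = ι (+ 4 * y + + 4 * d)
    i₃ = ι (y + + 2 * d)

    c₁ : ∀ y → + 2 * y - + 4 * y ≡ - (+ 2) * y
    c₁ = solve-∀
    c₂ : ∀ y → + 4 * y - + 4 * y ≡ + 0
    c₂ = solve-∀
    c₃ : ∀ y d → + 2 * y + + 2 * d - + 4 * y ≡ - (+ 2) * (y - d)
    c₃ = solve-∀
    c₄ : ∀ y d → + 4 * y - + 4 * (y - d) ≡ + 4 * d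
    c₄ = solve-∀
    c₅ : ∀ y d → + 2 * y + + 2 * d - (+ 4 * y + + 4 * d) ≡ - (+ 2) * (y + d)
    c₅ = solve-∀
    c₆ : ∀ y d → + 4 * y + + 4 * d - + 4 * (y + d) ≡ + 0
    c₆ = solve-∀
    c₇ : ∀ y d → + 2 * y + + 4 * d - (+ 4 * y + + 4 * d) ≡ - (+ 2) * y
    c₇ = solve-∀
    c₈ : ∀ y d → + 4 * y + + 4 * d - + 4 * y ≡ + 4 * d
    c₈ = solve-∀
    c₉ : ∀ y d → + 2 * y + + 4 * d - (y + + 2 * d) ≡ y + + 2 * d
    c₉ = solve-∀
    c₁₀ : ∀ y d → y + + 2 * d - (y + + 2 * d) ≡ + 0
    c₁₀ = solve-∀
    c₁₁ : ∀ y d → + 2 * y - (y + + 2 * d) ≡ y - + 2 * d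
    c₁₁ = solve-∀
    c₁₂ : ∀ y d → y + + 2 * d - (y - + 2 * d) ≡ + 4 * d
    c₁₂ = solve-∀

    entryι : ∀ a b → entry latinSquare (ι a) (ι b) ≡ ι (a - θ (b - a))
    entryι a b = ι-cong (≈-trans (+-≈ (- θ (τ (ι b) - τ (ι a))) (≈-sym (τι a)))
      (sub-≈ a (θ-cong (≈-trans (+-≈ (- τ (ι a)) (≈-sym (τι b))) (sub-≈ b (≈-sym (τι a)))))))

    S-cell : ∀ a b c e → b - a ≡ e → a - e ≡ c → S e → entry latinSquare (ι a) (ι b) ≡ ι c
    S-cell a b c e refl refl s′ = trans (entryι a b) (cong (λ z → ι (a - z)) (θ-S s′))

    -- Writing the difference as -2e keeps halves out of the coordinates: -2e has the colour of e,
    -- and θ (-2e) = 4e.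
    N-cell : ∀ a b c e → b - a ≡ - (+ 2) * e → a - + 4 * e ≡ c → N e → entry latinSquare (ι a) (ι b) ≡ ι c
    N-cell a b c e eq refl n′ = trans (entryι a b) (cong (λ z → ι (a - z))
      (trans (cong θ eq) (trans (θ-N (trans (col-[-2] e) n′)) (lem e))))
      where
      lem : ∀ e → - (+ 2) * (- (+ 2) * e) ≡ + 4 * e
      lem = solve-∀

    next : ∀ i {x x′} → entry latinSquare i x ≡ s → entry latinSquare i x′ ≡ t → r x ≡ x′
    next i {x} {x′} e e′ = trans (cong r (sym (at x e))) (trans (rowPermutation-entry M s t i) (at x′ e′))
      where
      at : ∀ x {u} → entry latinSquare i x ≡ u → columnOf latinSquare i u ≡ x
      at x refl = columnOf-entry latinSquare i x

    -- If 4d vanished, so would d, and y - 2d and y would be the same residue in two colours.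
    s≢t : s ≢ t
    s≢t e = ¬S×N (col-≈ (≈-trans (sub-≈ y 2d≈0) (≡⇒≈ (lem₂ y))) s₋₂) n₀
      where
      lem : ∀ d → + 4 * d ≡ - (+ 2) * (- (+ 2) * d)
      lem = solve-∀
      lem₂ : ∀ y → y - + 2 * + 0 ≡ y
      lem₂ = solve-∀
      η0 : ∀ μ → μ * + 0 ≡ + 0
      η0 = solve-∀
      d≈0 : d ≈ + 0
      d≈0 = ≈-trans (≈-sym (≈-trans (η-cong (≈-trans (η-cong (≡⇒≈ (lem d))) (η[-2] (- (+ 2) * d)))) (η[-2] d)))
        (≈-trans (η-cong (η-cong (≈-sym (ι-injective e)))) (≡⇒≈ (trans (cong η (η0 μ)) (η0 μ))))
      2d≈0 : + 2 * d ≈ + 2 * + 0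
      2d≈0 = *-≈ (+ 2) d≈0

-- The transposed square

module Transposition
  (m : ℕ) (col : ℤ → Bool)
  (col-periodic : ∀ x k → col (x + k * (+ 2 * + m + + 1)) ≡ col x)
  (col-[-2] : ∀ x → col (- (+ 2) * x) ≡ col x)
  where

  open Residues m
  open Quadratic m col col-periodic col-[-2]
  open Connectivity m col col-periodic col-[-2]

  -- Transposing changes the sign of the difference of column and row and interchanges the formulas
  -- 2i - j and 2j - i; hence both negations.
  opposite : ℤ → Bool
  opposite x = not (col (- x))

  opposite-periodic : ∀ x k → opposite (x + k * (+ 2 * + m + + 1)) ≡ opposite x
  opposite-periodic x k = cong not (trans (cong col (lem x k P)) (col-periodic (- x) (- k)))
    where
    lem : ∀ x k p → - (x + k * p) ≡ - x + - k * p
    lem = solve-∀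

  opposite-[-2] : ∀ x → opposite (- (+ 2) * x) ≡ opposite x
  opposite-[-2] x = cong not (trans (cong col (lem x)) (col-[-2] (- x)))
    where
    lem : ∀ x → - (- (+ 2) * x) ≡ - (+ 2) * (- x)
    lem = solve-∀

  module Opp = Connectivity m opposite opposite-periodic opposite-[-2]

  θ-opposite : ∀ x → x - θ (- x) ≡ - Opp.θ x
  θ-opposite x = byColour (- x)
    (λ s → trans (cong (λ z → x - z) (θ-S s)) (trans (lem₁ x) (cong -_ (sym (Opp.θ-N {x} (cong not s))))))
    (λ n → trans (cong (λ z → x - z) (θ-N n)) (trans (lem₂ x) (cong -_ (sym (Opp.θ-S {x} (cong not n))))))
    where
    lem₁ : ∀ x → x - - x ≡ - (- (+ 2) * x)
    lem₁ = solve-∀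
    lem₂ : ∀ x → x - - (+ 2) * - x ≡ - x
    lem₂ = solve-∀

  transposed : ∀ i j → entry (swapRowsColumns latinSquare) i j ≡
               ι (Quadratic.cell m opposite opposite-periodic opposite-[-2] (τ i) (τ j))
  transposed i j = cong ι (trans (cong (λ z → τ j - θ z) (lem₁ (τ i) (τ j)))
    (trans (lem₂ (τ i) (τ j) (θ (- (τ j - τ i)))) (cong (λ z → τ i + z) (θ-opposite (τ j - τ i)))))
    where
    lem₁ : ∀ i j → i - j ≡ - (j - i)
    lem₁ = solve-∀
    lem₂ : ∀ i j t → j - t ≡ i + (j - i - t)
    lem₂ = solve-∀

module _
  (m : ℕ) (col : ℤ → Bool)
  (col-periodic : ∀ x k → col (x + k * (+ 2 * + m + + 1)) ≡ col x)
  (col-[-2] : ∀ x → col (- (+ 2) * x) ≡ col x)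
  (inverse : Modulo.Invertible m)
  where

  open Residues m
  open Connectivity m col col-periodic col-[-2]
  open Quadratic m col col-periodic col-[-2]
  open Transposition m col col-periodic col-[-2]

  private
    module H = Hamiltonicity m col col-periodic col-[-2] inverse
    module H′ = Hamiltonicity m opposite opposite-periodic opposite-[-2] inverse

  rows : ∃ S → ∃ N → RowHamiltonian latinSquare
  rows = H.Row.rowHamiltonian latinSquare (λ _ _ → refl)

  columns : ∃ S → ∃ N → RowHamiltonian (swapRowsColumns latinSquare)
  columns (x , s) (y , n) = H′.Row.rowHamiltonian (swapRowsColumns latinSquare) transposed
    (- y , cong not (trans (cong col (neg-neg y)) n)) (- x , cong not (trans (cong col (neg-neg x)) s))

  symbols : ∀ y d → S (y - + 2 * d) → N (y - d) → N y → N (y + d) → S (y + + 2 * d) → 3 ℕ.< pℕ →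
            ¬ RowHamiltonian (swapRowsColumns (swapColumnsSymbols latinSquare))
  symbols = H.hexagon

  pattern⇒∃ν≡4 : ∀ y d → S (y - + 2 * d) → N (y - d) → N y → N (y + d) → S (y + + 2 * d) → 3 ℕ.< pℕ →
                 ∃ λ (L : LatinSquare pℕ) → ν L ≡ 4
  pattern⇒∃ν≡4 y d s₋₂ n₋₁ n₀ n₁ s₂ 3<p = ∃ν≡4 latinSquare
    (rows (y + + 2 * d , s₂) (y , n₀)) (columns (y + + 2 * d , s₂) (y , n₀)) (symbols y d s₋₂ n₋₁ n₀ n₁ s₂ 3<p)

module ℕSemiring = CommutativeSemiring ℕ.+-*-commutativeSemiring
open import Algebra.Properties.Semiring.Sum ℕSemiring.semiring using (sum; sum-init-last)
open import Algebra.Properties.Semiring.Mult ℕSemiring.semiring using () renaming (_×_ to _×ₙ_)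
import Algebra.Properties.Semiring.Exp ℕSemiring.semiring as Exp
open import Algebra.Properties.CommutativeSemiring.Binomial ℕ.+-*-commutativeSemiring using (theorem; binomialTerm)

-- Fermat's little theorem and the quadratic character

absorption : ∀ n k → suc k ℕ.* (suc n C suc k) ≡ suc n ℕ.* (n C k)
absorption zero zero = refl
absorption zero (suc k) = ℕ.*-zeroʳ (suc (suc k))
absorption (suc n) zero = begin
  1 ℕ.* (suc (suc n) C 1)                  ≡⟨ cong (1 ℕ.*_) (sym (nCk+nC[k+1]≡[n+1]C[k+1] (suc n) 0)) ⟩
  1 ℕ.* (1 ℕ.+ (suc n C 1))                ≡⟨ lem (suc n C 1) ⟩
  1 ℕ.+ 1 ℕ.* (suc n C 1)                  ≡⟨ cong (1 ℕ.+_) (absorption n 0) ⟩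
  1 ℕ.+ suc n ℕ.* 1                        ∎
  where
  open ≡-Reasoning
  lem : ∀ x → 1 ℕ.* (1 ℕ.+ x) ≡ 1 ℕ.+ 1 ℕ.* x
  lem = solveℕ-∀
absorption (suc n) (suc k) = begin
  suc (suc k) ℕ.* (suc (suc n) C suc (suc k))                       ≡⟨ cong (suc (suc k) ℕ.*_)
      (sym (nCk+nC[k+1]≡[n+1]C[k+1] (suc n) (suc k))) ⟩
  suc (suc k) ℕ.* (a ℕ.+ b)                                         ≡⟨ lem k a b ⟩
  a ℕ.+ (suc k ℕ.* a ℕ.+ suc (suc k) ℕ.* b)                         ≡⟨ cong₂ (λ x y → a ℕ.+ (x ℕ.+ y))
      (absorption n k) (absorption n (suc k)) ⟩
  a ℕ.+ (suc n ℕ.* (n C k) ℕ.+ suc n ℕ.* (n C suc k))               ≡⟨ cong (a ℕ.+_)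
      (sym (ℕ.*-distribˡ-+ (suc n) (n C k) (n C suc k))) ⟩
  a ℕ.+ suc n ℕ.* (n C k ℕ.+ n C suc k)                             ≡⟨ cong (λ x → a ℕ.+ suc n ℕ.* x)
      (nCk+nC[k+1]≡[n+1]C[k+1] n k) ⟩
  suc (suc n) ℕ.* a                                                 ∎
  where
  open ≡-Reasoning
  a = suc n C suc k
  b = suc n C suc (suc k)
  lem : ∀ k a b → suc (suc k) ℕ.* (a ℕ.+ b) ≡ a ℕ.+ (suc k ℕ.* a ℕ.+ suc (suc k) ℕ.* b)
  lem = solveℕ-∀

prime∣binomial : ∀ {p} → Prime (suc p) → ∀ k → k ℕ.< p → suc p ℕ.∣ (suc p C suc k)
prime∣binomial {p} isPrime k k<p with euclidsLemma (suc k) (suc p C suc k) isPrime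
  (ℕ.divides (p C k) (trans (absorption p k) (ℕ.*-comm (suc p) (p C k))))
... | inj₁ p∣k = contradiction (ℕ.∣⇒≤ p∣k) (ℕ.<⇒≱ (s≤s k<p))
... | inj₂ p∣C = p∣C

∣sum : ∀ {d n} (t : Fin n → ℕ) → (∀ i → d ℕ.∣ t i) → d ℕ.∣ sum t
∣sum {n = zero}  t d∣t = _ ℕ.∣0
∣sum {n = suc n} t d∣t = ℕ.∣m∣n⇒∣m+n (d∣t fzero) (∣sum (λ i → t (fsuc i)) (λ i → d∣t (fsuc i)))

×ₙ≡* : ∀ n x → n ×ₙ x ≡ n ℕ.* x
×ₙ≡* zero    x = refl
×ₙ≡* (suc n) x = cong (x ℕ.+_) (×ₙ≡* n x)

frobenius : ∀ {p} → Prime (suc p) → ∀ x → ∃ λ q → (x ℕ.+ 1) Exp.^ suc p ≡ (x Exp.^ suc p ℕ.+ 1) ℕ.+ q ℕ.* suc p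
frobenius {p} isPrime x with ∣sum (λ i → t (fsuc (inject₁ i))) middle
  where
  t = binomialTerm x 1 (suc p)
  middle : ∀ (i : Fin p) → suc p ℕ.∣ t (fsuc (inject₁ i))
  middle i = subst (suc p ℕ.∣_) (sym (×ₙ≡* (suc p C toℕ (fsuc (inject₁ i))) _))
    (ℕ.∣m⇒∣m*n _ (prime∣binomial isPrime (toℕ (inject₁ i)) (subst (ℕ._< p) (sym (toℕ-inject₁ i)) (toℕ<n i))))
... | ℕ.divides q eq = q , (begin
  (x ℕ.+ 1) Exp.^ suc p                                            ≡⟨ theorem (suc p) x 1 ⟩
  t fzero ℕ.+ sum (λ i → t (fsuc i))                               ≡⟨ cong (t fzero ℕ.+_)
      (sum-init-last (λ i → t (fsuc i))) ⟩
  t fzero ℕ.+ (sum (λ i → t (fsuc (inject₁ i))) ℕ.+ t (fsuc (fromℕ p))) ≡⟨ cong₂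
      (λ a b → a ℕ.+ (sum (λ i → t (fsuc (inject₁ i))) ℕ.+ b)) first last ⟩
  1 ℕ.+ (sum (λ i → t (fsuc (inject₁ i))) ℕ.+ x Exp.^ suc p)       ≡⟨ cong (λ a → 1 ℕ.+ (a ℕ.+ x Exp.^ suc p)) eq ⟩
  1 ℕ.+ (q ℕ.* suc p ℕ.+ x Exp.^ suc p)                            ≡⟨ lem (q ℕ.* suc p) (x Exp.^ suc p) ⟩
  (x Exp.^ suc p ℕ.+ 1) ℕ.+ q ℕ.* suc p                            ∎)
  where
  open ≡-Reasoning
  t = binomialTerm x 1 (suc p)
  lem : ∀ a b → 1 ℕ.+ (a ℕ.+ b) ≡ b ℕ.+ 1 ℕ.+ a
  lem = solveℕ-∀
  1^ : ∀ n → 1 Exp.^ n ≡ 1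
  1^ zero    = refl
  1^ (suc n) = trans (ℕ.*-identityˡ (1 Exp.^ n)) (1^ n)
  first : t fzero ≡ 1
  first = trans (ℕ.+-identityʳ _) (trans (ℕ.*-identityˡ _) (1^ (suc p)))
  last : t (fsuc (fromℕ p)) ≡ x Exp.^ suc p
  last = begin
    t (fsuc (fromℕ p))    ≡⟨ ×ₙ≡* (suc p C suc (toℕ (fromℕ p))) _ ⟩
    (suc p C suc (toℕ (fromℕ p))) ℕ.* (x Exp.^ suc (toℕ (fromℕ p)) ℕ.* 1 Exp.^ (p ℕ.∸ toℕ (fromℕ p)))
      ≡⟨ cong (λ k → (suc p C suc k) ℕ.* (x Exp.^ suc k ℕ.* 1 Exp.^ (p ℕ.∸ k))) (toℕ-fromℕ p) ⟩
    (suc p C suc p) ℕ.* (x Exp.^ suc p ℕ.* 1 Exp.^ (p ℕ.∸ p)) ≡⟨ cong₂ (λ a b → a ℕ.* (x Exp.^ suc p ℕ.* b))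
        (nCn≡1 (suc p)) (1^ (p ℕ.∸ p)) ⟩
    1 ℕ.* (x Exp.^ suc p ℕ.* 1) ≡⟨ lem₂ (x Exp.^ suc p) ⟩
    x Exp.^ suc p ∎
    where
    lem₂ : ∀ a → 1 ℕ.* (a ℕ.* 1) ≡ a
    lem₂ = solveℕ-∀

pos-^ : ∀ x n → + (x Exp.^ n) ≡ (+ x) ^ n
pos-^ x zero    = refl
pos-^ x (suc n) = trans (ℤ.pos-* x (x Exp.^ n)) (cong (λ z → + x * z) (pos-^ x n))

-- Monic polynomials

-- The coefficients below the leading 1, constant term first; the length is the degree.
Monic : ℕ → Set
Monic = Vec ℤ

eval : ∀ {n} → Monic n → ℤ → ℤ
eval []      x = + 1
eval (c ∷ f) x = x * eval f x + c

addMultiple : ∀ {n} → Monic (suc n) → ℤ → Monic n → Monic (suc n)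
addMultiple (c ∷ f) r []      = c + r ∷ f
addMultiple (c ∷ f) r (d ∷ g) = c + r * d ∷ addMultiple f r g

eval-addMultiple : ∀ {n} (f : Monic (suc n)) r (g : Monic n) x → eval (addMultiple f r g) x ≡ eval f x + r * eval g x
eval-addMultiple (c ∷ f) r []      x = lem x (eval f x) c r
  where
  lem : ∀ x f c r → x * f + (c + r) ≡ x * f + c + r * + 1
  lem = solve-∀
eval-addMultiple (c ∷ f) r (d ∷ g) x = trans (cong (λ z → x * z + (c + r * d)) (eval-addMultiple f r g x))
    (lem x (eval f x) (eval g x) c d r)
  where
  lem : ∀ x f g c d r → x * (f + r * g) + (c + r * d) ≡ x * f + c + r * (x * g + d)
  lem = solve-∀

-- Horner's scheme: if f = (x - r) q + f(r), then x f + c = (x - r)(f + r q) + (r f(r) + c), so the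
-- new quotient is f + r q.
divide : ∀ {n} (f : Monic (suc n)) r → ∃ λ (q : Monic n) → ∀ x → eval f x ≡ (x - r) * eval q x + eval f r
divide (c ∷ [])    r = [] , λ x → lem x r c
  where
  lem : ∀ x r c → x * + 1 + c ≡ (x - r) * + 1 + (r * + 1 + c)
  lem = solve-∀
divide (c ∷ f@(_ ∷ _)) r with q , f≡ ← divide f r = addMultiple f r q , λ x →
  trans (cong (_+ c) (lem₀ x (eval f x) (eval f r) (eval q x) (f≡ x))) (trans
      (lem x r c (eval f x) (eval q x) (eval f r))
    (cong (λ z → (x - r) * z + (r * eval f r + c)) (sym (eval-addMultiple f r q x))))
  where
  lem₀ : ∀ x fx fr q → fx ≡ (x - r) * q + fr → x * fx ≡ (x - r) * fx + r * ((x - r) * q + fr)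
  lem₀ x fx fr q e = trans (lem₁ x r fx) (cong (λ z → (x - r) * fx + r * z) e)
    where
    lem₁ : ∀ x r f → x * f ≡ (x - r) * f + r * f
    lem₁ = solve-∀
  lem : ∀ x r c fx q fr → (x - r) * fx + r * ((x - r) * q + fr) + c ≡ (x - r) * (fx + r * q) + (r * fr + c)
  lem = solve-∀

-- Products of even and odd numbers

evens odds factorial : ℕ → ℤ
evens zero    = + 1
evens (suc t) = evens t * (+ 2 * + suc t)
odds zero    = + 1
odds (suc t) = odds t * (+ 2 * + t + + 1)
factorial zero    = + 1
factorial (suc n) = factorial n * + suc n

evens≡ : ∀ t → evens t ≡ (+ 2) ^ t * factorial t
evens≡ zero    = refl
evens≡ (suc t) = trans (cong (_* (+ 2 * + suc t)) (evens≡ t)) (lem ((+ 2) ^ t) (factorial t) (+ suc t))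
  where
  lem : ∀ a b c → a * b * (+ 2 * c) ≡ + 2 * a * (b * c)
  lem = solve-∀

evens*odds : ∀ t → evens t * odds t ≡ factorial (t ℕ.+ t)
evens*odds⁺ : ∀ t → evens t * odds (suc t) ≡ factorial (suc (t ℕ.+ t))
evens*odds⁺ t = trans (lem (evens t) (odds t) (+ t)) (cong (_* + suc (t ℕ.+ t)) (evens*odds t))
  where
  lem : ∀ a b t → a * (b * (+ 2 * t + + 1)) ≡ a * b * (+ 1 + (t + t))
  lem = solve-∀
evens*odds zero    = refl
evens*odds (suc t) = trans (lem (evens t) (odds (suc t)) (+ t))
  (trans (cong (_* (+ 1 + (+ t + + suc t))) (trans (evens*odds⁺ t) (cong factorial (sym (ℕ.+-suc t t))))) refl)
  where
  lem : ∀ a b t → a * (+ 2 * (+ 1 + t)) * b ≡ a * b * (+ 1 + (t + (+ 1 + t)))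
  lem = solve-∀

module _ (m : ℕ) where

  open Residues m

  -- The product of the u largest even numbers below P, namely P - 1, P - 3, and so on; up to sign
  -- and modulo P these are the first u odd numbers.
  topEvens : ℕ → ℤ
  topEvens zero    = + 1
  topEvens (suc u) = topEvens u * (P - (+ 2 * + u + + 1))

  evens*topEvens : ∀ v u → v ℕ.+ u ≡ m → evens v * topEvens u ≡ evens m
  evens*topEvens v zero    e = trans (ℤ.*-identityʳ (evens v)) (cong evens (trans (sym (ℕ.+-identityʳ v)) e))
  evens*topEvens v (suc u) refl = trans (lem (evens v) (topEvens u) (+ v) (+ u))
      (evens*topEvens (suc v) u (sym (ℕ.+-suc v u)))
    where
    lem : ∀ a b v u → a * (b * (+ 2 * (v + (+ 1 + u)) + + 1 - (+ 2 * u + + 1))) ≡ a * (+ 2 * (+ 1 + v)) * b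
    lem = solve-∀

  topEvens≈ : ∀ u → topEvens u ≈ -1ℤ ^ u * odds u
  topEvens≈ zero    = ≡⇒≈ refl
  topEvens≈ (suc u) = ≈-trans (≡⇒≈ (ℤ.*-comm (topEvens u) (P - (+ 2 * + u + + 1))))
      (≈-trans (*-≈ (P - (+ 2 * + u + + 1)) (topEvens≈ u))
    (- (-1ℤ ^ u * odds u) , lem (-1ℤ ^ u) (odds u) (+ u) P))
    where
    lem : ∀ s o u p → - + 1 * s * (o * (+ 2 * u + + 1)) ≡ (p - (+ 2 * u + + 1)) * (s * o) + - (s * o) * p
    lem = solve-∀

-- The quadratic character

module Legendre (m : ℕ) (isPrime : Prime (suc (m ℕ.+ m))) where

  open Residues m

  infix 4 _≈?_
  _≈?_ : ∀ x y → Dec (x ≈ y)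
  x ≈? y = map′ ι-injective ι-cong (ι x ≟ ι y)

  ≈0⇒∣ : ∀ {x} → x ≈ + 0 → pℕ ℕ.∣ ∣ x ∣
  ≈0⇒∣ {x} (k , e) = ∣⇒∣ᵤ (divides (- k) (lem x k P (+ pℕ) +p≡P e))
    where
    lem : ∀ x k p q → q ≡ p → + 0 ≡ x + k * p → x ≡ - k * q
    lem x k p .p refl e = trans (lem₁ x k p) (trans (cong (_- k * p) (sym e)) (lem₂ k p))
      where
      lem₁ : ∀ x k p → x ≡ x + k * p - k * p
      lem₁ = solve-∀
      lem₂ : ∀ k p → + 0 - k * p ≡ - k * p
      lem₂ = solve-∀

  ∣⇒≈0 : ∀ {x} → pℕ ℕ.∣ ∣ x ∣ → x ≈ + 0
  ∣⇒≈0 {x} d = go (∣ᵤ⇒∣ {+ pℕ} {x} d)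
    where
    lem : ∀ x k q p → q ≡ p → x ≡ k * q → + 0 ≡ x + - k * p
    lem _ k q .q refl refl = lem₁ k q
      where
      lem₁ : ∀ k q → + 0 ≡ k * q + - k * q
      lem₁ = solve-∀
    go : + pℕ ℤ.∣ x → x ≈ + 0
    go (divides k e) = - k , lem x k (+ pℕ) P +p≡P e

  euclid : ∀ x y → x * y ≈ + 0 → x ≈ + 0 ⊎ y ≈ + 0
  euclid x y e = [ (λ d → inj₁ (∣⇒≈0 d)) , (λ d → inj₂ (∣⇒≈0 d)) ]′
    (euclidsLemma ∣ x ∣ ∣ y ∣ isPrime (subst (pℕ ℕ.∣_) (ℤ.abs-* x y) (≈0⇒∣ e)))

  small≉0 : ∀ n → 0 ℕ.< n → n ℕ.< pℕ → ¬ + n ≈ + 0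
  small≉0 n 0<n n<p e = ℕ.<⇒≢ 0<n (sym (residue-unique e n<p (s≤s z≤n)))

  ≈⇒-≈0 : ∀ {x y} → x ≈ y → x - y ≈ + 0
  ≈⇒-≈0 {x} {y} e = ≈-trans (+-≈ (- y) e) (≡⇒≈ (ℤ.+-inverseʳ y))

  -≈0⇒≈ : ∀ {x y} → x - y ≈ + 0 → x ≈ y
  -≈0⇒≈ {x} {y} e = ≈-trans (≡⇒≈ (lem x y)) (≈-trans (+-≈ y e) (≡⇒≈ (ℤ.+-identityˡ y)))
    where
    lem : ∀ x y → x ≡ x - y + y
    lem = solve-∀

  cancel : ∀ {z} x y → ¬ z ≈ + 0 → z * x ≈ z * y → x ≈ y
  cancel {z} x y z≉0 e = [ (λ z≈0 → contradiction z≈0 z≉0) , -≈0⇒≈ ]′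
    (euclid z (x - y) (≈-trans (≡⇒≈ (lem z x y)) (≈⇒-≈0 e)))
    where
    lem : ∀ z x y → z * (x - y) ≡ z * x - z * y
    lem = solve-∀

  *-cong : ∀ {x x′ y y′} → x ≈ x′ → y ≈ y′ → x * y ≈ x′ * y′
  *-cong {x} {x′} {y} {y′} e e′ = ≈-trans (*-≈ x e′) (≈-trans (≡⇒≈ (ℤ.*-comm x y′))
      (≈-trans (*-≈ y′ e) (≡⇒≈ (ℤ.*-comm y′ x′))))

  ^-cong : ∀ {x y} n → x ≈ y → x ^ n ≈ y ^ n
  ^-cong zero    e = ≡⇒≈ refl
  ^-cong (suc n) e = *-cong e (^-cong n e)

  fermat : ∀ x → x ^ pℕ ≈ x
  fermat x = reduce (residue x (+ 0))
    where
    natural : ∀ n → + (n Exp.^ pℕ) ≈ + n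
    natural zero    = ≡⇒≈ refl
    natural (suc n) = go (frobenius isPrime n)
      where
      go : (∃ λ q → (n ℕ.+ 1) Exp.^ pℕ ≡ (n Exp.^ pℕ ℕ.+ 1) ℕ.+ q ℕ.* pℕ) → + (suc n Exp.^ pℕ) ≈ + suc n
      go (q , e) =
        ≈-trans (≡⇒≈ (trans (cong (λ k → + (k Exp.^ pℕ)) (ℕ.+-comm 1 n))
            (trans (cong +_ e) (cong (λ z → + (n Exp.^ pℕ ℕ.+ 1) + z) (ℤ.pos-* q pℕ)))))
        (≈-trans (≈-sym (+ q , cong (λ z → + (n Exp.^ pℕ ℕ.+ 1) + + q * z) +p≡P))
        (≈-trans (+-≈ (+ 1) (natural n)) (≡⇒≈ (ℤ.+-comm (+ n) (+ 1)))))
    reduce : (∃ λ n → n ℕ.< pℕ × x ≈ + 0 + + n) → x ^ pℕ ≈ x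
    reduce (n , _ , x≈) = ≈-trans (^-cong pℕ x≈n) (≈-trans (≡⇒≈ (sym (pos-^ n pℕ))) (≈-trans (natural n) (≈-sym x≈n)))
      where
      x≈n : x ≈ + n
      x≈n = ≈-trans x≈ (≡⇒≈ (ℤ.+-identityˡ (+ n)))

  fermat′ : ∀ x → ¬ x ≈ + 0 → x ^ (m ℕ.+ m) ≈ + 1
  fermat′ x x≉0 = cancel {x} (x ^ (m ℕ.+ m)) (+ 1) x≉0 (≈-trans (fermat x) (≡⇒≈ (sym (ℤ.*-identityʳ x))))

  1<pℕ : 1 ℕ.< pℕ
  1<pℕ = ℕ.nonTrivial⇒n>1 pℕ {{prime⇒nonTrivial isPrime}}

  1≤m : 1 ℕ.≤ m
  1≤m = go m 1<pℕ
    where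
    go : ∀ m → 1 ℕ.< suc (m ℕ.+ m) → 1 ℕ.≤ m
    go zero    (s≤s ())
    go (suc m) _ = s≤s z≤n

  inverse : ∀ x → ¬ x ≈ + 0 → ∃ λ y → x * y ≈ + 1
  inverse x x≉0 = go (ℕ.m≤n⇒∃[o]m+o≡n (ℕ.≤-trans 1≤m (ℕ.m≤m+n m m)))
    where
    go : (∃ λ d → suc d ≡ m ℕ.+ m) → ∃ λ y → x * y ≈ + 1
    go (d , e) = x ^ d , ≈-trans (≡⇒≈ (cong (x ^_) e)) (fermat′ x x≉0)

  1≉0 : ¬ + 1 ≈ + 0
  1≉0 = small≉0 1 ℕ.≤-refl 1<pℕ

  ±1 : ∀ x → ¬ x ≈ + 0 → x ^ m ≈ + 1 ⊎ x ^ m ≈ -1ℤ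
  ±1 x x≉0 = [ (λ e → inj₁ (-≈0⇒≈ e)) , (λ e → inj₂ (-≈0⇒≈ e)) ]′
    (euclid (x ^ m - + 1) (x ^ m - -1ℤ) (≈-trans (≡⇒≈ (lem (x ^ m)))
      (≈⇒-≈0 (≈-trans (≡⇒≈ (sym (ℤ.^-distribˡ-+-* x m m))) (fermat′ x x≉0)))))
    where
    lem : ∀ y → (y - + 1) * (y - - + 1) ≡ y * y - + 1
    lem = solve-∀

  1≉-1 : ¬ + 1 ≈ -1ℤ
  1≉-1 e = small≉0 2 (s≤s z≤n) 2<p (+-≈ (+ 1) e)
    where
    2<p : 2 ℕ.< pℕ
    2<p = s≤s (ℕ.+-mono-≤ 1≤m 1≤m)

  -- Euler's criterion serves as the definition. Multiples of p get the value `false`, so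
  -- multiplicativity holds for units only.
  χ : ℤ → Bool
  χ x = does ((x ^ m) ≈? -1ℤ)

  χ-true : ∀ {x} → x ^ m ≈ -1ℤ → χ x ≡ true
  χ-true {x} = dec-true ((x ^ m) ≈? -1ℤ)

  χ-false : ∀ {x} → x ^ m ≈ + 1 → χ x ≡ false
  χ-false {x} e = dec-false ((x ^ m) ≈? -1ℤ) λ e′ → 1≉-1 (≈-trans (≈-sym e) e′)

  χ-cong : ∀ {x y} → x ≈ y → χ x ≡ χ y
  χ-cong {x} {y} e = byResidue ((x ^ m) ≈? -1ℤ)
    where
    byResidue : Dec (x ^ m ≈ -1ℤ) → χ x ≡ χ y
    byResidue (yes e′) = trans (χ-true {x} e′) (sym (χ-true {y} (≈-trans (^-cong m (≈-sym e)) e′)))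
    byResidue (no ¬e′) = trans (dec-false ((x ^ m) ≈? -1ℤ) ¬e′) (sym (dec-false ((y ^ m) ≈? -1ℤ) λ e″ → ¬e′
        (≈-trans (^-cong m e) e″)))

  χ-periodic : ∀ x k → χ (x + k * (+ 2 * + m + + 1)) ≡ χ x
  χ-periodic x k = sym (χ-cong (k , refl))

  ^-distrib-* : ∀ x y n → (x * y) ^ n ≡ x ^ n * y ^ n
  ^-distrib-* x y zero    = refl
  ^-distrib-* x y (suc n) = trans (cong (λ z → x * y * z) (^-distrib-* x y n)) (lem x y (x ^ n) (y ^ n))
    where
    lem : ∀ x y a b → x * y * (a * b) ≡ x * a * (y * b)
    lem = solve-∀

  χ-* : ∀ x y → ¬ x ≈ + 0 → ¬ y ≈ + 0 → χ (x * y) ≡ χ x xor χ y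
  χ-* x y x≉0 y≉0 = bySigns (±1 x x≉0) (±1 y y≉0)
    where
    product : ∀ {a b} → x ^ m ≈ a → y ^ m ≈ b → (x * y) ^ m ≈ a * b
    product e e′ = ≈-trans (≡⇒≈ (^-distrib-* x y m)) (*-cong e e′)
    bySigns : x ^ m ≈ + 1 ⊎ x ^ m ≈ -1ℤ → y ^ m ≈ + 1 ⊎ y ^ m ≈ -1ℤ → χ (x * y) ≡ χ x xor χ y
    bySigns (inj₁ a) (inj₁ b) = trans (χ-false {x * y} (product a b)) (sym
        (cong₂ _xor_ (χ-false {x} a) (χ-false {y} b)))
    bySigns (inj₁ a) (inj₂ b) = trans (χ-true {x * y} (product a b)) (sym (cong₂ _xor_ (χ-false {x} a) (χ-true {y} b)))
    bySigns (inj₂ a) (inj₁ b) = trans (χ-true {x * y} (product a b)) (sym (cong₂ _xor_ (χ-true {x} a) (χ-false {y} b)))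
    bySigns (inj₂ a) (inj₂ b) = trans (χ-false {x * y} (product a b)) (sym (cong₂ _xor_ (χ-true {x} a) (χ-true {y} b)))

  1^ : ∀ n → (+ 1) ^ n ≡ + 1
  1^ zero    = refl
  1^ (suc n) = trans (ℤ.*-identityˡ ((+ 1) ^ n)) (1^ n)

  χ1 : χ (+ 1) ≡ false
  χ1 = χ-false {+ 1} (≡⇒≈ (1^ m))

  -1^even : ∀ n → -1ℤ ^ (n ℕ.+ n) ≡ + 1
  -1^even n = trans (ℤ.^-distribˡ-+-* -1ℤ n n) (trans (sym (^-distrib-* -1ℤ -1ℤ n)) (1^ n))

  -1^odd : ∀ n → -1ℤ ^ suc (n ℕ.+ n) ≡ -1ℤ
  -1^odd n = cong (-1ℤ *_) (-1^even n)

  factorial≉0 : ∀ n → n ℕ.< pℕ → ¬ factorial n ≈ + 0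
  factorial≉0 zero    _   e = 1≉0 e
  factorial≉0 (suc n) n<p e = [ factorial≉0 n (ℕ.<-trans (ℕ.n<1+n n) n<p) , small≉0 (suc n) (s≤s z≤n) n<p ]′
    (euclid (factorial n) (+ suc n) e)

  -- Gauss's lemma for the residue 2: modulo P, the even numbers up to P - 1 are, up to sign, the numbers up to m.
  2^m : ∀ v u → v ℕ.+ u ≡ m → evens v * odds u ≡ factorial m → (+ 2) ^ m ≈ -1ℤ ^ u
  2^m v u v+u≡m e = cancel {factorial m} ((+ 2) ^ m) (-1ℤ ^ u) (factorial≉0 m (s≤s (ℕ.m≤m+n m m)))
    (≈-trans (≡⇒≈ (trans (ℤ.*-comm (factorial m) ((+ 2) ^ m)) (trans (sym (evens≡ m))
        (sym (evens*topEvens m v u v+u≡m)))))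
    (≈-trans (*-≈ (evens v) (topEvens≈ m u)) (≡⇒≈ (trans (lem (evens v) (-1ℤ ^ u) (odds u)) (cong (_* -1ℤ ^ u) e)))))
    where
    lem : ∀ a s o → a * (s * o) ≡ a * o * s
    lem = solve-∀

  -- After division by x - (n + 2) the other points remain roots of the quotient, because they
  -- differ from n + 2 modulo the prime.
  manyRoots : ∀ n (f : Monic n) → suc n ℕ.< pℕ → ¬ (∀ i → i ℕ.≤ n → eval f (+ suc i) ≈ + 0)
  manyRoots zero    []  _   root = 1≉0 (root 0 z≤n)
  manyRoots (suc n) f n<p root = deflate (divide f r)
    where
    r = + suc (suc n)
    lem : ∀ a b c → a ≡ b + c → b ≡ a - c
    lem a b c e = trans (lem₁ b c) (cong (_- c) (sym e))
      where
      lem₁ : ∀ b c → b ≡ b + c - c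
      lem₁ = solve-∀
    deflate : ¬ (∃ λ (q : Monic n) → ∀ x → eval f x ≡ (x - r) * eval q x + eval f r)
    deflate (q , f≡) = manyRoots n q (ℕ.<-trans (ℕ.n<1+n (suc n)) n<p) λ i i≤n →
      [ (λ e → contradiction (residue-unique (-≈0⇒≈ e) (ℕ.≤-<-trans (s≤s (ℕ.m≤n⇒m≤1+n i≤n)) n<p) n<p)
          (ℕ.<⇒≢ (s≤s (s≤s i≤n)))) , (λ e → e) ]′
      (euclid (+ suc i - r) (eval q (+ suc i))
        (≈-trans (≡⇒≈ (lem (eval f (+ suc i)) ((+ suc i - r) * eval q (+ suc i)) (eval f r) (f≡ (+ suc i))))
          (≈-trans (+-≈ (- eval f r) (root i (ℕ.m≤n⇒m≤1+n i≤n))) (sub-≈ (+ 0) (root (suc n) ℕ.≤-refl)))))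

  unityPolynomial : ∀ n → Monic (suc n)
  unityPolynomial n = - (+ 1) ∷ replicate n (+ 0)

  eval-unity : ∀ n x → eval (unityPolynomial n) x ≡ x ^ suc n - + 1
  eval-unity n x = cong (λ z → x * z + - (+ 1)) (power n)
    where
    power : ∀ n → eval (replicate n (+ 0)) x ≡ x ^ n
    power zero    = refl
    power (suc n) = trans (ℤ.+-identityʳ _) (cong (x *_) (power n))

  -- Otherwise x^m - 1 would vanish at 1, ..., m + 1, more points than its degree allows.
  nonresidue : ¬ (∀ n → 0 ℕ.< n → n ℕ.< pℕ → χ (+ n) ≡ false)
  nonresidue all = go (ℕ.m≤n⇒∃[o]m+o≡n 1≤m)
    where
    root : ∀ i → suc i ℕ.< pℕ → (+ suc i) ^ m ≈ + 1
    root i i<p = unless (±1 (+ suc i) (small≉0 (suc i) (s≤s z≤n) i<p))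
      where
      unless : (+ suc i) ^ m ≈ + 1 ⊎ (+ suc i) ^ m ≈ -1ℤ → (+ suc i) ^ m ≈ + 1
      unless (inj₁ e) = e
      unless (inj₂ e) = contradiction (trans (sym (χ-true {+ suc i} e)) (all (suc i) (s≤s z≤n) i<p)) λ ()
    go : ¬ (∃ λ d → suc d ≡ m)
    go (d , 1+d≡m) = manyRoots (suc d) (unityPolynomial d) bound λ i i≤ →
      ≈-trans (≡⇒≈ (trans (eval-unity d (+ suc i)) (cong (λ n → (+ suc i) ^ n - + 1) 1+d≡m)))
          (≈⇒-≈0 (root i (ℕ.≤-<-trans (s≤s i≤) bound)))
      where
      bound : suc (suc d) ℕ.< pℕ
      bound = subst (λ m → suc (suc d) ℕ.< suc (m ℕ.+ m)) 1+d≡m (s≤s (s≤s (ℕ.m≤n+m (suc d) d)))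

-- Five-term progressions with values S N N N S or N S S S N

data Model : Set where
  mod3 mod19 : Model

half : Model → ℕ
half mod3  = 1
half mod19 = 9

modulus : Model → ℕ
modulus M = suc (half M ℕ.+ half M)

-- The Legendre symbols modulo 3 and 19 (true for nonresidues).
nonresidue? : Model → ℕ → Bool
nonresidue? mod3  2  = true
nonresidue? mod19 2  = true
nonresidue? mod19 3  = true
nonresidue? mod19 8  = true
nonresidue? mod19 10 = true
nonresidue? mod19 12 = true
nonresidue? mod19 13 = true
nonresidue? mod19 14 = true
nonresidue? mod19 15 = true
nonresidue? mod19 18 = true
nonresidue? _     _  = false

ψ : Model → ℤ → Bool
ψ M z = nonresidue? M (z %ℕ modulus M)

-- Certificates for the finite search

Env : Set
Env = List (ℕ × Bool)

-- A factorisation of n into numbers with assumed values; multiplicativity then forces the value of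
-- the character at n.
data Derives (env : Env) : ℕ → Bool → Set where
  one  : Derives env 1 false
  step : ∀ {q b c v} → (q , b) ∈ₗ env → Derives env c v → Derives env (c ℕ.* q) (b xor v)

data Derivesℤ (s : Bool) (env : Env) : ℤ → Bool → Set where
  pos : ∀ {n v} → Derives env n v → Derivesℤ s env (+ n) v
  neg : ∀ {n v} → Derives env (suc n) v → Derivesℤ s env -[1+ n ] (s xor v)

derive : ∀ env → ℕ → ∀ n → Maybe (∃ (Derives env n))
derive env zero    _ = nothing
derive env (suc k) 1 = just (false , one)
derive env (suc k) n = search env (λ e → e)
  where
  search : ∀ l → (∀ {x} → x ∈ₗ l → x ∈ₗ env) → Maybe (∃ (Derives env n))
  search []            _ = nothing
  search ((q , b) ∷ l) i with q ∣? n
  ... | no  _ = search l (λ e → i (there e))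
  ... | yes (ℕ.divides c n≡cq) = derive env k c >>= λ (v , d) →
    just (b xor v , subst (λ n → Derives env n (b xor v)) (sym n≡cq) (step (i (here refl)) d))

deriveℤ : ∀ s env z → Maybe (∃ (Derivesℤ s env z))
deriveℤ s env (+ n)    = derive env 10 n >>= λ (v , d) → just (v , pos d)
deriveℤ s env -[1+ n ] = derive env 10 (suc n) >>= λ (v , d) → just (s xor v , neg d)

expect : ∀ {P : Bool → Set} b → ∃ P → Maybe (P b)
expect b (v , p) with v Bool.≟ b
... | yes refl = just p
... | no  _    = nothing

-- R is derivability in the certificates and the graph of χ afterwards. With b as the middle value
-- one record covers both patterns.
record Forbidden (R : ℤ → Bool → Set) : Set where
  constructor forbidden
  field
    b   : Bool
    a d : ℤ
    v₀  : R a (not b)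
    v₁  : R (a + d) b
    v₂  : R (a + + 2 * d) b
    v₃  : R (a + + 3 * d) b
    v₄  : R (a + + 4 * d) (not b)

data Argument (s : Bool) (N : ℕ) (env : Env) : Set where
  killed : Forbidden (Derivesℤ s env) → Argument s N env
  branch : ∀ q → 0 ℕ.< q → q ℕ.< N → Argument s N ((q , false) ∷ env) → Argument s N
      ((q , true) ∷ env) → Argument s N env
  agrees : ∀ M → (∀ j → j ℕ.< N → modulus M ℕ.∣ j ⊎ Derives env j (ψ M (+ j))) → Argument s N env

data Tree : Set where
  kill  : ℤ → ℤ → Tree
  split : ℕ → Tree → Tree → Tree
  agree : Model → Tree

checkAll : ∀ n {P : ℕ → Set} → (∀ i → Maybe (P i)) → Maybe (∀ i → i ℕ.< n → P i)
checkAll zero    f = just λ _ ()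
checkAll (suc n) f = f 0 >>= λ p₀ → checkAll n (λ i → f (suc i)) >>= λ ps → just λ where
  zero    _         → p₀
  (suc i) (s≤s i<n) → ps i i<n

check : ∀ s N env → Tree → Maybe (Argument s N env)
check s N env (kill a d) =
  deriveℤ s env (a + d) >>= λ (b , v₁) →
  deriveℤ s env a >>= expect (not b) >>= λ v₀ →
  deriveℤ s env (a + + 2 * d) >>= expect b >>= λ v₂ →
  deriveℤ s env (a + + 3 * d) >>= expect b >>= λ v₃ →
  deriveℤ s env (a + + 4 * d) >>= expect (not b) >>= λ v₄ →
  just (killed (forbidden b a d v₀ v₁ v₂ v₃ v₄))
check s N env (split q l r) with 1 ℕ.≤? q | suc q ℕ.≤? N
... | yes 0<q | yes q<N = check s N ((q , false) ∷ env) l >>= λ L → check s N ((q , true) ∷ env) r >>= λ R →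
  just (branch q 0<q q<N L R)
... | _       | _       = nothing
check s N env (agree M) = checkAll N (λ j → known j (modulus M ∣? j)) >>= λ p → just (agrees M p)
  where
  known : ∀ j → Dec (modulus M ℕ.∣ j) → Maybe (modulus M ℕ.∣ j ⊎ Derives env j (ψ M (+ j)))
  known j (yes d) = just (inj₁ d)
  known j (no  _) = derive env 10 j >>= expect (ψ M (+ j)) >>= λ d → just (inj₂ d)

-- The outcome of the search: `kill a d` names the progression a, a + d, ..., a + 4d that becomes a
-- pattern under the assumed values, and `agree` a model that fits all of them.
tree : Tree
tree =
  split 3
    (split 5
     (kill (- + 6) (+ 1))
     (split 7
      (split 11
       (kill (- + 15) (+ 4))
       (split 13
        (split 17
         (kill (- + 24) (+ 7))
         (split 19
          (split 23
           (kill (- + 24) (+ 1))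
           (split 29
            (kill (- + 33) (+ 4))
            (split 31
             (split 37
              (split 41
               (kill (- + 42) (+ 1))
               (agree mod3))
              (kill (- + 39) (+ 2)))
             (kill (- + 34) (+ 1)))))
          (kill (- + 21) (+ 2))))
        (kill (- + 16) (+ 1))))
      (kill (- + 12) (+ 5))))
    (split 5
     (split 7
      (split 11
       (split 13
        (kill (- + 21) (+ 8))
        (split 17
         -- Both values at 19 lead on to the same model, because the character modulo 19 prescribes
         -- nothing at 19; likewise 3 modulo 3.
         (split 19
          (split 23
           (split 29
            (kill (- + 29) (+ 7))
            (split 31
             (kill (- + 33) (+ 16))
             (split 37
              (kill (- + 37) (+ 5))
              (split 41
               (kill (- + 41) (+ 4))
               (agree mod19)))))
           (kill (- + 23) (+ 6)))
          (split 23
           (split 29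
            (kill (- + 29) (+ 7))
            (split 31
             (kill (- + 33) (+ 16))
             (split 37
              (kill (- + 37) (+ 5))
              (split 41
               (kill (- + 41) (+ 4))
               (agree mod19)))))
           (kill (- + 23) (+ 6))))
         (kill (- + 25) (+ 4))))
       (kill (- + 11) (+ 2)))
      (kill (- + 7) (+ 1)))
     (split 7
      (split 11
       (kill (- + 12) (+ 1))
       (split 13
        (split 17
         (kill (- + 18) (+ 1))
         (split 19
          (split 23
           (kill (- + 27) (+ 4))
           (split 29
            (kill (- + 39) (+ 10))
            (split 31
             (split 37
              (split 41
               (kill (- + 45) (+ 4))
               (agree mod3))
              (kill (- + 40) (+ 1)))
             (kill (- + 33) (+ 2)))))
          (kill (- + 36) (+ 17))))
        (kill (- + 24) (+ 11))))
      (kill (- + 9) (+ 2))))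

argument : Argument true 43 ((2 , true) ∷ [])
argument = from-just (check true 43 ((2 , true) ∷ []) tree)

argument-3-5 : Argument false 17 ((5 , true) ∷ (3 , true) ∷ (2 , false) ∷ [])
argument-3-5 = from-just (check false 17 ((5 , true) ∷ (3 , true) ∷ (2 , false) ∷ [])
  (split 7 (kill (- + 10) (+ 1)) (kill (- + 7) (+ 3))))

argument-3-7 : Argument false 17 ((7 , true) ∷ (5 , false) ∷ (3 , true) ∷ (2 , false) ∷ [])
argument-3-7 = from-just (check false 17 ((7 , true) ∷ (5 , false) ∷ (3 , true) ∷ (2 , false) ∷ [])
  (kill (- + 14) (+ 5)))

search : ∀ {P : ℕ → Set} → Decidable P → ∀ n →
         (∃ λ k → k ℕ.< n × P k × (∀ i → i ℕ.< k → ¬ P i)) ⊎ (∀ k → k ℕ.< n → ¬ P k)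
search P? zero    = inj₂ λ _ ()
search P? (suc n) with P? 0 | search (λ i → P? (suc i)) n
... | yes p₀ | _ = inj₁ (0 , s≤s z≤n , p₀ , λ _ ())
... | no ¬p₀ | inj₁ (k , k<n , pk , below) = inj₁ (suc k , s≤s k<n , pk , λ where
  zero    _         → ¬p₀
  (suc i) (s≤s i<k) → below i i<k)
... | no ¬p₀ | inj₂ none = inj₂ λ where
  zero    _         → ¬p₀
  (suc i) (s≤s i<n) → none i i<n

-- This is how minimality of n is applied: up to sign such a term n - e is smaller than n.
∣n-e∣<n : ∀ n e → 0 ℕ.< e → e ℕ.< n ℕ.+ n → ∣ + n - + e ∣ ℕ.< n
∣n-e∣<n n e 0<e e<2n = below-or-above e n {λ e → 0 ℕ.< e → e ℕ.< n ℕ.+ n → ∣ + n - + e ∣ ℕ.< n}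
  (λ e<n 0<e _ → difference (ℕ.<⇒≤ e<n) {λ n → ∣ + n - + e ∣ ℕ.< n} λ f →
    subst (ℕ._< e ℕ.+ f) (cong ∣_∣ (lem (+ e) (+ f))) (ℕ.m<n+m f 0<e))
  (λ f _ n+f<2n → subst (ℕ._< n) (trans (sym (ℤ.∣-i∣≡∣i∣ (+ f))) (cong ∣_∣ (lem₂ (+ n) (+ f))))
      (ℕ.+-cancelˡ-< n f n n+f<2n))
  0<e e<2n
  where
  lem : ∀ e f → f ≡ e + f - e
  lem = solve-∀
  lem₂ : ∀ n f → - f ≡ n - (n + f)
  lem₂ = solve-∀

-- The model characters modulo 3 and 19

module _ (M : Model) where
  private module R = Residues (half M)

  %-≈ : ∀ z → z R.≈ + (z %ℕ modulus M)
  %-≈ z = R.≈-sym ((z /ℕ modulus M) R., trans (a≡a%ℕn+[a/ℕn]*n z (modulus M))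
      (cong (λ q → + (z %ℕ modulus M) + (z /ℕ modulus M) * q) R.+p≡P))

  %-cong : ∀ {x y} → x R.≈ y → x %ℕ modulus M ≡ y %ℕ modulus M
  %-cong {x} {y} x≈y = R.residue-unique (R.≈-trans (R.≈-sym (%-≈ x)) (R.≈-trans x≈y (%-≈ y)))
    (n%ℕd<d x (modulus M)) (n%ℕd<d y (modulus M))

  ψ-cong : ∀ {x y} → x R.≈ y → ψ M x ≡ ψ M y
  ψ-cong x≈y = cong (nonresidue? M) (%-cong x≈y)

ψ-neg-residue : ∀ M r → r ℕ.< modulus M → r ≡ 0 ⊎ ψ M (- + r) ≡ not (ψ M (+ r))
ψ-neg-residue mod3  r r< = from-yes (ℕ.allUpTo? (λ r → r ℕ.≟ 0 ⊎-dec (ψ mod3 (- + r) Bool.≟ not (ψ mod3 (+ r)))) 3) r<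
ψ-neg-residue mod19 r r< = from-yes (ℕ.allUpTo? (λ r → r ℕ.≟ 0 ⊎-dec (ψ mod19 (- + r) Bool.≟ not
    (ψ mod19 (+ r)))) 19) r<

ψ-neg : ∀ M z → z %ℕ modulus M ≢ 0 → ψ M (- z) ≡ not (ψ M z)
ψ-neg M z z≢0 = [ (λ e → contradiction e z≢0) ,
  (λ e → trans (ψ-cong M (R.neg-≈ (%-≈ M z))) (trans e (cong not (sym (ψ-cong M (%-≈ M z)))))) ]′
  (ψ-neg-residue M (z %ℕ modulus M) (n%ℕd<d z (modulus M)))
  where module R = Residues (half M)

Clash : Model → ℕ → ℕ → Set
Clash M r j = j ≢ 0 × (+ r - + j) %ℕ modulus M ≢ 0 × ψ M (+ r - + j) ≡ ψ M (+ j)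

clash? : ∀ M r j → Dec (Clash M r j)
clash? M r j = ¬? (j ℕ.≟ 0) ×-dec ¬? ((+ r - + j) %ℕ modulus M ℕ.≟ 0) ×-dec (ψ M (+ r - + j) Bool.≟ ψ M (+ j))

-- For r = p mod M this is incompatible with χ (p - j) = not (χ j) if χ and ψ agree below p.
clash : ∀ M r → r ℕ.< modulus M → r ≡ 0 ⊎ ∃ λ j → j ℕ.< modulus M × Clash M r j
clash mod3  r r< = from-yes (ℕ.allUpTo? (λ r → r ℕ.≟ 0 ⊎-dec ℕ.anyUpTo? (clash? mod3 r) 3) 3) r<
clash mod19 r r< = from-yes (ℕ.allUpTo? (λ r → r ℕ.≟ 0 ⊎-dec ℕ.anyUpTo? (clash? mod19 r) 19) 19) r<

Run19 : ℕ → ℕ → Set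
Run19 r d = 0 ℕ.< d × d ℕ.≤ 18 ×
  (ψ mod19 (+ r - + d) ≡ ψ mod19 (+ r) × (+ r - + d) %ℕ 19 ≢ 0) ×
  (ψ mod19 (+ r - + 2 * + d) ≡ ψ mod19 (+ r) × (+ r - + 2 * + d) %ℕ 19 ≢ 0) ×
  (ψ mod19 (+ r - + 3 * + d) ≡ ψ mod19 (+ r) × (+ r - + 3 * + d) %ℕ 19 ≢ 0) ×
  (ψ mod19 (+ r - + 4 * + d) ≡ not (ψ mod19 (+ r)) × (+ r - + 4 * + d) %ℕ 19 ≢ 0)

-- r - k d is 7/7, 6/7, 5/7, 4/7, 3/7 of r modulo 19: the residues 4, 5, 6, 7 follow the nonresidue 3.
run19 : ∀ r → r ℕ.< 19 → r ≡ 0 ⊎ Run19 r (11 ℕ.* r % 19)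
run19 r r< = from-yes (ℕ.allUpTo? (λ r → r ℕ.≟ 0 ⊎-dec run? r (11 ℕ.* r % 19)) 19) r<
  where
  term? : ∀ z b → Dec (ψ mod19 z ≡ b × z %ℕ 19 ≢ 0)
  term? z b = (ψ mod19 z Bool.≟ b) ×-dec ¬? (z %ℕ 19 ℕ.≟ 0)
  run? : ∀ r d → Dec (Run19 r d)
  run? r d = (1 ℕ.≤? d) ×-dec (d ℕ.≤? 18) ×-dec term? (+ r - + d) _ ×-dec term? (+ r - + 2 * + d) _ ×-dec
    term? (+ r - + 3 * + d) _ ×-dec term? (+ r - + 4 * + d) _

-- The progression is n - 3d, ..., n + d, with e for χ 3. Since ψ says nothing about multiples of 3,
-- the factor 3 is taken out of n - 2d and g out of n + d; the latter also brings that term below n.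
-- Working modulo 27 leaves cofactors known modulo 3 even for g = 9.
Run3 : Bool → ℕ → ℕ → ℕ → ℤ → ℤ → Set
Run3 e g r d u v = 0 ℕ.< d × d ℕ.≤ 26 ×
  (ψ mod3 (+ r - + 3 * + d) ≡ ψ mod3 (+ r) × (+ r - + 3 * + d) %ℕ 3 ≢ 0) ×
  (+ r - + 2 * + d ≡ + 3 * u × e xor ψ mod3 u ≡ not (ψ mod3 (+ r)) × u %ℕ 3 ≢ 0) ×
  (ψ mod3 (+ r - + d) ≡ not (ψ mod3 (+ r)) × (+ r - + d) %ℕ 3 ≢ 0) ×
  (+ r + + d ≡ + g * v × ψ mod3 v ≡ ψ mod3 (+ r) × v %ℕ 3 ≢ 0)

run3? : ∀ e g r d u v → Dec (Run3 e g r d u v)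
run3? e g r d u v = (1 ℕ.≤? d) ×-dec (d ℕ.≤? 26) ×-dec
  ((ψ mod3 (+ r - + 3 * + d) Bool.≟ _) ×-dec ¬? ((+ r - + 3 * + d) %ℕ 3 ℕ.≟ 0)) ×-dec
  ((+ r - + 2 * + d ℤ.≟ + 3 * u) ×-dec (e xor ψ mod3 u Bool.≟ _) ×-dec ¬? (u %ℕ 3 ℕ.≟ 0)) ×-dec
  ((ψ mod3 (+ r - + d) Bool.≟ _) ×-dec ¬? ((+ r - + d) %ℕ 3 ℕ.≟ 0)) ×-dec
  ((+ r + + d ℤ.≟ + g * v) ×-dec (ψ mod3 v Bool.≟ _) ×-dec ¬? (v %ℕ 3 ℕ.≟ 0))

SomeRun3 : Bool → ℕ → ℕ → Set
SomeRun3 e g r = ∃ λ d → ∃₂ λ u v → Run3 e g r d u v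

-- The power of 3 taken out of n + d has the value false under χ.
run3 : ∀ e r → r ℕ.< 27 → r % 3 ≡ 0 ⊎ ∃ λ c → SomeRun3 e (suc (suc (suc c))) r × (c ≡ 0 × e ≡ false ⊎ c ≡ 6)
run3 false r r< = [ inj₁ , (λ run → inj₂ (0 , (d , u , v , run) , inj₁ (refl , refl))) ]′
  (from-yes (ℕ.allUpTo? (λ r → (r % 3 ℕ.≟ 0) ⊎-dec (let d = 2 ℕ.* r % 27 in run3? false 3 r d
      ((+ r - + 2 * + d) /ℕ 3) ((+ r + + d) /ℕ 3))) 27) r<)
  where
  -- With d = 2r the terms are -5r, -3r, -r, r, 3r modulo 27; the cofactors are -r and r.
  d = 2 ℕ.* r % 27
  u = (+ r - + 2 * + d) /ℕ 3
  v = (+ r + + d) /ℕ 3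
run3 true  r r< = [ inj₁ , (λ run → inj₂ (6 , (d , u , v , run) , inj₂ refl)) ]′
  (from-yes (ℕ.allUpTo? (λ r → (r % 3 ℕ.≟ 0) ⊎-dec (let d = 8 ℕ.* r % 27 in run3? true 9 r d ((+ r - + 2 * + d) /ℕ 3)
      ((+ r + + d) /ℕ 9))) 27) r<)
  where
  -- With d = 8r the terms are -23r, -15r, -7r, r, 9r modulo 27. Now 3 contributes a sign, so the
  -- cofactor -5r of 3 is congruent to r modulo 3, and 9 is a square.
  d = 8 ℕ.* r % 27
  u = (+ r - + 2 * + d) /ℕ 3
  v = (+ r + + d) /ℕ 9

-- Rigidity of the character for p = 3 modulo 8

module Rigidity (m : ℕ) (isPrime : Prime (suc (m ℕ.+ m))) where

  open Residues m
  open Legendre m isPrime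

  Known : ℕ → Bool → Set
  Known n b = ¬ + n ≈ + 0 × χ (+ n) ≡ b

  Pattern : Set
  Pattern = Forbidden λ z b → χ z ≡ b

  unit-* : ∀ {x y} → ¬ x ≈ + 0 → ¬ y ≈ + 0 → ¬ x * y ≈ + 0
  unit-* {x} {y} x≉0 y≉0 e = [ x≉0 , y≉0 ]′ (euclid x y e)

  unit-neg : ∀ {x} → ¬ x ≈ + 0 → ¬ - x ≈ + 0
  unit-neg {x} x≉0 e = x≉0 (≈-trans (≡⇒≈ (lem x)) (neg-≈ e))
    where
    lem : ∀ x → x ≡ - - x
    lem = solve-∀

  ∣small∣≉0 : ∀ z → 0 ℕ.< ∣ z ∣ → ∣ z ∣ ℕ.< pℕ → ¬ z ≈ + 0
  ∣small∣≉0 (+ n)    0<n n<p = small≉0 n 0<n n<p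
  ∣small∣≉0 -[1+ n ] 0<n n<p e = small≉0 (suc n) 0<n n<p (neg-≈ e)

  module Sign (s : Bool) (χ-1 : χ -1ℤ ≡ s) where

    χ-neg : ∀ {x} → ¬ x ≈ + 0 → χ (- x) ≡ s xor χ x
    χ-neg {x} x≉0 = trans (cong χ (sym (ℤ.-1*i≡-i x))) (trans (χ-* -1ℤ x -1≉0 x≉0) (cong (_xor χ x) χ-1))
      where
      -1≉0 : ¬ -1ℤ ≈ + 0
      -1≉0 = unit-neg 1≉0

    sound : ∀ {env} → All (λ (q , b) → Known q b) env → ∀ {n b} → Derives env n b → Known n b
    sound known one = 1≉0 , χ1
    sound known (step {q} {b} {c} {v} q∈ d) = combine (All.lookup known q∈) (sound known d)
      where
      combine : Known q b → Known c v → Known (c ℕ.* q) (b xor v)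
      combine (q≉0 , χq) (c≉0 , χc) = (λ e → unit-* c≉0 q≉0 (≈-trans (≡⇒≈ (sym (ℤ.pos-* c q))) e)) ,
        trans (cong χ (ℤ.pos-* c q)) (trans (χ-* (+ c) (+ q) c≉0 q≉0) (trans (cong₂ _xor_ χc χq) (Bool.xor-comm v b)))

    soundℤ : ∀ {env} → All (λ (q , b) → Known q b) env → ∀ {z b} → Derivesℤ s env z b → χ z ≡ b
    soundℤ known (pos d) = proj₂ (sound known d)
    soundℤ known (neg d) = trans (χ-neg (proj₁ (sound known d))) (cong (s xor_) (proj₂ (sound known d)))

    Agrees : Model → ℕ → Set
    Agrees M n = ∀ j → j ℕ.< n → modulus M ℕ.∣ j ⊎ χ (+ j) ≡ ψ M (+ j)

    interpret : ∀ {N env} → N ℕ.≤ pℕ → Argument s N env → All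
        (λ (q , b) → Known q b) env → ¬ Pattern → ∃ λ M → Agrees M N
    interpret N≤p (killed (forbidden b a d v₀ v₁ v₂ v₃ v₄)) known ¬pattern = contradiction
      (forbidden b a d (soundℤ known v₀) (soundℤ known v₁) (soundℤ known v₂) (soundℤ known v₃)
          (soundℤ known v₄)) ¬pattern
    interpret {N} {env} N≤p (branch q 0<q q<N f t) known ¬pattern = byValue (χ (+ q)) refl
      where
      byValue : ∀ b → χ (+ q) ≡ b → ∃ λ M → Agrees M N
      byValue false e = interpret N≤p f ((small≉0 q 0<q (ℕ.<-≤-trans q<N N≤p) , e) ∷ known) ¬pattern
      byValue true  e = interpret N≤p t ((small≉0 q 0<q (ℕ.<-≤-trans q<N N≤p) , e) ∷ known) ¬pattern
    interpret N≤p (agrees M p) known ¬pattern = M , λ j j<N → [ inj₁ , (λ d → inj₂ (proj₂ (sound known d))) ]′ (p j j<N)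

  module Odd (χ-1 : χ -1ℤ ≡ true) (χ2 : χ (+ 2) ≡ true) (43≤p : 43 ℕ.≤ pℕ) (¬pattern : ¬ Pattern) where

    open Sign true χ-1

    modulus<43 : ∀ M → modulus M ℕ.< 43
    modulus<43 mod3  = from-yes (3 ℕ.<? 43)
    modulus<43 mod19 = from-yes (19 ℕ.<? 43)

    %≢0⇒>0 : ∀ M z → z %ℕ modulus M ≢ 0 → 0 ℕ.< ∣ z ∣
    %≢0⇒>0 M (+ zero)  e = contradiction refl e
    %≢0⇒>0 M (+ suc n) e = s≤s z≤n
    %≢0⇒>0 M -[1+ n ]  e = s≤s z≤n

    agreesℤ : ∀ M {n} → Agrees M n → n ℕ.≤ pℕ → ∀ z → ∣ z ∣ ℕ.< n → z %ℕ modulus M ≢ 0 → χ z ≡ ψ M z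
    agreesℤ M agr n≤p (+ j) j<n z≢0 = [ (λ M∣j → contradiction (ℕ.n∣m⇒m%n≡0 j (modulus M) M∣j) z≢0) , (λ e → e) ]′
        (agr j j<n)
    agreesℤ M agr n≤p z@(-[1+ j ]) j<n z≢0 = trans (χ-neg {+ suc j} (small≉0 (suc j) (s≤s z≤n) (ℕ.<-≤-trans j<n n≤p)))
      (trans (cong not (agreesℤ M agr n≤p (+ suc j) j<n (λ e → residue-neg e)))
          (sym (ψ-neg M (+ suc j) (λ e → residue-neg e))))
      where
      residue-neg : ¬ suc j % modulus M ≡ 0
      residue-neg e = z≢0 (zero-neg (ℕ.m%n≡0⇒n∣m (suc j) (modulus M) e))
        where
        module R = Residues (half M)
        zero-neg : modulus M ℕ.∣ suc j → z %ℕ modulus M ≡ 0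
        zero-neg (ℕ.divides c eq) = trans (%-cong M {z} {+ 0} ((+ c) R., sym (trans (cong (λ k → - + k + + c * R.P) eq)
          (trans (cong (λ k → - k + + c * R.P) (ℤ.pos-* c (modulus M)))
              (trans (cong (λ q → - (+ c * q) + + c * R.P) R.+p≡P) (lem (+ c * R.P))))))) refl
          where
          lem : ∀ x → - x + x ≡ + 0
          lem = solve-∀

    disagrees? : ∀ M j → Dec (¬ modulus M ℕ.∣ j × χ (+ j) ≢ ψ M (+ j))
    disagrees? M j = ¬? (modulus M ∣? j) ×-dec ¬? (χ (+ j) Bool.≟ ψ M (+ j))

    ¬disagrees⇒agrees : ∀ M {j} → ¬ (¬ modulus M ℕ.∣ j × χ (+ j) ≢ ψ M (+ j)) → modulus M ℕ.∣ j ⊎ χ (+ j) ≡ ψ M (+ j)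
    ¬disagrees⇒agrees M {j} ¬dis = decide (modulus M ∣? j) (χ (+ j) Bool.≟ ψ M (+ j))
      where
      decide : Dec (modulus M ℕ.∣ j) → Dec (χ (+ j) ≡ ψ M (+ j)) → modulus M ℕ.∣ j ⊎ χ (+ j) ≡ ψ M (+ j)
      decide (yes d) _       = inj₁ d
      decide (no ¬d) (yes e) = inj₂ e
      decide (no ¬d) (no ¬e) = contradiction (¬d , ¬e) ¬dis

    ¬agrees-everywhere : ∀ M → ¬ Agrees M pℕ
    ¬agrees-everywhere M agr = [ p≢0 , (λ (j , j<M , c) → refute j j<M c) ]′ (clash M r (m%n<n pℕ (modulus M)))
      where
      module R = Residues (half M)
      r = pℕ % modulus M
      M<p : modulus M ℕ.< pℕ
      M<p = ℕ.<-≤-trans (modulus<43 M) 43≤p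
      p≢0 : ¬ r ≡ 0
      p≢0 e = [ (λ e → nontrivial M e) , (λ e → ℕ.<⇒≢ M<p e) ]′ (prime⇒irreducible isPrime
          (ℕ.m%n≡0⇒n∣m pℕ (modulus M) e))
        where
        nontrivial : ∀ M → ¬ modulus M ≡ 1
        nontrivial mod3  ()
        nontrivial mod19 ()
      refute : ∀ j → j ℕ.< modulus M → ¬ Clash M r j
      refute j j<M (j≢0 , r-j≢0 , ψ≡) = Bool.not-¬ {ψ M (+ j)} refl
        (trans (sym (trans χ≡ψ (trans (ψ-cong M shift) ψ≡))) χp-j)
        where
        0<j : 0 ℕ.< j
        0<j = ℕ.n≢0⇒n>0 j≢0
        shift : (+ pℕ - + j) R.≈ (+ r - + j)
        shift = R.+-≈ (- + j) (%-≈ M (+ pℕ))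
        j%≢0 : + j %ℕ modulus M ≢ 0
        j%≢0 e = j≢0 (trans (sym (m<n⇒m%n≡m j<M)) e)
        χp-j : χ (+ pℕ - + j) ≡ not (ψ M (+ j))
        χp-j = trans (χ-cong { + pℕ - + j} { - + j} (- (+ 1) , trans (lem (+ j) (+ pℕ))
            (cong (λ q → + pℕ - + j + - (+ 1) * q) +p≡P)))
          (trans (χ-neg {+ j} (small≉0 j 0<j (ℕ.<-trans j<M M<p))) (cong not
              (agreesℤ M agr ℕ.≤-refl (+ j) (ℕ.<-trans j<M M<p) j%≢0)))
          where
          lem : ∀ j p → - j ≡ p - j + - (+ 1) * p
          lem = solve-∀
        χ≡ψ : χ (+ pℕ - + j) ≡ ψ M (+ pℕ - + j)
        χ≡ψ = agreesℤ M agr ℕ.≤-refl (+ pℕ - + j)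
          (∣n-e∣<n pℕ j 0<j (ℕ.<-trans (ℕ.<-trans j<M M<p) (ℕ.m<m+n pℕ (s≤s z≤n))))
              (λ e → r-j≢0 (trans (sym (%-cong M shift)) e))

    module Least (n : ℕ) (n<p : n ℕ.< pℕ) (43≤n : 43 ℕ.≤ n) where

      -- From 43 ≤ n follows e < 86 ≤ 2n, hence |n - e| < n. The largest e that occur are 4 * 18 =
      -- 72 modulo 19 and 3 * 26 = 78 modulo 27.
      close : ∀ M → Agrees M n → ∀ r e → + e ≢ + 0 → e ℕ.< 86 → ∀ {b} →
              Residues._≈_ (half M) (+ n) (+ r) → ψ M (+ r - + e) ≡ b × (+ r - + e) %ℕ modulus M ≢ 0 → χ (+ n - + e) ≡ b
      close M agr r e e≢0 e<86 n≈r (ψ≡ , ≢0) = trans (agreesℤ M agr (ℕ.<⇒≤ n<p) (+ n - + e)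
          (∣n-e∣<n n e (ℕ.n≢0⇒n>0 (λ { refl → e≢0 refl })) (ℕ.<-≤-trans e<86 (ℕ.+-mono-≤ 43≤n 43≤n)))
          (λ z → ≢0 (trans (sym (%-cong M (R.+-≈ (- + e) n≈r))) z)))
        (trans (ψ-cong M (R.+-≈ (- + e) n≈r)) ψ≡)
        where module R = Residues (half M)

      -- The progression descends from n. The value at n, being opposite to ψ, closes at one end the
      -- three equal values that 3/7 closes at the other.
      pattern19 : Agrees mod19 n → ¬ 19 ℕ.∣ n → χ (+ n) ≢ ψ mod19 (+ n) → Pattern
      pattern19 agr 19∤n χ≢ψ = [ (λ r≡0 → contradiction (ℕ.m%n≡0⇒n∣m n 19 r≡0) 19∤n) , build ]′ (run19 r (m%n<n n 19))
        where
        r = n % 19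
        -- 11 is the inverse of 7 modulo 19.
        d = 11 ℕ.* r % 19
        module R = Residues 9
        n≈r : + n R.≈ + r
        n≈r = %-≈ mod19 (+ n)
        build : Run19 r d → Pattern
        build (0<d , d≤18 , t₁ , t₂ , t₃ , t₄) = forbidden (ψ mod19 (+ r)) (+ n) (- + d)
          (trans (Bool.¬-not χ≢ψ) (cong not (ψ-cong mod19 n≈r)))
          (term 1 (s≤s z≤n) (from-yes (1 ℕ.≤? 4)) (lem₁ (+ n) (+ d)) (lem₁ (+ r) (+ d)) t₁)
          (term 2 (s≤s z≤n) (from-yes (2 ℕ.≤? 4)) (lem₂ (+ n) (+ d) (+ 2)) (lem₃ (+ r) (+ d) (+ 2)) t₂)
          (term 3 (s≤s z≤n) (from-yes (3 ℕ.≤? 4)) (lem₂ (+ n) (+ d) (+ 3)) (lem₃ (+ r) (+ d) (+ 3)) t₃)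
          (term 4 (s≤s z≤n) (from-yes (4 ℕ.≤? 4)) (lem₂ (+ n) (+ d) (+ 4)) (lem₃ (+ r) (+ d) (+ 4)) t₄)
          where
          lem₁ : ∀ n d → n + - d ≡ n - + 1 * d
          lem₁ = solve-∀
          lem₂ : ∀ n d k → n + k * - d ≡ n - k * d
          lem₂ = solve-∀
          lem₃ : ∀ n d k → n - k * d ≡ n - k * d
          lem₃ _ _ _ = refl
          term : ∀ k → 1 ℕ.≤ k → k ℕ.≤ 4 → ∀ {z y b} → z ≡ + n - + k * + d → y ≡ + r - + k * + d → ψ mod19 y ≡ b × y
              %ℕ 19 ≢ 0 → χ z ≡ b
          term k 1≤k k≤4 refl refl t = trans (cong (λ x → χ (+ n - x)) (sym (ℤ.pos-* k d)))
            (close mod19 agr r (k ℕ.* d) (λ e → ℕ.<⇒≢ (ℕ.*-mono-≤ 1≤k 0<d) (sym (ℤ.+-injective e)))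
              (ℕ.≤-<-trans (ℕ.*-mono-≤ k≤4 d≤18) (from-yes (72 ℕ.<? 86))) n≈r
              (subst (λ x → ψ mod19 (+ r - x) ≡ _ × (+ r - x) %ℕ 19 ≢ 0) (sym (ℤ.pos-* k d)) t))

      pattern3 : Agrees mod3 n → ¬ 3 ℕ.∣ n → χ (+ n) ≢ ψ mod3 (+ n) → Pattern
      pattern3 agr 3∤n χ≢ψ = [ (λ r≡0 → contradiction (3∣n r≡0) 3∤n) , build ]′ (run3 (χ (+ 3)) r (m%n<n n 27))
        where
        r = n % 27
        c = n / 27
        module R = Residues 1
        n≡ : + n ≡ + r + + c * + 27
        n≡ = trans (cong +_ (m≡m%n+[m/n]*n n 27)) (cong (λ x → + r + x) (ℤ.pos-* c 27))
        n≈r : + n R.≈ + r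
        n≈r = R.≈-sym ((+ c * + 9) R., trans n≡ (lem (+ r) (+ c)))
          where
          lem : ∀ r c → r + c * + 27 ≡ r + c * + 9 * + 3
          lem = solve-∀
        3∣n : r % 3 ≡ 0 → 3 ℕ.∣ n
        3∣n e = ℕ.m%n≡0⇒n∣m n 3 (trans (%-cong mod3 n≈r) e)
        3<p : 3 ℕ.< pℕ
        3<p = ℕ.<-≤-trans (from-yes (3 ℕ.<? 43)) 43≤p
        3≉0 : ¬ + 3 ≈ + 0
        3≉0 = small≉0 3 (s≤s z≤n) 3<p
        χ9 : χ (+ 9) ≡ false
        χ9 = trans (χ-* (+ 3) (+ 3) 3≉0 3≉0) (Bool.xor-same (χ (+ 3)))
        build : (∃ λ k → SomeRun3 (χ (+ 3)) (3 ℕ.+ k) r × (k ≡ 0 × χ (+ 3) ≡ false ⊎ k ≡ 6)) → Pattern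
        build (k , (d , u₀ , v₀ , 0<d , d≤26 , t₀ , (u₀≡ , tu , u≢0) , t₂ , (v₀≡ , tv , v≢0)) , ks) =
          forbidden (not (ψ mod3 (+ r))) (+ n - + 3 * + d) (+ d)
            (trans (subst (λ x → χ (+ n - x) ≡ ψ mod3 (+ r)) (ℤ.pos-* 3 d)
              (close mod3 agr r (3 ℕ.* d) (λ e → ℕ.<⇒≢ (ℕ.*-mono-≤ (s≤s {n = 2} z≤n) 0<d) (sym (ℤ.+-injective e)))
                (ℕ.≤-<-trans (ℕ.*-monoʳ-≤ 3 d≤26) (from-yes (78 ℕ.<? 86))) n≈r
                (subst (λ x → ψ mod3 (+ r - x) ≡ ψ mod3 (+ r) × (+ r - x) %ℕ 3 ≢ 0) (sym (ℤ.pos-* 3 d)) t₀)))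
              (sym (Bool.not-involutive (ψ mod3 (+ r)))))
            (trans (cong χ (trans (lem₁ (+ n) (+ d)) 3u≡)) (trans (χ-* (+ 3) u 3≉0 (unitOf ∣u∣<n u%≢0))
                (trans (cong (χ (+ 3) xor_)
              (trans (agreesℤ mod3 agr (ℕ.<⇒≤ n<p) u ∣u∣<n u%≢0) (ψ-cong mod3 u≈))) tu)))
            (trans (cong χ (lem₂ (+ n) (+ d)))
              (close mod3 agr r d (λ e → ℕ.<⇒≢ 0<d (sym (ℤ.+-injective e)))
                  (ℕ.≤-<-trans d≤26 (from-yes (26 ℕ.<? 86))) n≈r t₂))
            (trans (cong χ (lem₃ (+ n) (+ d))) (trans (Bool.¬-not χ≢ψ) (cong not (ψ-cong mod3 n≈r))))
            (trans (cong χ (trans (lem₄ (+ n) (+ d)) (proj₁ (proj₂ V))))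
                (trans (χ-* (+ (3 ℕ.+ k)) v (proj₁ (χg ks)) (unitOf ∣v∣<n v%≢0))
              (trans (cong₂ _xor_ (proj₂ (χg ks)) (trans (agreesℤ mod3 agr (ℕ.<⇒≤ n<p) v ∣v∣<n v%≢0)
                  (trans (ψ-cong mod3 (proj₂ (proj₂ V))) tv)))
                (sym (Bool.not-involutive (ψ mod3 (+ r)))))))
          where
          lem₁ : ∀ n d → n - + 3 * d + d ≡ n - + 2 * d
          lem₁ = solve-∀
          lem₂ : ∀ n d → n - + 3 * d + + 2 * d ≡ n - d
          lem₂ = solve-∀
          lem₃ : ∀ n d → n - + 3 * d + + 3 * d ≡ n
          lem₃ = solve-∀
          lem₄ : ∀ n d → n - + 3 * d + + 4 * d ≡ n + d
          lem₄ = solve-∀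
          u : ℤ
          u = u₀ + + c * + 9
          3u≡ : + n - + 2 * + d ≡ + 3 * u
          3u≡ = trans (cong (λ x → x - + 2 * + d) n≡) (trans (lem (+ r) (+ c) (+ d))
              (trans (cong (_+ + c * + 27) u₀≡) (lem′ u₀ (+ c))))
            where
            lem : ∀ r c d → r + c * + 27 - + 2 * d ≡ r - + 2 * d + c * + 27
            lem = solve-∀
            lem′ : ∀ u c → + 3 * u + c * + 27 ≡ + 3 * (u + c * + 9)
            lem′ = solve-∀
          u≈ : u R.≈ u₀
          u≈ = R.≈-sym ((+ c * + 3) R., lem u₀ (+ c))
            where
            lem : ∀ u c → u + c * + 9 ≡ u + c * + 3 * + 3
            lem = solve-∀
          u%≢0 : u %ℕ 3 ≢ 0
          u%≢0 e = u≢0 (trans (sym (%-cong mod3 u≈)) e)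
          ∣u∣<n : ∣ u ∣ ℕ.< n
          ∣u∣<n = ℕ.≤-<-trans (ℕ.m≤n*m ∣ u ∣ 3) (subst (ℕ._< n) (trans (cong (λ x → ∣ + n - x ∣) (ℤ.pos-* 2 d))
              (trans (cong ∣_∣ 3u≡) (ℤ.abs-* (+ 3) u)))
            (∣n-e∣<n n (2 ℕ.* d) (ℕ.*-mono-≤ (s≤s {n = 1} z≤n) 0<d) (ℕ.≤-<-trans (ℕ.*-monoʳ-≤ 2 d≤26)
                (ℕ.<-≤-trans (from-yes (52 ℕ.<? 86)) (ℕ.+-mono-≤ 43≤n 43≤n)))))
          unitOf : ∀ {z} → ∣ z ∣ ℕ.< n → z %ℕ 3 ≢ 0 → ¬ z ≈ + 0
          unitOf {z} z<n z≢0 = ∣small∣≉0 z (%≢0⇒>0 mod3 z z≢0) (ℕ.<-trans z<n n<p)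
          χg : (k ≡ 0 × χ (+ 3) ≡ false ⊎ k ≡ 6) → ¬ + (3 ℕ.+ k) ≈ + 0 × χ (+ (3 ℕ.+ k)) ≡ false
          χg (inj₁ (refl , e)) = 3≉0 , e
          χg (inj₂ refl)       = unit-* 3≉0 3≉0 , χ9
          V : ∃ λ v → + n + + d ≡ + (3 ℕ.+ k) * v × v R.≈ v₀
          V = lift ks
            where
            lift : (k ≡ 0 × χ (+ 3) ≡ false ⊎ k ≡ 6) → ∃ λ v → + n + + d ≡ + (3 ℕ.+ k) * v × v R.≈ v₀
            lift (inj₁ (refl , _)) = v₀ + + c * + 9 , trans (cong (_+ + d) n≡)
                (trans (lem (+ r) (+ c) (+ d)) (trans (cong (_+ + c * + 27) v₀≡) (lem′ v₀ (+ c)))) ,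
              R.≈-sym ((+ c * + 3) R., lem″ v₀ (+ c))
              where
              lem : ∀ r c d → r + c * + 27 + d ≡ r + d + c * + 27
              lem = solve-∀
              lem′ : ∀ u c → + 3 * u + c * + 27 ≡ + 3 * (u + c * + 9)
              lem′ = solve-∀
              lem″ : ∀ u c → u + c * + 9 ≡ u + c * + 3 * + 3
              lem″ = solve-∀
            lift (inj₂ refl) = v₀ + + c * + 3 , trans (cong (_+ + d) n≡)
                (trans (lem (+ r) (+ c) (+ d)) (trans (cong (_+ + c * + 27) v₀≡) (lem′ v₀ (+ c)))) ,
              R.≈-sym ((+ c) R., refl)
              where
              lem : ∀ r c d → r + c * + 27 + d ≡ r + d + c * + 27
              lem = solve-∀
              lem′ : ∀ u c → + 9 * u + c * + 27 ≡ + 9 * (u + c * + 3)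
              lem′ = solve-∀
          v : ℤ
          v = proj₁ V
          v%≢0 : v %ℕ 3 ≢ 0
          v%≢0 e = v≢0 (trans (sym (%-cong mod3 (proj₂ (proj₂ V)))) e)
          ∣v∣<n : ∣ v ∣ ℕ.< n
          ∣v∣<n = ℕ.*-cancelˡ-< 3 ∣ v ∣ n (ℕ.≤-<-trans (ℕ.*-monoˡ-≤ ∣ v ∣ (ℕ.m≤m+n 3 k)) (subst (ℕ._< 3 ℕ.* n)
            (trans (cong ∣_∣ (proj₁ (proj₂ V))) (ℤ.abs-* (+ (3 ℕ.+ k)) v))
            (ℕ.+-monoʳ-< n (ℕ.<-≤-trans (ℕ.≤-<-trans d≤26 (ℕ.<-≤-trans (from-yes (26 ℕ.<? 43)) 43≤n))
                (ℕ.m≤m+n n (n ℕ.+ 0))))))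

      least-pattern : ∀ M → Agrees M n → ¬ modulus M ℕ.∣ n × χ (+ n) ≢ ψ M (+ n) → Pattern
      least-pattern mod3  agr (M∤n , χ≢ψ) = pattern3 agr M∤n χ≢ψ
      least-pattern mod19 agr (M∤n , χ≢ψ) = pattern19 agr M∤n χ≢ψ

    contradictory : ⊥
    contradictory = refute (interpret 43≤p argument ((small≉0 2 (s≤s z≤n)
        (ℕ.<-≤-trans (from-yes (2 ℕ.<? 43)) 43≤p) , χ2) ∷ []) ¬pattern)
      where
      refute : (∃ λ M → Agrees M 43) → ⊥
      refute (M , agr₀) = [ fromLeast , (λ none → ¬agrees-everywhere M λ j j<p → ¬disagrees⇒agrees M (none j j<p)) ]′
          (search (disagrees? M) pℕ)
        where
        fromLeast : (∃ λ n → n ℕ.< pℕ × (¬ modulus M ℕ.∣ n × χ (+ n) ≢ ψ M (+ n)) ×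
            (∀ i → i ℕ.< n → ¬ (¬ modulus M ℕ.∣ i × χ (+ i) ≢ ψ M (+ i)))) → ⊥
        fromLeast (n , n<p , dis@(M∤n , χ≢ψ) , below) = ¬pattern (Least.least-pattern n n<p 43≤n M
            (λ j j<n → ¬disagrees⇒agrees M (below j j<n)) dis)
          where
          43≤n : 43 ℕ.≤ n
          43≤n = ℕ.≮⇒≥ λ n<43 → [ M∤n , χ≢ψ ]′ (agr₀ n n<43)

-- Least nonresidues for p = 1 modulo 8

module Nonresidues (m : ℕ) (isPrime : Prime (suc (m ℕ.+ m))) where

  open Residues m
  open Legendre m isPrime
  open Rigidity m isPrime
  open Sign

  module Even (χ-1 : χ -1ℤ ≡ false) (χ2 : χ (+ 2) ≡ false) (17≤p : 17 ℕ.≤ pℕ) (¬pattern : ¬ Pattern) where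

    2≉0 : ¬ + 2 ≈ + 0
    2≉0 = small≉0 2 (s≤s z≤n) (ℕ.<-≤-trans (from-yes (2 ℕ.<? 17)) 17≤p)

    χ-double : ∀ a → 0 ℕ.< a → a ℕ.< pℕ → χ (+ (a ℕ.+ a)) ≡ χ (+ a)
    χ-double a 0<a a<p = trans (cong χ (lem (+ a))) (trans (χ-* (+ 2) (+ a) 2≉0 (small≉0 a 0<a a<p))
        (cong (_xor χ (+ a)) χ2))
      where
      lem : ∀ a → a + a ≡ + 2 * a
      lem = solve-∀

    module TwoNonresidues
      (q : ℕ) (0<q : 0 ℕ.< q) (q<p : q ℕ.< pℕ) (χq : χ (+ q) ≡ true)
      (below-q : ∀ i → 0 ℕ.< i → i ℕ.< q → χ (+ i) ≡ false)
      (n : ℕ) (n<p : n ℕ.< pℕ) (q∤n : ¬ q ℕ.∣ n) (χn : χ (+ n) ≡ true)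
      (below-n : ∀ i → i ℕ.< n → ¬ q ℕ.∣ i → χ (+ i) ≡ false)
      where

      0<n : 0 ℕ.< n
      0<n = ℕ.n≢0⇒n>0 λ n≡0 → q∤n (subst (q ℕ.∣_) (sym n≡0) (q ℕ.∣0))

      q<n : q ℕ.< n
      q<n = ℕ.≤∧≢⇒< (ℕ.≮⇒≥ λ n<q → contradiction (trans (sym χn) (below-q n 0<n n<q)) λ ()) λ { refl → q∤n ℕ.∣-refl }

      below-nℤ : ∀ z → ∣ z ∣ ℕ.< n → ¬ + q ℤ.∣ z → χ z ≡ false
      below-nℤ (+ i)    i<n q∤i = below-n i i<n λ q∣i → q∤i (∣ᵤ⇒∣ q∣i)
      below-nℤ -[1+ i ] i<n q∤i = trans (χ-neg false χ-1 {+ suc i} (small≉0 (suc i) (s≤s z≤n) (ℕ.<-trans i<n n<p)))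
        (below-n (suc i) i<n λ q∣i → q∤i (∣ᵤ⇒∣ q∣i))

      -- As 2 is a residue, half of n would be a smaller nonresidue not divisible by q.
      n-odd : ∀ a → n ≢ a ℕ.+ a
      n-odd a n≡2a = contradiction (trans (sym χn) (trans (cong (λ n → χ (+ n)) n≡2a)
          (trans (χ-double a 0<a (ℕ.<-trans a<n n<p))
        (below-n a a<n λ q∣a → q∤n (subst (q ℕ.∣_) (sym n≡2a) (ℕ.∣m∣n⇒∣m+n q∣a q∣a)))))) λ ()
        where
        0<a : 0 ℕ.< a
        0<a = ℕ.n≢0⇒n>0 λ a≡0 → ℕ.<⇒≢ 0<n (sym (trans n≡2a (cong (λ a → a ℕ.+ a) a≡0)))
        a<n : a ℕ.< n
        a<n = subst (a ℕ.<_) (sym n≡2a) (ℕ.m<m+n a 0<a)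

      q-odd : ∀ a → q ≢ a ℕ.+ a
      q-odd a q≡2a = contradiction (trans (sym χq) (trans (cong (λ n → χ (+ n)) q≡2a)
          (trans (χ-double a 0<a (ℕ.<-trans a<q q<p))
        (below-q a 0<a a<q)))) λ ()
        where
        0<a : 0 ℕ.< a
        0<a = ℕ.n≢0⇒n>0 λ a≡0 → ℕ.<⇒≢ 0<q (sym (trans q≡2a (cong (λ a → a ℕ.+ a) a≡0)))
        a<q : a ℕ.< q
        a<q = subst (a ℕ.<_) (sym q≡2a) (ℕ.m<m+n a 0<a)

      -- Here σ is q or -q. The inner terms n - d, n - 2d, n - 3d are smaller than n in absolute
      -- value, and q divides none of them because it does not divide d, 2d or 3d; so they are
      -- residues.
      module Spread (3∤q : ¬ 3 ℕ.∣ q) (σ : ℤ) (q∣σ : + q ℤ.∣ σ) (χσ : χ σ ≡ true) (d : ℕ) (0<d : 0 ℕ.< d)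
                    (3d<2n : 3 ℕ.* d ℕ.< n ℕ.+ n) (n≡ : + n ≡ σ + + 4 * + d) where

        q∤4d : ¬ + q ℤ.∣ + 4 * + d
        q∤4d q∣4d = q∤n (∣⇒∣ᵤ (subst (+ q ℤ.∣_) (sym n≡) (ℤ.∣m∣n⇒∣m+n q∣σ q∣4d)))

        q∤d : ¬ + q ℤ.∣ + d
        q∤d q∣d = q∤4d (ℤ.∣n⇒∣m*n (+ 4) q∣d)

        q∤2d : ¬ + q ℤ.∣ + 2 * + d
        q∤2d q∣2d = q∤4d (subst (+ q ℤ.∣_) (lem (+ d)) (ℤ.∣n⇒∣m*n (+ 2) q∣2d))
          where
          lem : ∀ d → + 2 * (+ 2 * d) ≡ + 4 * d
          lem = solve-∀

        q∤3d : ¬ + q ℤ.∣ + 3 * + d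
        q∤3d q∣3d = byResidue (q % 3) (q / 3) (m%n<n q 3) (m≡m%n+[m/n]*n q 3)
          where
          lem : ∀ r f d → r * d ≡ d * (r + f * + 3) + - f * (+ 3 * d)
          lem = solve-∀
          multiple : ∀ r f → q ≡ r ℕ.+ f ℕ.* 3 → + q ℤ.∣ + r * + d
          multiple r f e = subst (+ q ℤ.∣_) (trans (cong (λ x → + d * x + - + f * (+ 3 * + d))
              (trans (cong +_ e) (cong (λ x → + r + x) (ℤ.pos-* f 3)))) (sym (lem (+ r) (+ f) (+ d))))
            (ℤ.∣m∣n⇒∣m+n (ℤ.∣n⇒∣m*n (+ d) (ℤ.∣-refl {+ q})) (ℤ.∣n⇒∣m*n (- + f) q∣3d))
          byResidue : ∀ r f → r ℕ.< 3 → q ≡ r ℕ.+ f ℕ.* 3 → ⊥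
          byResidue 0 f _ e = 3∤q (ℕ.divides f e)
          byResidue 1 f _ e = q∤d (subst (+ q ℤ.∣_) (ℤ.*-identityˡ (+ d)) (multiple 1 f e))
          byResidue 2 f _ e = q∤2d (multiple 2 f e)
          byResidue (suc (suc (suc r))) f (s≤s (s≤s (s≤s ()))) e

        term : ∀ k l → k ℕ.+ l ≡ 4 → 1 ℕ.≤ l → l ℕ.≤ 3 → ¬ + q ℤ.∣ + k * + d → χ (σ + + k * + d) ≡ false
        term k l k+l≡4 1≤l l≤3 q∤kd = below-nℤ (σ + + k * + d)
          (subst (ℕ._< n) (cong ∣_∣ (trans (cong (λ x → + n - x) (ℤ.pos-* l d)) (trans (cong (_- + l * + d) n≡)
            (trans (cong (λ x → σ + x * + d - + l * + d) (cong +_ (sym k+l≡4))) (lem σ (+ k) (+ l) (+ d))))))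
            (∣n-e∣<n n (l ℕ.* d) (ℕ.*-mono-≤ 1≤l 0<d) (ℕ.≤-<-trans (ℕ.*-monoˡ-≤ d l≤3) 3d<2n)))
          λ q∣z → q∤kd (ℤ.∣m+n∣m⇒∣n q∣z q∣σ)
          where
          lem : ∀ σ k l d → σ + (k + l) * d - l * d ≡ σ + k * d
          lem = solve-∀

        found : Pattern
        found = forbidden false σ (+ d) χσ
          (trans (cong (λ x → χ (σ + x)) (sym (ℤ.*-identityˡ (+ d)))) (term 1 3 refl (s≤s z≤n) ℕ.≤-refl
              (λ e → q∤d (subst (+ q ℤ.∣_) (ℤ.*-identityˡ (+ d)) e))))
          (term 2 2 refl (s≤s z≤n) (from-yes (2 ℕ.≤? 3)) q∤2d)
          (term 3 1 refl (s≤s z≤n) (from-yes (1 ℕ.≤? 3)) q∤3d)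
          (trans (cong χ (sym n≡)) χn)

      3∤q⇒⊥ : ¬ 3 ℕ.∣ q → ⊥
      3∤q⇒⊥ 3∤q = byParity (parity n) (parity q)
        where
        byParity : (∃ λ a → n ≡ a ℕ.+ a ⊎ n ≡ suc (a ℕ.+ a)) → (∃ λ b → q ≡ b ℕ.+ b ⊎ q ≡ suc (b ℕ.+ b)) → ⊥
        byParity (a , inj₁ n≡) _ = n-odd a n≡
        byParity (a , inj₂ n≡) (b , inj₁ q≡) = q-odd b q≡
        byParity (a , inj₂ n≡) (b , inj₂ q≡) = gap (ℕ.m≤n⇒∃[o]m+o≡n b<a)
          where
          b<a : b ℕ.< a
          b<a = ℕ.≰⇒> λ a≤b → ℕ.<⇒≱ q<n (subst₂ ℕ._≤_ (sym n≡) (sym q≡) (s≤s (ℕ.+-mono-≤ a≤b a≤b)))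
          gap : (∃ λ c → suc b ℕ.+ c ≡ a) → ⊥
          gap (c , a≡) = halve (parity (suc c))
            where
            n≡′ : n ≡ q ℕ.+ (suc c ℕ.+ suc c)
            n≡′ = trans n≡ (trans (cong (λ a → suc (a ℕ.+ a)) (sym a≡))
                (trans (lem b c) (cong (ℕ._+ (suc c ℕ.+ suc c)) (sym q≡))))
              where
              lem : ∀ b c → suc (suc b ℕ.+ c ℕ.+ (suc b ℕ.+ c)) ≡ suc (b ℕ.+ b) ℕ.+ (suc c ℕ.+ suc c)
              lem = solveℕ-∀
            halve : (∃ λ d → suc c ≡ d ℕ.+ d ⊎ suc c ≡ suc (d ℕ.+ d)) → ⊥
            halve (zero  , inj₁ ())
            halve (d@(suc _) , inj₁ c≡) = ¬pattern (Spread.found 3∤q (+ q) ℤ.∣-refl χq d (s≤s z≤n)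
              (ℕ.<-≤-trans 3d<n (ℕ.m≤m+n n n)) (trans (cong +_ n≡″) (lem (+ q) (+ d))))
              where
              lem : ∀ q d → q + (d + d + (d + d)) ≡ q + + 4 * d
              lem = solve-∀
              n≡″ : n ≡ q ℕ.+ (d ℕ.+ d ℕ.+ (d ℕ.+ d))
              n≡″ = trans n≡′ (cong (λ c → q ℕ.+ (c ℕ.+ c)) c≡)
              3d<n : 3 ℕ.* d ℕ.< n
              3d<n = subst (3 ℕ.* d ℕ.<_) (sym (trans n≡″ (lem₂ q d))) (ℕ.m<m+n (3 ℕ.* d)
                  (ℕ.<-≤-trans 0<q (ℕ.m≤m+n q d)))
                where
                lem₂ : ∀ q d → q ℕ.+ (d ℕ.+ d ℕ.+ (d ℕ.+ d)) ≡ 3 ℕ.* d ℕ.+ (q ℕ.+ d)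
                lem₂ = solveℕ-∀
            -- Now (n - q)/2 is odd, so 4 divides n + q instead: the progression starts at -q with d
            -- = (n + q)/4, and -q is a nonresidue because -1 is a residue.
            halve (e , inj₂ c≡) = ¬pattern (Spread.found 3∤q (- + q) (ℤ.∣m⇒∣-m ℤ.∣-refl)
                (trans (χ-neg false χ-1 (small≉0 q 0<q q<p)) χq) d (s≤s z≤n)
              (subst₂ ℕ._<_ (sym (lem₃ b e)) (sym (trans (cong (λ n → n ℕ.+ n) n≡″) (lem₄ b e)))
                  (ℕ.m<m+n (3 ℕ.* b ℕ.+ 3 ℕ.* e ℕ.+ 3) {b ℕ.+ (e ℕ.+ e ℕ.+ e ℕ.+ e ℕ.+ e) ℕ.+ 3}
                  (ℕ.≤-trans (s≤s z≤n) (ℕ.m≤n+m 3 _))))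
              (trans (cong +_ n≡″) (trans (lem₅ (+ b) (+ e)) (cong (λ q → - + q + + 4 * + d) (sym q≡)))))
              where
              d = suc (b ℕ.+ e)
              n≡″ : n ≡ suc (b ℕ.+ b) ℕ.+ (suc (e ℕ.+ e) ℕ.+ suc (e ℕ.+ e))
              n≡″ = trans n≡′ (cong₂ (λ q c → q ℕ.+ (c ℕ.+ c)) q≡ c≡)
              lem₃ : ∀ b e → 3 ℕ.* suc (b ℕ.+ e) ≡ 3 ℕ.* b ℕ.+ 3 ℕ.* e ℕ.+ 3
              lem₃ = solveℕ-∀
              lem₄ : ∀ b e → suc (b ℕ.+ b) ℕ.+ (suc (e ℕ.+ e) ℕ.+ suc (e ℕ.+ e)) ℕ.+
                  (suc (b ℕ.+ b) ℕ.+ (suc (e ℕ.+ e) ℕ.+ suc (e ℕ.+ e)))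
                     ≡ 3 ℕ.* b ℕ.+ 3 ℕ.* e ℕ.+ 3 ℕ.+ (b ℕ.+ (e ℕ.+ e ℕ.+ e ℕ.+ e ℕ.+ e) ℕ.+ 3)
              lem₄ = solveℕ-∀
              lem₅ : ∀ b e → + 1 + (b + b) + (+ 1 + (e + e) + (+ 1 + (e + e))) ≡ - (+ 1 + (b + b)) + + 4 *
                  (+ 1 + (b + e))
              lem₅ = solve-∀

      -- Doubling keeps t prime to 3, and n = 18t cannot happen because 3 does not divide n; t + f
      -- stays at least n.
      doubling : ∀ f t → n ℕ.≤ t ℕ.+ f → ¬ 3 ℕ.∣ n → ¬ 3 ℕ.∣ t → 0 ℕ.< t → 9 ℕ.* t ℕ.< n →
                 ∃ λ t → ¬ 3 ℕ.∣ t × 9 ℕ.* t ℕ.< n × n ℕ.< 18 ℕ.* t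
      doubling zero    t n≤t 3∤n 3∤t 0<t 9t<n = contradiction (ℕ.≤-<-trans (ℕ.m≤n*m t 9) 9t<n)
          (ℕ.≤⇒≯ (subst (n ℕ.≤_) (ℕ.+-identityʳ t) n≤t))
      doubling (suc f) t n≤t 3∤n 3∤t 0<t 9t<n = compare (ℕ.<-≤-connex n (18 ℕ.* t))
        where
        18t≡ : ∀ t → 9 ℕ.* (t ℕ.+ t) ≡ 18 ℕ.* t
        18t≡ = solveℕ-∀
        3∣18t : 3 ℕ.∣ 18 ℕ.* t
        3∣18t = ℕ.∣m⇒∣m*n t (ℕ.divides 6 refl)
        3∤2t : ¬ 3 ℕ.∣ t ℕ.+ t
        3∤2t 3∣2t = 3∤t (ℕ.∣m+n∣m⇒∣n (subst (3 ℕ.∣_) (lem t) (ℕ.∣m∣n⇒∣m+n 3∣2t 3∣2t)) (ℕ.m∣m*n t))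
          where
          lem : ∀ t → t ℕ.+ t ℕ.+ (t ℕ.+ t) ≡ 3 ℕ.* t ℕ.+ t
          lem = solveℕ-∀
        compare : n ℕ.< 18 ℕ.* t ⊎ 18 ℕ.* t ℕ.≤ n → ∃ λ t → ¬ 3 ℕ.∣ t × 9 ℕ.* t ℕ.< n × n ℕ.< 18 ℕ.* t
        compare (inj₁ n<18t) = t , 3∤t , 9t<n , n<18t
        compare (inj₂ 18t≤n) = doubling f (t ℕ.+ t) (ℕ.≤-trans n≤t (ℕ.≤-trans (ℕ.≤-reflexive (ℕ.+-suc t f))
            (ℕ.+-monoˡ-≤ f (ℕ.m<m+n t 0<t)))) 3∤n 3∤2t
          (ℕ.≤-trans 0<t (ℕ.m≤m+n t t))
          (subst (ℕ._< n) (sym (18t≡ t)) (ℕ.≤∧≢⇒< 18t≤n λ e → 3∤n (subst (3 ℕ.∣_) e 3∣18t)))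

      -- For q = 3 a progression from q to n has another multiple of 3 inside, a step of 3d away.
      -- Another progression descends from n through 9t, where 9 is harmless, to a term that is a
      -- nonresidue because of its single factor 3.
      module Three (q≡3 : q ≡ 3) where

        χ3 : χ (+ 3) ≡ true
        χ3 = trans (cong (λ q → χ (+ q)) (sym q≡3)) χq

        3∤n : ¬ 3 ℕ.∣ n
        3∤n = subst (λ q → ¬ q ℕ.∣ n) q≡3 q∤n

        below : ∀ z → ∣ z ∣ ℕ.< n → ¬ 3 ℕ.∣ ∣ z ∣ → χ z ≡ false
        below z z<n 3∤z = below-nℤ z z<n λ q∣z → 3∤z (subst (ℕ._∣ ∣ z ∣) q≡3 (∣⇒∣ᵤ q∣z))

        3≉0 : ¬ + 3 ≈ + 0
        3≉0 = small≉0 3 (s≤s z≤n) (ℕ.<-≤-trans (from-yes (3 ℕ.<? 17)) 17≤p)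

        χ-3* : ∀ z → ¬ z ≈ + 0 → χ (+ 3 * z) ≡ not (χ z)
        χ-3* z z≉0 = trans (χ-* (+ 3) z 3≉0 z≉0) (cong (_xor χ z) χ3)

        ¬3∣⇒≉0 : ∀ z → ∣ z ∣ ℕ.< n → ¬ 3 ℕ.∣ ∣ z ∣ → ¬ z ≈ + 0
        ¬3∣⇒≉0 z z<n 3∤z = ∣small∣≉0 z (ℕ.n≢0⇒n>0 λ e → 3∤z (subst (3 ℕ.∣_) (sym e) (3 ℕ.∣0))) (ℕ.<-trans z<n n<p)

        -- The progression n, 9t, 18t - n, 27t - 2n, 3 (12t - n), where t is prime to 3.
        progression : ∀ t b c → ¬ 3 ℕ.∣ t → 0 ℕ.< b → 0 ℕ.< c → 9 ℕ.* t ℕ.+ b ≡ n → b ℕ.+ c ≡ 9 ℕ.* t → Pattern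
        progression t b c 3∤t 0<b 0<c n≡ 9t≡ = forbidden false (+ n) (- + b) χn
          (trans (cong χ (trans (lem₁ (+ t) (+ b) (+ n) nℤ) (lem₁′ (+ t))))
              (trans (χ-3* (+ 3 * + t) (unit-* 3≉0 t≉0)) (cong not (trans (χ-3* (+ t) t≉0)
              (cong not (below (+ t) t<n 3∤t))))))
          (trans (cong χ (lem₂ (+ n) (+ b))) (below (+ n - + 2 * + b) (bound 2 (s≤s z≤n) (from-yes (2 ℕ.≤? 4)))
              (∤sub₂)))
          (trans (cong χ (lem₃ (+ n) (+ b))) (below (+ n - + 3 * + b) (bound 3 (s≤s z≤n) (from-yes (3 ℕ.≤? 4)))
              (∤sub₃)))
          (trans (cong χ (lem₄ (+ n) (+ b) (+ t) nℤ)) (trans (χ-3* w (¬3∣⇒≉0 w w<n 3∤w)) (cong not (below w w<n 3∤w))))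
          where
          w : ℤ
          w = + 12 * + t - + n
          nℤ : + n ≡ + 9 * + t + + b
          nℤ = trans (cong +_ (sym n≡)) (cong (_+ + b) (ℤ.pos-* 9 t))
          lem₁ : ∀ t b n → n ≡ + 9 * t + b → n + - b ≡ + 9 * t
          lem₁ t b _ refl = lem t b
            where
            lem : ∀ t b → + 9 * t + b + - b ≡ + 9 * t
            lem = solve-∀
          lem₁′ : ∀ t → + 9 * t ≡ + 3 * (+ 3 * t)
          lem₁′ = solve-∀
          lem₂ : ∀ n b → n + + 2 * - b ≡ n - + 2 * b
          lem₂ = solve-∀
          lem₃ : ∀ n b → n + + 3 * - b ≡ n - + 3 * b
          lem₃ = solve-∀
          lem₄ : ∀ n b t → n ≡ + 9 * t + b → n + + 4 * - b ≡ + 3 * (+ 12 * t - n)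
          lem₄ _ b t refl = lem b t
            where
            lem : ∀ b t → + 9 * t + b + + 4 * - b ≡ + 3 * (+ 12 * t - (+ 9 * t + b))
            lem = solve-∀
          t<n : t ℕ.< n
          t<n = ℕ.≤-<-trans (ℕ.m≤n*m t 9) (subst (9 ℕ.* t ℕ.<_) n≡ (ℕ.m<m+n (9 ℕ.* t) 0<b))
          t≉0 : ¬ + t ≈ + 0
          t≉0 = ¬3∣⇒≉0 (+ t) t<n 3∤t
          2b<n : 2 ℕ.* b ℕ.< n
          2b<n = subst (2 ℕ.* b ℕ.<_) (trans (lem b c) (trans (cong (ℕ._+ b) 9t≡) n≡)) (ℕ.m<m+n (2 ℕ.* b) 0<c)
            where
            lem : ∀ b c → 2 ℕ.* b ℕ.+ c ≡ b ℕ.+ c ℕ.+ b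
            lem = solveℕ-∀
          4b<2n : 4 ℕ.* b ℕ.< n ℕ.+ n
          4b<2n = subst (ℕ._< n ℕ.+ n) (lem b) (ℕ.+-mono-< 2b<n 2b<n)
            where
            lem : ∀ b → 2 ℕ.* b ℕ.+ 2 ℕ.* b ≡ 4 ℕ.* b
            lem = solveℕ-∀
          bound : ∀ k → 1 ℕ.≤ k → k ℕ.≤ 4 → ∣ + n - + k * + b ∣ ℕ.< n
          bound k 1≤k k≤4 = subst (λ x → ∣ + n - x ∣ ℕ.< n) (ℤ.pos-* k b)
            (∣n-e∣<n n (k ℕ.* b) (ℕ.*-mono-≤ 1≤k 0<b) (ℕ.≤-<-trans (ℕ.*-monoˡ-≤ b k≤4) 4b<2n))
          w<n : ∣ w ∣ ℕ.< n
          w<n = ℕ.≤-<-trans (ℕ.m≤n*m ∣ w ∣ 3) (subst (ℕ._< n) (trans (cong ∣_∣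
              (trans (sym (lem (+ n) (+ b))) (lem₄ (+ n) (+ b) (+ t) nℤ))) (ℤ.abs-* (+ 3) w))
            (bound 4 (s≤s z≤n) ℕ.≤-refl))
            where
            lem : ∀ n b → n + + 4 * - b ≡ n - + 4 * b
            lem = solve-∀
          ∤via : ∀ z x y → + n ≡ x * z + + 3 * y → ¬ 3 ℕ.∣ ∣ z ∣
          ∤via z x y e 3∣z = 3∤n (∣⇒∣ᵤ (subst (+ 3 ℤ.∣_) (sym e) (ℤ.∣m∣n⇒∣m+n (ℤ.∣n⇒∣m*n x {z} (∣ᵤ⇒∣ 3∣z))
              (ℤ.∣m⇒∣m*n y (ℤ.∣-refl {+ 3})))))
          ∤sub₂ : ¬ 3 ℕ.∣ ∣ + n - + 2 * + b ∣
          ∤sub₂ = ∤via (+ n - + 2 * + b) (- + 1) (+ 6 * + t) (trans nℤ (trans (lem (+ t) (+ b))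
              (cong (λ n → - + 1 * (n - + 2 * + b) + + 3 * (+ 6 * + t)) (sym nℤ))))
            where
            lem : ∀ t b → + 9 * t + b ≡ - + 1 * (+ 9 * t + b - + 2 * b) + + 3 * (+ 6 * t)
            lem = solve-∀
          ∤sub₃ : ¬ 3 ℕ.∣ ∣ + n - + 3 * + b ∣
          ∤sub₃ = ∤via (+ n - + 3 * + b) (+ 1) (+ b) (lem (+ n) (+ b))
            where
            lem : ∀ n b → n ≡ + 1 * (n - + 3 * b) + + 3 * b
            lem = solve-∀
          3∤w : ¬ 3 ℕ.∣ ∣ w ∣
          3∤w = ∤via w (- + 1) (+ 4 * + t) (lem (+ t) (+ n))
            where
            lem : ∀ t n → n ≡ - + 1 * (+ 12 * t - n) + + 3 * (+ 4 * t)
            lem = solve-∀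

        large : 9 ℕ.< n → ⊥
        large 9<n = build (doubling n 1 (ℕ.n≤1+n n) 3∤n (λ d → ℕ.<⇒≱ (from-yes (1 ℕ.<? 3)) (ℕ.∣⇒≤ d)) ℕ.≤-refl 9<n)
          where
          build : (∃ λ t → ¬ 3 ℕ.∣ t × 9 ℕ.* t ℕ.< n × n ℕ.< 18 ℕ.* t) → ⊥
          build (t , 3∤t , 9t<n , n<18t) = go (ℕ.m≤n⇒∃[o]m+o≡n 9t<n) (ℕ.m≤n⇒∃[o]m+o≡n n<18t)
            where
            go : (∃ λ b → suc (9 ℕ.* t) ℕ.+ b ≡ n) → (∃ λ c → suc n ℕ.+ c ≡ 18 ℕ.* t) → ⊥
            go (b , n≡) (c , 18t≡) = ¬pattern (progression t (suc b) (suc c) 3∤t (s≤s z≤n) (s≤s z≤n) n≡′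
              (ℕ.+-cancelˡ-≡ (9 ℕ.* t) _ _ (trans (lem₂ t b c) (trans (cong (λ n → suc n ℕ.+ c) n≡)
                  (trans 18t≡ (lem₃ t))))))
              where
              n≡′ : 9 ℕ.* t ℕ.+ suc b ≡ n
              n≡′ = trans (ℕ.+-suc (9 ℕ.* t) b) n≡
              lem₂ : ∀ t b c → 9 ℕ.* t ℕ.+ (suc b ℕ.+ suc c) ≡ suc (suc (9 ℕ.* t) ℕ.+ b) ℕ.+ c
              lem₂ = solveℕ-∀
              lem₃ : ∀ t → 18 ℕ.* t ≡ 9 ℕ.* t ℕ.+ 9 ℕ.* t
              lem₃ = solveℕ-∀

        known : ∀ j b → χ (+ j) ≡ b → 0 ℕ.< j → j ℕ.< 17 → Known j b
        known j b e 0<j j<17 = small≉0 j 0<j (ℕ.<-≤-trans j<17 17≤p) , e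

        -- `interpret` may in principle return a model; both models make 2 a nonresidue.
        disagree : ¬ (∃ λ M → Agrees false χ-1 M 17)
        disagree (mod3  , agr) = [ (λ 3∣2 → ℕ.<⇒≱ (from-yes (2 ℕ.<? 3)) (ℕ.∣⇒≤ 3∣2)) ,
            (λ e → contradiction (trans (sym χ2) e) λ ()) ]′ (agr 2 (from-yes (2 ℕ.<? 17)))
        disagree (mod19 , agr) = [ (λ 19∣2 → ℕ.<⇒≱ (from-yes (2 ℕ.<? 19)) (ℕ.∣⇒≤ 19∣2)) ,
            (λ e → contradiction (trans (sym χ2) e) λ ()) ]′ (agr 2 (from-yes (2 ℕ.<? 17)))

        n≢5 : n ≢ 5
        n≢5 n≡5 = disagree (interpret false χ-1 17≤p argument-3-5
          (known 5 true (trans (cong (λ n → χ (+ n)) (sym n≡5)) χn) (s≤s z≤n) (from-yes (5 ℕ.<? 17)) ∷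
           known 3 true χ3 (s≤s z≤n) (from-yes (3 ℕ.<? 17)) ∷ known 2 false χ2 (s≤s z≤n)
               (from-yes (2 ℕ.<? 17)) ∷ []) ¬pattern)

        n≢7 : n ≢ 7
        n≢7 n≡7 = disagree (interpret false χ-1 17≤p argument-3-7
          (known 7 true (trans (cong (λ n → χ (+ n)) (sym n≡7)) χn) (s≤s z≤n) (from-yes (7 ℕ.<? 17)) ∷
           known 5 false (below (+ 5) (subst (5 ℕ.<_) (sym n≡7) (from-yes (5 ℕ.<? 7))) λ 3∣5 → contradiction
               (ℕ.n∣m⇒m%n≡0 5 3 3∣5) λ ()) (s≤s z≤n) (from-yes (5 ℕ.<? 17)) ∷
           known 3 true χ3 (s≤s z≤n) (from-yes (3 ℕ.<? 17)) ∷ known 2 false χ2 (s≤s z≤n)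
               (from-yes (2 ℕ.<? 17)) ∷ []) ¬pattern)

        3∣⇒⊥ : ∀ k → n ≢ k ℕ.* 3
        3∣⇒⊥ k e = 3∤n (ℕ.divides k e)

        -- The progression through 9t needs n > 9. Below that, n is odd, prime to 3 and not 1, which
        -- leaves 5 and 7 to the certificates.
        small : ∀ n′ → n ≡ n′ → n′ ℕ.< 10 → ⊥
        small 0 e _ = 3∣⇒⊥ 0 e
        small 1 e _ = contradiction (trans (sym χn) (trans (cong (λ n → χ (+ n)) e) χ1)) λ ()
        small 2 e _ = n-odd 1 e
        small 3 e _ = 3∣⇒⊥ 1 e
        small 4 e _ = n-odd 2 e
        small 5 e _ = n≢5 e
        small 6 e _ = n-odd 3 e
        small 7 e _ = n≢7 e
        small 8 e _ = n-odd 4 e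
        small 9 e _ = 3∣⇒⊥ 3 e
        small (suc (suc (suc (suc (suc (suc (suc (suc (suc (suc k)))))))))) e
            (s≤s (s≤s (s≤s (s≤s (s≤s (s≤s (s≤s (s≤s (s≤s (s≤s ()))))))))))

        impossible : ⊥
        impossible = [ small n refl , large ]′ (ℕ.<-≤-connex n 10)

      impossible : ⊥
      impossible = byDivisor (3 ∣? q)
        where
        byDivisor : Dec (3 ℕ.∣ q) → ⊥
        byDivisor (no 3∤q) = 3∤q⇒⊥ 3∤q
        byDivisor (yes (ℕ.divides 0 e)) = ℕ.<⇒≢ 0<q (sym e)
        byDivisor (yes (ℕ.divides 1 e)) = Three.impossible e
        -- A proper multiple q = 3f would be a product of two smaller numbers, hence of two
        -- residues.
        byDivisor (yes (ℕ.divides f@(suc (suc g)) e)) = contradiction (trans (sym χq)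
            (trans (cong χ (trans (cong +_ e) (ℤ.pos-* f 3)))
          (trans (χ-* (+ f) (+ 3) (small≉0 f (s≤s z≤n) (ℕ.<-trans f<q q<p)) (small≉0 3 (s≤s z≤n) (ℕ.<-trans 3<q q<p)))
            (cong₂ _xor_ (below-q f (s≤s z≤n) f<q) (below-q 3 (s≤s z≤n) 3<q))))) λ ()
          where
          f<q : f ℕ.< q
          f<q = subst (f ℕ.<_) (sym e) (ℕ.m<m*n f 3 (s≤s (s≤s z≤n)))
          3<q : 3 ℕ.< q
          3<q = subst (3 ℕ.<_) (sym e) (s≤s (s≤s (s≤s (s≤s z≤n))))

    contradictory : ⊥
    contradictory = [ first , (λ none → nonresidue λ j 0<j j<p → notTrue j (λ χj → none j j<p (0<j , χj))) ]′
      (search (λ j → (0 ℕ.<? j) ×-dec (χ (+ j) Bool.≟ true)) pℕ)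
      where
      notTrue : ∀ j → χ (+ j) ≢ true → χ (+ j) ≡ false
      notTrue j ¬t = Bool.¬-not ¬t
      first : (∃ λ q → q ℕ.< pℕ × (0 ℕ.< q × χ (+ q) ≡ true) × (∀ i → i ℕ.< q → ¬ (0 ℕ.< i × χ (+ i) ≡ true))) → ⊥
      first (q , q<p , (0<q , χq) , below-q) = [ second , (λ none → reflect (ℕ.m≤n⇒∃[o]m+o≡n (ℕ.<⇒≤ q<p)) none) ]′
        (search (λ j → ¬? (q ∣? j) ×-dec (χ (+ j) Bool.≟ true)) pℕ)
        where
        second : (∃ λ n → n ℕ.< pℕ × (¬ q ℕ.∣ n × χ (+ n) ≡ true) × (∀ i → i ℕ.< n → ¬
            (¬ q ℕ.∣ i × χ (+ i) ≡ true))) → ⊥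
        second (n , n<p , (q∤n , χn) , below-n) = TwoNonresidues.impossible q 0<q q<p χq
          (λ i 0<i i<q → notTrue i (λ e → below-q i i<q (0<i , e))) n n<p q∤n χn
          (λ i i<n q∤i → notTrue i (λ e → below-n i i<n (q∤i , e)))
        -- Since -1 is a residue, p - q is a nonresidue, and q cannot divide it without dividing p.
        reflect : (∃ λ d → q ℕ.+ d ≡ pℕ) → ¬ (∀ k → k ℕ.< pℕ → ¬ (¬ q ℕ.∣ k × χ (+ k) ≡ true))
        reflect (d , q+d≡p) none = none d (subst (d ℕ.<_) q+d≡p (ℕ.m<n+m d 0<q)) (q∤d , trans χd χq)
          where
          q∤d : ¬ q ℕ.∣ d
          q∤d q∣d = [ (λ { refl → contradiction (trans (sym χq) χ1) λ () }) , (λ e → ℕ.<⇒≢ q<p e) ]′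
            (prime⇒irreducible isPrime (subst (q ℕ.∣_) q+d≡p (ℕ.∣m∣n⇒∣m+n ℕ.∣-refl q∣d)))
          χd : χ (+ d) ≡ χ (+ q)
          χd = trans (χ-cong { + d} { - + q} (- + 1 , trans (lem (+ q) (+ d))
              (cong (λ x → + d + - + 1 * x) (trans (cong +_ q+d≡p) +p≡P))))
            (χ-neg false χ-1 (small≉0 q 0<q q<p))
            where
            lem : ∀ q d → - q ≡ d + - + 1 * (q + d)
            lem = solve-∀

-- Order 19

orbit : ∀ {n} → (Fin n → Fin n) → Fin n → ℕ → List (Fin n)
orbit f x zero    = []
orbit f x (suc k) = x ∷ orbit f (f x) k

∈orbit⇒reach : ∀ {n} (f : Fin n → Fin n) {x y} k → y ∈ₗ orbit f x k → Reach f x y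
∈orbit⇒reach f (suc k) (here refl) = 0 , refl
∈orbit⇒reach f (suc k) (there y∈) with l , e ← ∈orbit⇒reach f k y∈ = suc l , e

Spans : ∀ {n} → (Fin (suc n) → Fin (suc n)) → Set
Spans {n} f = ∀ y → y ∈ₗ orbit f fzero (suc n)

spans? : ∀ {n} (f : Fin (suc n) → Fin (suc n)) → Dec (Spans f)
spans? {n} f = within? (orbit f fzero (suc n))
  where
  open import Data.List.Membership.DecPropositional (_≟_ {suc n}) using (_∈?_)
  within? : ∀ l → Dec (∀ y → y ∈ₗ l)
  within? l = all? λ y → y ∈? l

-- The orbit of 0 alone suffices, as reachability is symmetric; r gives the row permutations in a
-- form suited to computation.
spans⇒rowHamiltonian : ∀ {n} (L : LatinSquare (suc n)) (r : Fin (suc n) → Fin (suc n) → Fin (suc n) → Fin (suc n)) →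
  (∀ i j x → r i j x ≡ rowPermutation L i j x) → (∀ i j → i ≡ j ⊎ Spans (r i j)) → RowHamiltonian L
spans⇒rowHamiltonian {n} L r r≡ spans = reach⇒rowHamiltonian L λ i j i≢j →
  reach-from (rowPermutation L i j) (rowPermutation-injective L i j) fzero λ y →
    transport i j (∈orbit⇒reach (r i j) (suc n) ([ (λ i≡j → contradiction i≡j i≢j) , (λ s → s y) ]′ (spans i j)))
  where
  iterate-≡ : ∀ i j x k → iterate (r i j) x k ≡ iterate (rowPermutation L i j) x k
  iterate-≡ i j x zero    = refl
  iterate-≡ i j x (suc k) = trans (iterate-≡ i j (r i j x) k) (cong (λ y → iterate (rowPermutation L i j) y k)
      (r≡ i j x))
  transport : ∀ i j {x y} → Reach (r i j) x y → Reach (rowPermutation L i j) x y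
  transport i j {x} (k , e) = k , trans (sym (iterate-≡ i j x k)) e

shiftBy : Vec ℕ 19 → Fin 19 → Fin 19 → Fin 19
shiftBy table i k = (toℕ i ℕ.+ lookup table ((toℕ k ℕ.+ (19 ℕ.∸ toℕ i)) mod 19)) mod 19

-- A cyclotomic orthomorphism of index 6: δ ↦ a δ on the powers of 2 whose exponent is c modulo 6, where a is the entry
-- number c of (3, 14, 8, 7, 11, 14).
entryShift columnShift rowShift transposedShift : Vec ℕ 19
entryShift = 0 ∷ 3 ∷ 9 ∷ 4 ∷ 13 ∷ 17 ∷ 10 ∷ 2 ∷ 18 ∷ 15 ∷ 7 ∷ 14 ∷ 8 ∷ 11 ∷ 6 ∷ 1 ∷ 5 ∷ 16 ∷ 12 ∷ []
columnShift      = 0 ∷ 15 ∷ 7 ∷ 1 ∷ 3 ∷ 16 ∷ 14 ∷ 10 ∷ 12 ∷ 2 ∷ 6 ∷ 13 ∷ 18 ∷ 4 ∷ 11 ∷ 9 ∷ 17 ∷ 5 ∷ 8 ∷ []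
rowShift         = 0 ∷ 16 ∷ 18 ∷ 8 ∷ 13 ∷ 4 ∷ 10 ∷ 17 ∷ 3 ∷ 15 ∷ 11 ∷ 5 ∷ 14 ∷ 1 ∷ 12 ∷ 7 ∷ 9 ∷ 6 ∷ 2 ∷ []
transposedShift   = 0 ∷ 13 ∷ 18 ∷ 8 ∷ 5 ∷ 11 ∷ 17 ∷ 15 ∷ 3 ∷ 16 ∷ 6 ∷ 10 ∷ 14 ∷ 4 ∷ 12 ∷ 9 ∷ 1 ∷ 7 ∷ 2 ∷ []

square19 : LatinSquare 19
square19 = record
  { entry        = entry₁₉
  ; onceInRow    = λ i s → shiftBy columnShift i s , row i s , λ {j} e → trans (cong (shiftBy columnShift i) (sym e))
      (row′ i j)
  ; onceInColumn = λ j s → shiftBy rowShift j s , column j s , λ {i} e → trans (cong (shiftBy rowShift j) (sym e))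
      (column′ j i)
  }
  where
  entry₁₉ = shiftBy entryShift
  row : ∀ i s → entry₁₉ i (shiftBy columnShift i s) ≡ s
  row = from-yes (all? λ i → all? λ s → entry₁₉ i (shiftBy columnShift i s) ≟ s)
  row′ : ∀ i j → shiftBy columnShift i (entry₁₉ i j) ≡ j
  row′ = from-yes (all? λ i → all? λ j → shiftBy columnShift i (entry₁₉ i j) ≟ j)
  column : ∀ j s → entry₁₉ (shiftBy rowShift j s) j ≡ s
  column = from-yes (all? λ j → all? λ s → entry₁₉ (shiftBy rowShift j s) j ≟ s)
  column′ : ∀ j i → shiftBy rowShift j (entry₁₉ i j) ≡ i
  column′ = from-yes (all? λ j → all? λ i → shiftBy rowShift j (entry₁₉ i j) ≟ i)

rows₁₉ : RowHamiltonian square19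
rows₁₉ = spans⇒rowHamiltonian square19 (λ i j x → shiftBy entryShift j (shiftBy columnShift i x)) (λ _ _ _ → refl)
  (from-yes (all? λ i → all? λ j → (i ≟ j) ⊎-dec spans? (λ x → shiftBy entryShift j (shiftBy columnShift i x))))

transposed≡ : ∀ i j → shiftBy transposedShift i j ≡ shiftBy entryShift j i
transposed≡ = from-yes (all? λ i → all? λ j → shiftBy transposedShift i j ≟ shiftBy entryShift j i)

rowPermutation-swap : ∀ {n} (L : LatinSquare n) i j x → rowPermutation (swapRowsColumns L) i j x ≡ entry L
    (rowOf L i x) j
rowPermutation-swap L i j x = refl

entry≡ : ∀ i j → entry square19 i j ≡ shiftBy entryShift i j
entry≡ i j = refl

rowOf≡ : ∀ j s → rowOf square19 j s ≡ shiftBy rowShift j s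
rowOf≡ j s = refl

columnPermutation : ∀ i j x → shiftBy transposedShift j (shiftBy rowShift i x) ≡ rowPermutation
    (swapRowsColumns square19) i j x
columnPermutation i j x = trans (transposed≡ j (shiftBy rowShift i x)) (sym (trans (rowPermutation-swap square19 i j x)
    (trans (cong (λ y → entry square19 y j) (rowOf≡ i x)) (entry≡ (shiftBy rowShift i x) j))))

spanning : ∀ i j → i ≡ j ⊎ Spans (λ x → shiftBy transposedShift j (shiftBy rowShift i x))
spanning = from-yes (all? λ i → all? λ j → (i ≟ j) ⊎-dec spans? (λ x → shiftBy transposedShift j
    (shiftBy rowShift i x)))

columns₁₉-for : ∀ (L : LatinSquare 19) → (∀ i j x → shiftBy transposedShift j
    (shiftBy rowShift i x) ≡ rowPermutation L i j x) → RowHamiltonian L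
columns₁₉-for L r≡ = spans⇒rowHamiltonian L (λ i j x → shiftBy transposedShift j (shiftBy rowShift i x)) r≡ spanning

columns₁₉ : RowHamiltonian (swapRowsColumns square19)
columns₁₉ = columns₁₉-for (swapRowsColumns square19) columnPermutation

¬symbols₁₉ : ¬ RowHamiltonian (swapRowsColumns (swapColumnsSymbols square19))
-- Between the symbols 0 and 2, column 1 returns after three steps.
¬symbols₁₉ = ¬rowHamiltonian (swapRowsColumns (swapColumnsSymbols square19)) {# 0} {# 2} (λ ()) (# 1) 2
    (from-yes (3 ℕ.<? 19)) refl

∃ν≡4₁₉ : ∃ λ (L : LatinSquare 19) → ν L ≡ 4
∃ν≡4₁₉ = ∃ν≡4 square19 rows₁₉ columns₁₉ ¬symbols₁₉

-- From a pattern to a Latin square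

module FromPattern (m : ℕ) (isPrime : Prime (suc (m ℕ.+ m)))
    (χ-1≡χ2 : Legendre.χ m isPrime -1ℤ ≡ Legendre.χ m isPrime (+ 2)) where

  open Residues m
  open Legendre m isPrime
  open Rigidity m isPrime

  2≉0 : ¬ + 2 ≈ + 0
  2≉0 = small≉0 2 (s≤s z≤n) (s≤s (ℕ.+-mono-≤ 1≤m 1≤m))

  χ-[-2] : ∀ x → χ (- (+ 2) * x) ≡ χ x
  χ-[-2] x = byZero (x ≈? + 0)
    where
    lem : ∀ x → - (+ 2) * x ≡ - + 1 * (+ 2 * x)
    lem = solve-∀
    byZero : Dec (x ≈ + 0) → χ (- (+ 2) * x) ≡ χ x
    byZero (yes x≈0) = trans (χ-cong (*-≈ (- (+ 2)) x≈0)) (sym (χ-cong x≈0))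
    byZero (no x≉0)  = trans (cong χ (lem x)) (trans (χ-* -1ℤ (+ 2 * x) (unit-neg 1≉0) (unit-* 2≉0 x≉0))
      (trans (cong₂ _xor_ χ-1≡χ2 (χ-* (+ 2) x 2≉0 x≉0)) (cancel-xor (χ (+ 2)) (χ x))))
      where
      cancel-xor : ∀ a b → a xor (a xor b) ≡ b
      cancel-xor a b = trans (sym (Bool.xor-assoc a a b)) (cong (_xor b) (Bool.xor-same a))

  -- Only a and d modulo p matter, so a pattern can be searched for; this turns the refuted absence
  -- into an actual pattern.
  Pattern? : Dec Pattern
  Pattern? = map′ (λ (i , j , p) → unpack (τ i) (τ j) p) pack (any? λ i → any? λ j → at? true (τ i)
      (τ j) ⊎-dec at? false (τ i) (τ j))
    where
    At : Bool → ℤ → ℤ → Set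
    At b a d = χ a ≡ not b × χ (a + d) ≡ b × χ (a + + 2 * d) ≡ b × χ (a + + 3 * d) ≡ b × χ (a + + 4 * d) ≡ not b
    at? : ∀ b a d → Dec (At b a d)
    at? b a d = (χ a Bool.≟ not b) ×-dec (χ (a + d) Bool.≟ b) ×-dec (χ (a + + 2 * d) Bool.≟ b) ×-dec
        (χ (a + + 3 * d) Bool.≟ b) ×-dec (χ (a + + 4 * d) Bool.≟ not b)
    unpack : ∀ a d → At true a d ⊎ At false a d → Pattern
    unpack a d (inj₁ (v₀ , v₁ , v₂ , v₃ , v₄)) = forbidden true a d v₀ v₁ v₂ v₃ v₄
    unpack a d (inj₂ (v₀ , v₁ , v₂ , v₃ , v₄)) = forbidden false a d v₀ v₁ v₂ v₃ v₄
    reduce : ∀ b a d → At b a d → At b (τ (ι a)) (τ (ι d))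
    reduce b a d (v₀ , v₁ , v₂ , v₃ , v₄) = trans (sym (χ-cong (τι a))) v₀ , trans (sym (χ-cong (+-cong (τι d)))) v₁ ,
      trans (sym (χ-cong (+-cong (*-≈ (+ 2) (τι d))))) v₂ , trans (sym (χ-cong (+-cong (*-≈ (+ 3) (τι d))))) v₃ ,
      trans (sym (χ-cong (+-cong (*-≈ (+ 4) (τι d))))) v₄
      where
      +-cong : ∀ {x y} → x ≈ y → a + x ≈ τ (ι a) + y
      +-cong {x} {y} e = ≈-trans (+-≈ x (τι a)) (≈-trans (≡⇒≈ (ℤ.+-comm (τ (ι a)) x))
          (≈-trans (+-≈ (τ (ι a)) e) (≡⇒≈ (ℤ.+-comm y (τ (ι a))))))
    pack : Pattern → ∃₂ λ i j → At true (τ i) (τ j) ⊎ At false (τ i) (τ j)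
    pack (forbidden true  a d v₀ v₁ v₂ v₃ v₄) = ι a , ι d , inj₁ (reduce true a d (v₀ , v₁ , v₂ , v₃ , v₄))
    pack (forbidden false a d v₀ v₁ v₂ v₃ v₄) = ι a , ι d , inj₂ (reduce false a d (v₀ , v₁ , v₂ , v₃ , v₄))

  -- Interchanging the two colours turns the pattern N S S S N into S N N N S.
  pattern⇒latinSquare : 3 ℕ.< pℕ → Pattern → ∃ λ (L : LatinSquare pℕ) → ν L ≡ 4
  pattern⇒latinSquare 3<p (forbidden b a d v₀ v₁ v₂ v₃ v₄) =
    pattern⇒∃ν≡4 m colour (λ x k → cong (λ c → not (c xor b)) (χ-periodic x k))
        (λ x → cong (λ c → not (c xor b)) (χ-[-2] x)) inverse (a + + 2 * d) d
      (end (lem₀ a d) v₀) (middle (lem₁ a d) v₁) (middle refl v₂) (middle (lem₃ a d) v₃) (end (lem₄ a d) v₄) 3<p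
    where
    colour : ℤ → Bool
    colour x = not (χ x xor b)
    end : ∀ {x y} → x ≡ y → χ y ≡ not b → colour x ≡ false
    end refl e = trans (cong (λ c → not (c xor b)) e) (opposite b)
      where
      opposite : ∀ b → not (not b xor b) ≡ false
      opposite false = refl
      opposite true  = refl
    middle : ∀ {x y} → x ≡ y → χ y ≡ b → colour x ≡ true
    middle refl e = trans (cong (λ c → not (c xor b)) e) (cong not (Bool.xor-same b))
    lem₀ : ∀ a d → a + + 2 * d - + 2 * d ≡ a
    lem₀ = solve-∀
    lem₁ : ∀ a d → a + + 2 * d - d ≡ a + d
    lem₁ = solve-∀
    lem₃ : ∀ a d → a + + 2 * d + d ≡ a + + 3 * d
    lem₃ = solve-∀
    lem₄ : ∀ a d → a + + 2 * d + + 2 * d ≡ a + + 4 * d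
    lem₄ = solve-∀

  unavoidable⇒latinSquare : 3 ℕ.< pℕ → ¬ ¬ Pattern → ∃ λ (L : LatinSquare pℕ) → ν L ≡ 4
  unavoidable⇒latinSquare 3<p ¬¬pattern = pattern⇒latinSquare 3<p (decidable-stable Pattern? ¬¬pattern)

-- The values at -1 and 2, and the orders

module _ (v : ℕ) (isPrime : Prime (suc (v ℕ.+ v ℕ.+ (v ℕ.+ v)))) where
  open Residues (v ℕ.+ v)
  open Legendre (v ℕ.+ v) isPrime

  χ-1-even : χ -1ℤ ≡ false
  χ-1-even = χ-false { -1ℤ} (≡⇒≈ (-1^even v))

  χ2-even : ∀ k → v ≡ k ℕ.+ k → χ (+ 2) ≡ false
  χ2-even k v≡ = χ-false {+ 2} (≈-trans (2^m v v refl (evens*odds v)) (≡⇒≈ (trans (cong (-1ℤ ^_) v≡) (-1^even k))))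

module _ (v : ℕ) (isPrime : Prime (suc (suc (v ℕ.+ v) ℕ.+ suc (v ℕ.+ v)))) where
  open Residues (suc (v ℕ.+ v))
  open Legendre (suc (v ℕ.+ v)) isPrime

  χ-1-odd : χ -1ℤ ≡ true
  χ-1-odd = χ-true { -1ℤ} (≡⇒≈ (-1^odd v))

  χ2-odd : ∀ k → v ≡ k ℕ.+ k → χ (+ 2) ≡ true
  χ2-odd k v≡ = χ-true {+ 2} (≈-trans (2^m v (suc v) (ℕ.+-suc v v) (evens*odds⁺ v))
      (≡⇒≈ (trans (cong (λ v → -1ℤ ^ suc v) v≡) (-1^odd k))))

Solution : ℕ → Set
Solution p = ∃ λ (L : LatinSquare p) → ν L ≡ 4

module _ (m : ℕ) (isPrime : Prime (suc (m ℕ.+ m))) where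
  open Legendre m isPrime

  evenSolution : χ -1ℤ ≡ false → χ (+ 2) ≡ false → 17 ℕ.≤ suc (m ℕ.+ m) → Solution (suc (m ℕ.+ m))
  evenSolution χ-1 χ2 17≤p = FromPattern.unavoidable⇒latinSquare m isPrime (trans χ-1 (sym χ2))
      (ℕ.≤-trans (from-yes (4 ℕ.≤? 17)) 17≤p)
    (Nonresidues.Even.contradictory m isPrime χ-1 χ2 17≤p)

  oddSolution : χ -1ℤ ≡ true → χ (+ 2) ≡ true → 43 ℕ.≤ suc (m ℕ.+ m) → Solution (suc (m ℕ.+ m))
  oddSolution χ-1 χ2 43≤p = FromPattern.unavoidable⇒latinSquare m isPrime (trans χ-1 (sym χ2))
      (ℕ.≤-trans (from-yes (4 ℕ.≤? 43)) 43≤p)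
    (Rigidity.Odd.contradictory m isPrime χ-1 χ2 43≤p)

order8k+1 : ∀ v k → v ≡ k ℕ.+ k → 2 ℕ.≤ k → Prime (suc (v ℕ.+ v ℕ.+ (v ℕ.+ v))) → Solution (suc (v ℕ.+ v ℕ.+ (v ℕ.+ v)))
order8k+1 v k v≡2k 2≤k isPrime = evenSolution (v ℕ.+ v) isPrime (χ-1-even v isPrime) (χ2-even v isPrime k v≡2k)
  (s≤s (ℕ.+-mono-≤ (ℕ.+-mono-≤ 4≤v 4≤v) (ℕ.+-mono-≤ 4≤v 4≤v)))
  where
  4≤v : 4 ℕ.≤ v
  4≤v = subst (4 ℕ.≤_) (sym v≡2k) (ℕ.+-mono-≤ 2≤k 2≤k)

order8k+3 : ∀ v k → v ≡ k ℕ.+ k → 5 ℕ.≤ k → Prime (suc (suc (v ℕ.+ v) ℕ.+ suc (v ℕ.+ v))) → Solution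
    (suc (suc (v ℕ.+ v) ℕ.+ suc (v ℕ.+ v)))
order8k+3 v k v≡2k 5≤k isPrime = oddSolution (suc (v ℕ.+ v)) isPrime (χ-1-odd v isPrime) (χ2-odd v isPrime k v≡2k)
  (s≤s (ℕ.+-mono-≤ (s≤s (ℕ.+-mono-≤ 10≤v 10≤v)) (s≤s (ℕ.+-mono-≤ 10≤v 10≤v))))
  where
  10≤v : 10 ℕ.≤ v
  10≤v = subst (10 ℕ.≤_) (sym v≡2k) (ℕ.+-mono-≤ 5≤k 5≤k)

-- 11 lies below the bound 43 of the search, but 5, 6, 7, 8, 9 is a pattern. Each integer is the
-- quotient c with x^5 + 11 c equal to 1 or -1.
order11 : Prime 11 → Solution 11
order11 isPrime = FromPattern.pattern⇒latinSquare 5 isPrime (trans (χ-1-odd 2 isPrime)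
    (sym (χ2-odd 2 isPrime 1 refl))) (from-yes (4 ℕ.≤? 11))
  (forbidden true (+ 5) (+ 1)
    (χ-false {+ 5} ((- + 284) , refl)) (χ-true {+ 6} ((- + 707) , refl)) (χ-true {+ 7} ((- + 1528) , refl))
    (χ-true {+ 8} ((- + 2979) , refl)) (χ-false {+ 9} ((- + 5368) , refl)))
  where
  open Residues 5
  open Legendre 5 isPrime

theorem1p1 : ∀ (p : ℕ) → Prime p → p > 3 → (p % 8 ≡ 1 ⊎ p % 8 ≡ 3) → ∃ λ (L : LatinSquare p) → ν L ≡ 4
theorem1p1 p isPrime p>3 (inj₁ p%8≡1) = go (p / 8) (trans (m≡m%n+[m/n]*n p 8) (cong (ℕ._+ p / 8 ℕ.* 8) p%8≡1))
  where
  go : ∀ k → p ≡ 1 ℕ.+ k ℕ.* 8 → Solution p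
  go 0 p≡ = contradiction (subst (3 ℕ.<_) p≡ p>3) (from-no (3 ℕ.<? 1))
  go 1 p≡ = contradiction (subst Prime p≡ isPrime) (from-no (prime? 9))
  go k@(suc (suc _)) p≡ = subst Solution (sym p≡′) (order8k+1 (k ℕ.+ k) k refl (s≤s (s≤s z≤n))
      (subst Prime p≡′ isPrime))
    where
    lem : ∀ k → 1 ℕ.+ k ℕ.* 8 ≡ suc (k ℕ.+ k ℕ.+ (k ℕ.+ k) ℕ.+ (k ℕ.+ k ℕ.+ (k ℕ.+ k)))
    lem = solveℕ-∀
    p≡′ = trans p≡ (lem k)
theorem1p1 p isPrime p>3 (inj₂ p%8≡3) = go (p / 8) (trans (m≡m%n+[m/n]*n p 8) (cong (ℕ._+ p / 8 ℕ.* 8) p%8≡3))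
  where
  go : ∀ k → p ≡ 3 ℕ.+ k ℕ.* 8 → Solution p
  go 0 p≡ = contradiction (subst (3 ℕ.<_) p≡ p>3) (from-no (3 ℕ.<? 3))
  go 1 p≡ = subst Solution (sym p≡) (order11 (subst Prime p≡ isPrime))
  go 2 p≡ = subst Solution (sym p≡) ∃ν≡4₁₉
  go 3 p≡ = contradiction (subst Prime p≡ isPrime) (from-no (prime? 27))
  go 4 p≡ = contradiction (subst Prime p≡ isPrime) (from-no (prime? 35))
  -- From k = 5 on, p is at least 43, so all numbers that the search uses as units are below p.
  go k@(suc (suc (suc (suc (suc _))))) p≡ = subst Solution (sym p≡′) (order8k+3 (k ℕ.+ k) k refl
      (s≤s (s≤s (s≤s (s≤s (s≤s z≤n))))) (subst Prime p≡′ isPrime))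
    where
    lem : ∀ k → 3 ℕ.+ k ℕ.* 8 ≡ suc (suc (k ℕ.+ k ℕ.+ (k ℕ.+ k)) ℕ.+ suc (k ℕ.+ k ℕ.+ (k ℕ.+ k)))
    lem = solveℕ-∀
    p≡′ = trans p≡ (lem k)
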